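{- There is an algorithm which, given a place/transition net $\mathrm{S}=(P,T,F,M_0)$ and a pair of transitions $a,b\in T$, decides whether there exists $\mathrm{k}\in\mathbb{N}$ such that $a$ postpones an enabled $b$ for at most $\mathrm{k}$ steps, and if so computes the minimum such number $\mathrm{k}_{a,b}$. Here "$a$ postpones an enabled $b$ for at most $\mathrm{k}$ steps" means: for every reachable marking $M\in[M_0\rangle$ with $Ma$ and $Mb$ there exists $w\in T^*$ with $|w|\le\mathrm{k}$ and $Mawb$.
   Context: A place/transition net (p/t-net) is $\mathrm{S}=(P,T,F,M_0)$ where $P$ (places) and $T$ (transitions) are finite disjoint sets, $F\subseteq P\times T\cup T\times P$ is the flow relation, and $M_0\in\mathbb{N}^P$ is the initial marking. Markings are vectors in $\mathbb{N}^P$, ordered and added componentwise. For $a\in T$, ${}^\bullet a\in\mathbb{N}^P$ is the vector with $1$ at places $p$ with $(p,a)\in F$ and $0$ elsewhere; $a^\bullet$ is the vector with $1$ at places $p$ with $(a,p)\in F$ and $0$ elsewhere. A transition $a$ is enabled in $M$ (written $Ma$) iff ${}^\bullet a\le M$; then firing $a$ yields $M'=(M-{}^\bullet a)+a^\bullet$ (written $MaM'$). This is extended to strings $w\in T^*$: $M\varepsilon M$, and $MvaM''$ iff $MvM'$ and $M'aM''$ for some $M'$; $Mw$ means $MwM'$ for some $M'$. The set $[M_0\rangle$ of reachable markings consists of all $M'$ with $M_0wM'$ for some $w\in T^*$. -}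

module Defs where

open import Data.Nat using (ℕ; _+_; _∸_; _≤_)
open import Data.Bool using (Bool; true; false)
open import Data.Fin using (Fin)
open import Data.List using (List; []; _∷_; _∷ʳ_; length)
open import Data.Product using (Σ; ∃; _×_; _,_)
open import Data.Sum using (_⊎_)
open import Relation.Nullary using (¬_)

-- A p/t-net with places P = Fin np and transitions T = Fin nt.
-- The flow relation F ⊆ P×T ∪ T×P is given by its two characteristic
-- functions: pre t p = true iff (p,t) ∈ F, post t p = true iff (t,p) ∈ F.
record Net : Set where
  field
    np   : ℕ
    nt   : ℕ
    pre  : Fin nt → Fin np → Bool
    post : Fin nt → Fin np → Bool
    M₀   : Fin np → ℕ
open Net public

Place : Net → Set
Place S = Fin (np S)

Transition : Net → Set
Transition S = Fin (nt S)

Marking : Net → Set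
Marking S = Place S → ℕ

b2n : Bool → ℕ
b2n true  = 1
b2n false = 0

•_ : {S : Net} → Transition S → Marking S
•_ {S} a p = b2n (pre S a p)

_• : {S : Net} → Transition S → Marking S
_• {S} a p = b2n (post S a p)

_≤M_ : {S : Net} → Marking S → Marking S → Set
_≤M_ {S} M M' = ∀ (p : Place S) → M p ≤ M' p

Enabled : (S : Net) → Marking S → Transition S → Set
Enabled S M a = _≤M_ {S} (•_ {S} a) M

fire : (S : Net) → Marking S → Transition S → Marking S
fire S M a p = (M p ∸ (•_ {S} a) p) + (_• {S} a) p

data Fires (S : Net) : Marking S → List (Transition S) → Marking S → Set where
  fires-ε : ∀ {M} → Fires S M [] M
  fires-∷ : ∀ {M a w M''} → Enabled S M a →
            Fires S (fire S M a) w M'' → Fires S M (a ∷ w) M''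

Firable : (S : Net) → Marking S → List (Transition S) → Set
Firable S M w = ∃ λ M' → Fires S M w M'

Reachable : (S : Net) → Marking S → Set
Reachable S M = ∃ λ w → Fires S (M₀ S) w M

Postpones : (S : Net) → Transition S → Transition S → ℕ → Set
Postpones S a b k =
  ∀ (M : Marking S) → Reachable S M → Enabled S M a → Enabled S M b →
  Σ (List (Transition S)) λ w → length w ≤ k × Firable S M ((a ∷ w) ∷ʳ b)

MinPostponement : (S : Net) → Transition S → Transition S → Set
MinPostponement S a b =
  (Σ ℕ λ k → Postpones S a b k × (∀ k' → Postpones S a b k' → k ≤ k'))
  ⊎ ¬ (∃ λ k → Postpones S a b k)

{-# OPTIONS --safe #-}
module Submission where

-- The theorem contains the reachability problem, which is decided by the method of Kosaraju,
-- Mayr and Lambert, with regular expressions (Seq) in place of graphs. A problem is a sequence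
-- of letters and stars, and multiplicities of star alternatives turn it into a linear system.
-- Let h be a homogeneous solution of maximal support.
--   * If h does not use some alternative, that alternative occurs boundedly often in every run
--     and can be unrolled.
--   * If the coordinates that are bounded at the entry (or exit) of a star cannot be increased
--     simultaneously by a word of the star, Rackoff's argument bounds one of them along every
--     run; Kleene's construction moves its value into the expression and freezes it.
--   * Otherwise words increasing at the entry, multiples of h and words decreasing to the exit
--     combine to a run.
-- The first two cases replace a star by stars with fewer unfrozen coordinates or, with equally
-- many, fewer alternatives, so the procedure terminates.
-- Rackoff's argument also bounds, uniformly in the marking, the length of a shortest w with
-- M a w b; so only one value of k has to be tested for existence. Whether w of length ≤ k exists
-- depends only on M truncated at k + 2, which reduces the test to reachability.

open import Defs
open import Data.Bool using (Bool; true; false)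
import Data.Bool.Properties as Boolₚ
open import Data.Empty using (⊥; ⊥-elim)
open import Data.Fin using (Fin; zero; suc; punchIn; punchOut)
import Data.Fin.Properties as Finₚ
open import Data.List as List using (List; []; _∷_; _++_; _∷ʳ_; map; concatMap; length;
  filter; allFin; upTo; cartesianProductWith; reverse)
open import Data.List.Membership.Propositional using (_∈_; find; lose)
open import Data.List.Membership.Propositional.Properties
open import Data.List.Properties
  using (++-assoc; ++-identityʳ; ∷-injective; length-++; length-reverse; unfold-reverse; reverse-++;
      reverse-involutive)
open import Data.List.Relation.Unary.All as All using (All; []; _∷_)
import Data.List.Relation.Unary.All.Properties as Allₚ
open import Data.List.Relation.Unary.AllPairs using (_∷_)
open import Data.List.Relation.Unary.Any as Any using (Any; here; there)
open import Data.List.Relation.Unary.Unique.Propositional using (Unique)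
open import Data.List.Relation.Unary.Unique.Propositional.Properties using (allFin⁺)
open import Data.Maybe using (Maybe; just; nothing; is-just)
open import Data.Maybe.Properties using (just-injective)
open import Data.Nat
open import Data.Nat.Induction using (<-wellFounded)
open import Data.Nat.Properties
open import Algebra.Properties.CommutativeSemigroup +-commutativeSemigroup using (interchange)
open import Data.Nat.Tactic.RingSolver using (solve-∀)
open import Data.Product using (Σ; ∃; _×_; _,_; proj₁; proj₂)
open import Data.Sum as Sum using (_⊎_; inj₁; inj₂)
open import Data.Unit using (⊤; tt)
open import Data.Vec as Vec using (Vec; []; _∷_; zipWith; replicate; lookup; tabulate)
import Data.Vec.Properties as Vecₚ
open import Data.Vec.Properties using (lookup∘tabulate; lookup-zipWith)
open import Function using (_∘_; id; case_of_)
open import Induction.WellFounded using (Acc; acc)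
open import Relation.Binary.Definitions using (DecidableEquality; Tri; tri<; tri≈; tri>)
open import Relation.Binary.PropositionalEquality
open import Relation.Nullary
open import Relation.Nullary.Decidable using (map′; decidable-stable)
open import Relation.Unary using (Decidable)

-- Linear systems over ℕ

-- The first two cases give finite covers because every run solves the linear system, and an
-- additive quantity with values in ℕ that vanishes on h can take only the values it has on finitely
-- many base solutions. The number of uses of alternatives missing from h is such a quantity. So is
-- the entry or exit value of a star at a coordinate where h is 0; this is the meaning of "bounded"
-- there. Knowing these values, one can search for an increasing word from a fixed starting point,
-- and a failed search bounds a coordinate in every run that agrees with them.
--
-- Regular expressions make realizability easy: in a graph a multiplicity vector belongs to a path
-- only if it is balanced and connected, whereas the iterations of a star may come in any order, so
-- positive multiplicities suffice. The price is that tracking a bounded coordinate requires a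
-- product with a finite automaton, which Kleene's construction turns back into expressions. These
-- are much larger, but their outer stars have one more frozen coordinate, and this is compared
-- first.

infixl 6 _⊞_
_⊞_ : ∀ {n} → Vec ℕ n → Vec ℕ n → Vec ℕ n
_⊞_ = zipWith _+_

𝟎 : ∀ {n} → Vec ℕ n
𝟎 = replicate _ 0

scale : ∀ {n} → ℕ → Vec ℕ n → Vec ℕ n
scale zero    x = 𝟎
scale (suc k) x = x ⊞ scale k x

unit : ∀ {n} → Fin n → Vec ℕ n
unit zero    = 1 ∷ 𝟎
unit (suc i) = 0 ∷ unit i

dot : ∀ {n} → Vec ℕ n → Vec ℕ n → ℕ
dot []      []      = 0
dot (a ∷ α) (x ∷ ξ) = a * x + dot α ξ

∑ : ∀ {n} → Vec ℕ n → ℕ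
∑ []      = 0
∑ (x ∷ ξ) = x + ∑ ξ

⊞-identityˡ : ∀ {n} (x : Vec ℕ n) → 𝟎 ⊞ x ≡ x
⊞-identityˡ = Vecₚ.zipWith-identityˡ +-identityˡ

⊞-identityʳ : ∀ {n} (x : Vec ℕ n) → x ⊞ 𝟎 ≡ x
⊞-identityʳ = Vecₚ.zipWith-identityʳ +-identityʳ

⊞-comm : ∀ {n} (x y : Vec ℕ n) → x ⊞ y ≡ y ⊞ x
⊞-comm = Vecₚ.zipWith-comm +-comm

⊞-assoc : ∀ {n} (x y z : Vec ℕ n) → (x ⊞ y) ⊞ z ≡ x ⊞ (y ⊞ z)
⊞-assoc = Vecₚ.zipWith-assoc +-assoc

⊞-interchange : ∀ {n} (a b c d : Vec ℕ n) → (a ⊞ b) ⊞ (c ⊞ d) ≡ (a ⊞ c) ⊞ (b ⊞ d)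
⊞-interchange []      []      []      []      = refl
⊞-interchange (a ∷ α) (b ∷ β) (c ∷ γ) (d ∷ δ) =
  cong₂ _∷_ (interchange a b c d) (⊞-interchange α β γ δ)

+-cancel-zero : ∀ {m} → m ≡ m + m → m ≡ 0
+-cancel-zero {m} e = sym (+-cancelˡ-≡ m 0 m (trans (+-identityʳ m) e))

module _ {m} (π : Vec ℕ m → ℕ) (π-⊞ : ∀ x y → π (x ⊞ y) ≡ π x + π y) where

  additive-𝟎 : π 𝟎 ≡ 0
  additive-𝟎 = +-cancel-zero (trans (cong π (sym (⊞-identityˡ 𝟎))) (π-⊞ 𝟎 𝟎))

  additive-scale : ∀ k x → π (scale k x) ≡ k * π x
  additive-scale zero    x = additive-𝟎
  additive-scale (suc k) x = trans (π-⊞ x (scale k x)) (cong (π x +_) (additive-scale k x))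

scale-∷ : ∀ {n} k x (ξ : Vec ℕ n) → scale k (x ∷ ξ) ≡ k * x ∷ scale k ξ
scale-∷ zero    x ξ = refl
scale-∷ (suc k) x ξ = cong ((x ∷ ξ) ⊞_) (scale-∷ k x ξ)

scale-𝟎 : ∀ {n} k → scale k (𝟎 {n}) ≡ 𝟎
scale-𝟎 zero    = refl
scale-𝟎 (suc k) = trans (⊞-identityˡ _) (scale-𝟎 k)

additive-dot : ∀ {m} (π : Vec ℕ m → ℕ) → (∀ x y → π (x ⊞ y) ≡ π x + π y) →
               ∀ x → π x ≡ dot (tabulate (π ∘ unit)) x
additive-dot π π-⊞ []      = additive-𝟎 π π-⊞
additive-dot π π-⊞ (x ∷ ξ) = begin
  π (x ∷ ξ)                                ≡⟨ cong π split ⟩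
  π (scale x (1 ∷ 𝟎) ⊞ (0 ∷ ξ))            ≡⟨ π-⊞ _ _ ⟩
  π (scale x (1 ∷ 𝟎)) + π (0 ∷ ξ)          ≡⟨ cong₂ _+_ (additive-scale π π-⊞ x (1 ∷ 𝟎))
                                                (additive-dot (π ∘ (0 ∷_)) (λ _ _ → π-⊞ _ _) ξ) ⟩
  x * π (1 ∷ 𝟎) + rest                     ≡⟨ cong (_+ rest) (*-comm x _) ⟩
  π (1 ∷ 𝟎) * x + rest                     ∎
  where
  open ≡-Reasoning
  rest = dot (tabulate (π ∘ unit ∘ suc)) ξ
  split : x ∷ ξ ≡ scale x (1 ∷ 𝟎) ⊞ (0 ∷ ξ)
  split = trans (cong₂ _∷_ (sym (trans (+-identityʳ _) (*-identityʳ x)))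
                   (sym (trans (cong (_⊞ ξ) (scale-𝟎 x)) (⊞-identityˡ ξ))))
                (cong (_⊞ (0 ∷ ξ)) (sym (scale-∷ x 1 𝟎)))

-- Natural coefficients cannot cancel, so their sum vanishes only if each of them does. Hence the
-- all-ones vector can stand for every direction of a cone at once.
dot-ones-zero : ∀ {m} (α : Vec ℕ m) → dot α (replicate m 1) ≡ 0 → ∀ x → dot α x ≡ 0
dot-ones-zero []      e []      = refl
dot-ones-zero (a ∷ α) e (x ∷ ξ)
  rewrite m*n≡0⇒m≡0 a 1 (m+n≡0⇒m≡0 (a * 1) e) = dot-ones-zero α (m+n≡0⇒n≡0 (a * 1) e) ξ

dot-⊞ : ∀ {m} (α x y : Vec ℕ m) → dot α (x ⊞ y) ≡ dot α x + dot α y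
dot-⊞ []      []      []      = refl
dot-⊞ (a ∷ α) (x ∷ ξ) (y ∷ η) rewrite dot-⊞ α ξ η = lem a x y (dot α ξ) (dot α η)
  where
  lem : ∀ a x y p q → a * (x + y) + (p + q) ≡ a * x + p + (a * y + q)
  lem = solve-∀

∑-⊞ : ∀ {m} (x y : Vec ℕ m) → ∑ (x ⊞ y) ≡ ∑ x + ∑ y
∑-⊞ []      []      = refl
∑-⊞ (x ∷ ξ) (y ∷ η) rewrite ∑-⊞ ξ η = lem x y (∑ ξ) (∑ η)
  where
  lem : ∀ x y p q → x + y + (p + q) ≡ x + p + (y + q)
  lem = solve-∀

lookup≤∑ : ∀ {m} (x : Vec ℕ m) k → lookup x k ≤ ∑ x
lookup≤∑ (x ∷ ξ) zero    = m≤m+n x _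
lookup≤∑ (x ∷ ξ) (suc k) = m≤n⇒m≤o+n x (lookup≤∑ ξ k)

∑-unit : ∀ {m} (k : Fin m) → ∑ (unit k) ≡ 1
∑-unit {suc m} zero    = cong suc (∑-𝟎 m)
  where
  ∑-𝟎 : ∀ m → ∑ (𝟎 {m}) ≡ 0
  ∑-𝟎 zero    = refl
  ∑-𝟎 (suc m) = ∑-𝟎 m
∑-unit (suc k) = ∑-unit k

subtract? : ∀ {n} (h x : Vec ℕ n) → Dec (∃ λ y → x ≡ h ⊞ y)
subtract? []      []      = yes ([] , refl)
subtract? (a ∷ h) (b ∷ x) with a ≤? b | subtract? h x
... | no ¬p    | _              = no λ { (c ∷ _ , e) →
  ¬p (subst (a ≤_) (sym (cong Vec.head e)) (m≤m+n a c)) }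
... | yes _    | no ¬q          = no λ { (_ ∷ y , e) → ¬q (y , cong Vec.tail e) }
... | yes a≤b  | yes (y , refl) = yes (b ∸ a ∷ y , cong (_∷ _) (sym (m+[n∸m]≡n a≤b)))

subtract-scale : ∀ {n} c k (x : Vec ℕ n) → c ≤ lookup x k → ∃ λ y → x ≡ scale c (unit k) ⊞ y
subtract-scale c zero    (x ∷ ξ) c≤x = (x ∸ c ∷ ξ) ,
  trans (cong₂ _∷_ (trans (sym (m+[n∸m]≡n c≤x)) (cong (_+ (x ∸ c)) (sym (*-identityʳ c))))
                   (sym (trans (cong (_⊞ ξ) (scale-𝟎 c)) (⊞-identityˡ ξ))))
        (cong (_⊞ (x ∸ c ∷ ξ)) (sym (scale-∷ c 1 𝟎)))
subtract-scale c (suc k) (x ∷ ξ) c≤x with subtract-scale c k ξ c≤x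
... | y , refl = (x ∷ y) ,
  trans (cong (λ z → z + x ∷ (scale c (unit k) ⊞ y)) (sym (*-zeroʳ c)))
        (cong (_⊞ (x ∷ y)) (sym (scale-∷ c 0 (unit k))))

subtract-scale₂ : ∀ {n} c k c′ k′ (x : Vec ℕ n) → k ≢ k′ → c ≤ lookup x k → c′ ≤ lookup x k′ →
                  ∃ λ y → x ≡ (scale c (unit k) ⊞ scale c′ (unit k′)) ⊞ y
subtract-scale₂ c k c′ k′ x k≢k′ p p′ with subtract-scale c k x p
... | y , refl with subtract-scale c′ k′ y (subst (c′ ≤_) (other c k k′ y k≢k′) p′)
  where
  lookup-unit-≢ : ∀ {n} (k k′ : Fin n) c → k ≢ k′ → lookup (scale c (unit k)) k′ ≡ 0
  lookup-unit-≢ k k′ c k≢k′ = trans (additive-scale (λ v → lookup v k′) (lookup-zipWith _+_ k′) c (unit k))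
                               (trans (cong (c *_) (go k k′ k≢k′)) (*-zeroʳ c))
    where
    go : ∀ {n} (k k′ : Fin n) → k ≢ k′ → lookup (unit k) k′ ≡ 0
    go zero    zero     k≢k′ = ⊥-elim (k≢k′ refl)
    go zero    (suc k′) k≢k′ = Vecₚ.lookup-replicate k′ 0
    go (suc k) zero     k≢k′ = refl
    go (suc k) (suc k′) k≢k′ = go k k′ (k≢k′ ∘ cong suc)
  other : ∀ {n} c (k k′ : Fin n) y → k ≢ k′ → lookup (scale c (unit k) ⊞ y) k′ ≡ lookup y k′
  other c k k′ y k≢k′ = trans (lookup-zipWith _+_ k′ (scale c (unit k)) y)
      (cong (_+ lookup y k′) (lookup-unit-≢ k k′ c k≢k′))
... | z , refl = z , sym (⊞-assoc _ _ z)

box : ∀ K m → List (Vec ℕ m)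
box K zero    = [] ∷ []
box K (suc m) = cartesianProductWith _∷_ (upTo (suc K)) (box K m)

∈-box : ∀ K {m} (x : Vec ℕ m) → (∀ k → lookup x k ≤ K) → x ∈ box K m
∈-box K []      b = here refl
∈-box K (x ∷ ξ) b = ∈-cartesianProductWith⁺ _∷_ (∈-upTo⁺ (s≤s (b zero))) (∈-box K ξ (b ∘ suc))

combine : ∀ {n} (G : List (Vec ℕ n)) → Vec ℕ (length G) → Vec ℕ n
combine []      []      = 𝟎
combine (g ∷ G) (l ∷ λs) = scale l g ⊞ combine G λs

scale-+ : ∀ {n} k l (x : Vec ℕ n) → scale (k + l) x ≡ scale k x ⊞ scale l x
scale-+ zero    l x = sym (⊞-identityˡ _)
scale-+ (suc k) l x = trans (cong (x ⊞_) (scale-+ k l x)) (sym (⊞-assoc x _ _))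

combine-⊞ : ∀ {n} (G : List (Vec ℕ n)) x y → combine G (x ⊞ y) ≡ combine G x ⊞ combine G y
combine-⊞ []      []      []      = sym (⊞-identityˡ 𝟎)
combine-⊞ (g ∷ G) (x ∷ ξ) (y ∷ η) =
  trans (cong₂ _⊞_ (scale-+ x y g) (combine-⊞ G ξ η))
        (⊞-interchange (scale x g) (scale y g) (combine G ξ) (combine G η))

combine-𝟎 : ∀ {n} (G : List (Vec ℕ n)) → combine G 𝟎 ≡ 𝟎
combine-𝟎 []      = refl
combine-𝟎 (g ∷ G) = trans (⊞-identityˡ _) (combine-𝟎 G)

combine-∈ : ∀ {n} {G : List (Vec ℕ n)} {g} → g ∈ G → ∃ λ λs → combine G λs ≡ g
combine-∈ {G = g ∷ G} (here refl) = (1 ∷ 𝟎) ,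
  trans (cong₂ _⊞_ (⊞-identityʳ g) (combine-𝟎 G)) (⊞-identityʳ g)
combine-∈ (there g∈G) with combine-∈ g∈G
... | λs , e = (0 ∷ λs) , trans (⊞-identityˡ _) e

lookup-ext : ∀ {n} {M N : Vec ℕ n} → (∀ i → lookup M i ≡ lookup N i) → M ≡ N
lookup-ext {M = M} {N} f = trans (sym (Vecₚ.tabulate∘lookup M))
    (trans (Vecₚ.tabulate-cong f) (Vecₚ.tabulate∘lookup N))

dominate : ∀ {n} A (α β x δ : Vec ℕ n) →
           (∀ k → lookup β k * lookup x k + lookup δ k ≤ lookup α k * lookup x k + A * lookup β k) →
           dot β x + ∑ δ ≤ dot α x + A * ∑ β
dominate A []      []      []      []      h = z≤n
dominate A (a ∷ α) (b ∷ β) (x ∷ ξ) (d ∷ δ) h =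
  subst₂ _≤_ (arith₁ (b * x) d (dot β ξ) (∑ δ)) (arith₂ (a * x) A b (dot α ξ) (∑ β))
    (+-mono-≤ (h zero) (dominate A α β ξ δ (h ∘ suc)))
  where
  arith₁ : ∀ p q r s → p + q + (r + s) ≡ p + r + (q + s)
  arith₁ = solve-∀
  arith₂ : ∀ p A b r s → p + A * b + (r + A * s) ≡ p + r + A * (b + s)
  arith₂ = solve-∀

-- An index with α above β contributes at least its variable to α·x - β·x, an index with α below β
-- removes at most A times its entry of β, and the other variables are 0. The difference α·x - β·x
-- is at most c′ by the equation.
positive-part-bounded : ∀ {n} (α β x : Vec ℕ n) A c c′ → dot α x + c ≡ dot β x + c′ →
  (∀ j → lookup α j < lookup β j → lookup x j ≤ A) → (∀ k → lookup α k ≡ lookup β k → lookup x k ≡ 0) →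
  ∀ k → lookup β k < lookup α k → lookup x k ≤ c′ + A * ∑ β
positive-part-bounded α β x A c c′ eq neg lev k p = ≤-trans (subst (_≤ ∑ δ) δk (lookup≤∑ δ k)) ∑δ≤
  where
  δ′ : ∀ k → Dec (lookup β k < lookup α k) → ℕ
  δ′ k (yes _) = lookup x k
  δ′ k (no _)  = 0
  δ = tabulate λ k → δ′ k (lookup β k <? lookup α k)
  δk : lookup δ k ≡ lookup x k
  δk = trans (lookup∘tabulate _ k) (lem (lookup β k <? lookup α k))
    where
    lem : (D : Dec (lookup β k < lookup α k)) → δ′ k D ≡ lookup x k
    lem (yes _) = refl
    lem (no ¬p) = ⊥-elim (¬p p)
  pointwise : ∀ k (D : Dec (lookup β k < lookup α k)) →
    lookup β k * lookup x k + δ′ k D ≤ lookup α k * lookup x k + A * lookup β k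
  pointwise k (yes p) = ≤-trans (≤-reflexive (+-comm (lookup β k * lookup x k) _))
      (≤-trans (*-monoˡ-≤ (lookup x k) p) (m≤m+n _ _))
  pointwise k (no ¬p) = go (<-cmp (lookup α k) (lookup β k))
    where
    go : Tri (lookup α k < lookup β k) (lookup α k ≡ lookup β k) (lookup β k < lookup α k) →
         lookup β k * lookup x k + 0 ≤ lookup α k * lookup x k + A * lookup β k
    go (tri< q _ _) = ≤-trans (≤-reflexive (trans (+-identityʳ _) (*-comm (lookup β k) _)))
                        (≤-trans (*-monoˡ-≤ (lookup β k) (neg k q)) (m≤n+m _ _))
    go (tri≈ _ q _) rewrite lev k q | *-zeroʳ (lookup β k) = z≤n
    go (tri> _ _ q) = ⊥-elim (¬p q)
  ∑δ≤ : ∑ δ ≤ c′ + A * ∑ β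
  ∑δ≤ = +-cancelˡ-≤ (dot β x) (∑ δ) (c′ + A * ∑ β) (begin
    dot β x + ∑ δ             ≤⟨ dominate A α β x δ (λ k → subst (λ z → lookup β k * lookup x k + z ≤ _)
                                   (sym (lookup∘tabulate _ k)) (pointwise k (lookup β k <? lookup α k))) ⟩
    dot α x + A * ∑ β         ≤⟨ +-monoˡ-≤ (A * ∑ β) (m≤m+n (dot α x) c) ⟩
    dot α x + c + A * ∑ β     ≡⟨ cong (_+ A * ∑ β) eq ⟩
    dot β x + c′ + A * ∑ β    ≡⟨ +-assoc (dot β x) c′ _ ⟩
    dot β x + (c′ + A * ∑ β)  ∎)
    where open ≤-Reasoning

-- For the equation α·x + c ≡ β·x + c′, the homogeneous generators pair an index with α > β
-- against one with α < β; a solution from which no generator can be subtracted is bounded.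
module Equation {m : ℕ} (α β : Vec ℕ m) where

  a b : Fin m → ℕ
  a = lookup α
  b = lookup β

  -- Each of the two indices is taken as often as the other one is unbalanced, so that the surplus
  -- of i and the deficit of j cancel.
  pairGen : Fin m → Fin m → Vec ℕ m
  pairGen i j = scale (b j ∸ a j) (unit i) ⊞ scale (a i ∸ b i) (unit j)

  data IsGen : Vec ℕ m → Set where
    pair  : ∀ i j → b i < a i → a j < b j → IsGen (pairGen i j)
    level : ∀ i → a i ≡ b i → IsGen (unit i)

  pairGens : Fin m → Fin m → List (∃ IsGen)
  pairGens i j with b i <? a i | a j <? b j
  ... | yes p | yes q = (_ , pair i j p q) ∷ []
  ... | _     | _     = []

  levelGens : Fin m → List (∃ IsGen)
  levelGens i with a i ≟ b i
  ... | yes p = (_ , level i p) ∷ []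
  ... | no  _ = []

  gens : List (∃ IsGen)
  gens = concatMap (λ i → concatMap (pairGens i) (allFin m)) (allFin m)
         List.++ concatMap levelGens (allFin m)

  generators : List (Vec ℕ m)
  generators = map proj₁ gens

  isGen : ∀ {g} → g ∈ generators → IsGen g
  isGen g∈ with ∈-map⁻ proj₁ g∈
  ... | (_ , i) , _ , refl = i

  pair∈ : ∀ i j → b i < a i → a j < b j → pairGen i j ∈ generators
  pair∈ i j p q = helper (∈-++⁺ˡ (∈-concatMap⁺ _ (lose (∈-allFin i)
      (∈-concatMap⁺ _ (lose (∈-allFin j) (proj₂ here′))))))
    where
    here′ : ∃ λ g → (pairGen i j , g) ∈ pairGens i j
    here′ with b i <? a i | a j <? b j
    ... | yes p | yes q = _ , here refl
    ... | no ¬p | _     = ⊥-elim (¬p p)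
    ... | yes _ | no ¬q = ⊥-elim (¬q q)
    helper : ∀ {g} → (pairGen i j , g) ∈ gens → pairGen i j ∈ generators
    helper = ∈-map⁺ proj₁

  level∈ : ∀ i → a i ≡ b i → unit i ∈ generators
  level∈ i p = ∈-map⁺ proj₁ (∈-++⁺ʳ (concatMap (λ i → concatMap (pairGens i) (allFin m)) (allFin m))
                            (∈-concatMap⁺ _ (lose (∈-allFin i) (proj₂ here′))))
    where
    here′ : ∃ λ g → (unit i , g) ∈ levelGens i
    here′ with a i ≟ b i
    ... | yes p = _ , here refl
    ... | no ¬p = ⊥-elim (¬p p)

  dot-scale-unit : ∀ {n} (γ : Vec ℕ n) k i → dot γ (scale k (unit i)) ≡ k * lookup γ i
  dot-scale-unit γ k i = trans (additive-scale (dot γ) (dot-⊞ γ) k (unit i)) (cong (k *_) (dot-unit γ i))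
    where
    dot-unit : ∀ {n} (γ : Vec ℕ n) i → dot γ (unit i) ≡ lookup γ i
    dot-unit (c ∷ γ) zero    = trans (cong₂ _+_ (*-identityʳ c) (additive-𝟎 (dot γ) (dot-⊞ γ)))
        (+-identityʳ c)
    dot-unit (c ∷ γ) (suc i) = trans (cong (_+ dot γ (unit i)) (*-zeroʳ c)) (dot-unit γ i)

  gen-balanced : ∀ {g} → IsGen g → dot α g ≡ dot β g
  gen-balanced (pair i j p q) = begin
    dot α (pairGen i j)       ≡⟨ expand α ⟩
    n * a i + r * a j         ≡⟨ cong (λ z → n * z + r * a j) (sym (m+[n∸m]≡n (<⇒≤ p))) ⟩
    n * (b i + r) + r * a j   ≡⟨ arith n r (b i) (a j) ⟩
    n * b i + r * (a j + n)   ≡⟨ cong (λ z → n * b i + r * z) (m+[n∸m]≡n (<⇒≤ q)) ⟩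
    n * b i + r * b j         ≡⟨ sym (expand β) ⟩
    dot β (pairGen i j)       ∎
    where
    open ≡-Reasoning
    n = b j ∸ a j
    r = a i ∸ b i
    expand : ∀ γ → dot γ (pairGen i j) ≡ n * lookup γ i + r * lookup γ j
    expand γ = trans (dot-⊞ γ _ _) (cong₂ _+_ (dot-scale-unit γ n i) (dot-scale-unit γ r j))
    arith : ∀ n r x y → n * (x + r) + r * y ≡ n * x + r * (y + n)
    arith = solve-∀
  gen-balanced (level i p) = trans (one α) (trans p (sym (one β)))
    where
    one : ∀ γ → dot γ (unit i) ≡ lookup γ i
    one γ = trans (cong (dot γ) (sym (⊞-identityʳ (unit i)))) (trans (dot-scale-unit γ 1 i) (*-identityˡ _))

  gen-positive : ∀ {g} → IsGen g → 0 < ∑ g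
  gen-positive (level i _)    = ≤-reflexive (sym (∑-unit i))
  gen-positive (pair i j p q) = subst (0 <_) (sym (trans (∑-⊞ (scale (b j ∸ a j) (unit i)) _)
      (cong₂ _+_ (weight (b j ∸ a j) i) (weight (a i ∸ b i) j)))) (≤-trans (m<n⇒0<n∸m q) (m≤m+n _ _))
    where
    weight : ∀ k i → ∑ (scale k (unit {m} i)) ≡ k
    weight k i = trans (additive-scale ∑ ∑-⊞ k (unit i)) (trans (cong (k *_) (∑-unit i)) (*-identityʳ k))

  combine-balanced : ∀ x → dot α (combine generators x) ≡ dot β (combine generators x)
  combine-balanced = go generators isGen
    where
    go : ∀ G → (∀ {g} → g ∈ G → IsGen g) → ∀ x → dot α (combine G x) ≡ dot β (combine G x)
    go []      ok []      = trans (additive-𝟎 (dot α) (dot-⊞ α)) (sym (additive-𝟎 (dot β) (dot-⊞ β)))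
    go (g ∷ G) ok (x ∷ ξ) = trans (dot-⊞ α (scale x g) _)
        (trans (cong₂ _+_ (scaled x) (go G (ok ∘ there) ξ)) (sym (dot-⊞ β (scale x g) _)))
      where
      scaled : ∀ x → dot α (scale x g) ≡ dot β (scale x g)
      scaled x = trans (additive-scale (dot α) (dot-⊞ α) x g)
          (trans (cong (x *_) (gen-balanced (ok (here refl))))
                   (sym (additive-scale (dot β) (dot-⊞ β) x g)))

  Irreducible : Vec ℕ m → Set
  Irreducible x = ∀ {g} → g ∈ generators → ¬ ∃ λ y → x ≡ g ⊞ y

  reduce : ∀ x → ∃ λ y → ∃ λ λs → x ≡ y ⊞ combine generators λs × Irreducible y
  reduce x = go x (<-wellFounded (∑ x))
    where
    go : ∀ x → Acc _<_ (∑ x) → ∃ λ y → ∃ λ λs → x ≡ y ⊞ combine generators λs × Irreducible y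
    go x (acc rs) with Any.any? (λ g → subtract? g x) generators
    ... | no ¬r = x , 𝟎 , sym (trans (cong (x ⊞_) (combine-𝟎 generators)) (⊞-identityʳ x)) ,
                  λ g∈ e → ¬r (lose g∈ e)
    ... | yes r with find r
    ... | g , g∈ , x′ , refl with go x′ (rs (subst (∑ x′ <_) (sym (∑-⊞ g x′))
        (m<n+m (∑ x′) (gen-positive (isGen g∈)))))
                                | combine-∈ g∈
    ... | y , λs , refl , irr | μs , refl = y , μs ⊞ λs ,
      trans (swap (combine generators μs) y (combine generators λs))
            (cong (y ⊞_) (sym (combine-⊞ generators μs λs))) , irr
      where
      swap : ∀ (u v w : Vec ℕ m) → u ⊞ (v ⊞ w) ≡ v ⊞ (u ⊞ w)
      swap u v w = trans (sym (⊞-assoc u v w)) (trans (cong (_⊞ w) (⊞-comm u v)) (⊞-assoc v u w))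

  -- The first summand dominates both coefficients of every pair generator. The other two are the
  -- bounds of `positive-part-bounded` with either side of the equation in the role of α. The sum
  -- serves as a common upper bound.
  irreducible-bound : ℕ → ℕ → ℕ
  irreducible-bound c c′ = (∑ α + ∑ β) + ((c + (∑ α + ∑ β) * ∑ α) + (c′ + (∑ α + ∑ β) * ∑ β))

  -- If some variable with positive coefficient is large, every variable with negative
  -- coefficient is small (else a pair generator could be subtracted), and vice versa;
  -- the equation then bounds the other side.
  irreducible-bounded : ∀ x c c′ → dot α x + c ≡ dot β x + c′ → Irreducible x →
                        ∀ k → lookup x k ≤ irreducible-bound c c′
  irreducible-bounded x c c′ eq irr = conclude (Finₚ.any? λ i → (b i <? a i) ×-dec (A ≤? lookup x i))
    where
    A = ∑ α + ∑ β
    K = irreducible-bound c c′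
    lev : ∀ k → a k ≡ b k → lookup x k ≡ 0
    lev k p with lookup x k in e
    ... | zero  = refl
    ... | suc l = ⊥-elim (irr (level∈ k p) (proj₁ r , trans (proj₂ r)
        (cong (_⊞ proj₁ r) (⊞-identityʳ (unit k)))))
      where r = subtract-scale 1 k x (subst (1 ≤_) (sym e) (s≤s z≤n))
    all-bounded : (∀ k → b k < a k → lookup x k ≤ K) → (∀ k → a k < b k → lookup x k ≤ K) → ∀ k → lookup x
        k ≤ K
    all-bounded pos neg k with <-cmp (a k) (b k)
    ... | tri< p _ _ = neg k p
    ... | tri≈ _ p _ = subst (_≤ K) (sym (lev k p)) z≤n
    ... | tri> _ _ p = pos k p
    A≤K : A ≤ K
    A≤K = m≤m+n A _
    left≤K : c + A * ∑ α ≤ K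
    left≤K = ≤-trans (m≤m+n _ (c′ + A * ∑ β)) (m≤n+m _ A)
    right≤K : c′ + A * ∑ β ≤ K
    right≤K = ≤-trans (m≤n+m _ (c + A * ∑ α)) (m≤n+m _ A)
    conclude : Dec (∃ λ i → b i < a i × A ≤ lookup x i) → ∀ k → lookup x k ≤ K
    conclude (yes (i , p , large)) = all-bounded
      (λ k q → ≤-trans (positive-part-bounded α β x A c c′ eq neg lev k q) right≤K)
      (λ k q → ≤-trans (neg k q) A≤K)
      where
      neg : ∀ j → a j < b j → lookup x j ≤ A
      neg j q with lookup x j ≤? A
      ... | yes r = r
      ... | no ¬r = ⊥-elim (irr (pair∈ i j p q)
              (subtract-scale₂ (b j ∸ a j) i (a i ∸ b i) j x i≢j
                (≤-trans (m∸n≤m (b j) (a j)) (≤-trans (lookup≤∑ β j) (≤-trans (m≤n+m _ (∑ α)) large)))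
                (≤-trans (m∸n≤m (a i) (b i)) (≤-trans (lookup≤∑ α i)
                    (≤-trans (m≤m+n _ (∑ β)) (<⇒≤ (≰⇒> ¬r)))))))
        where
        i≢j : i ≢ j
        i≢j refl = <-asym p q
    conclude (no ¬large) = all-bounded
      (λ k q → ≤-trans (pos k q) A≤K)
      (λ k q → ≤-trans (positive-part-bounded β α x A c′ c (sym eq) pos (λ k e → lev k (sym e)) k q) left≤K)
      where
      pos : ∀ i → b i < a i → lookup x i ≤ A
      pos i p with A ≤? lookup x i
      ... | yes r = ⊥-elim (¬large (i , p , r))
      ... | no ¬r = <⇒≤ (≰⇒> ¬r)

-- A quotient of ℕ^rank; no monoid laws are needed beyond those inherited through gen.
record Module (A : Set) : Set where
  field
    _⊕_      : A → A → A
    rank     : ℕ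
    gen      : Vec ℕ rank → A
    gen-⊞    : ∀ x y → gen (x ⊞ y) ≡ gen x ⊕ gen y
    gen-surj : ∀ u → ∃ λ x → gen x ≡ u

Additive : ∀ {A} → Module A → (A → ℕ) → Set
Additive M π = ∀ u v → π (Module._⊕_ M u v) ≡ π u + π v

record Eqn {A} (M : Module A) : Set where
  field
    lhs rhs : A → ℕ
    lhs-add : Additive M lhs
    rhs-add : Additive M rhs
    c c′    : ℕ

Sat Hom : ∀ {A} {M : Module A} → A → Eqn M → Set
Sat x e = Eqn.lhs e x + Eqn.c e ≡ Eqn.rhs e x + Eqn.c′ e
Hom x e = Eqn.lhs e x ≡ Eqn.rhs e x

module _ {A} (M : Module A) where
  open Module M

  -- A finite union of translates of one finitely generated monoid. Since all translates share
  -- `dir`, a further equation becomes an equation in `dim` unknowns whose coefficients are the same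
  -- for every base; only the constants differ.
  record Cone (es : List (Eqn M)) : Set where
    field
      dim      : ℕ
      base     : List (Vec ℕ rank)
      dir     : Vec ℕ dim → Vec ℕ rank
      dir-⊞   : ∀ x y → dir (x ⊞ y) ≡ dir x ⊞ dir y
      dir-hom  : ∀ x → All (Hom (gen (dir x))) es
      base-sat : All (λ v → All (Sat (gen v)) es) base
      complete : ∀ u → All (Sat (gen u)) es → ∃ λ v → v ∈ base × ∃ λ x → u ≡ v ⊞ dir x

  full-cone : Cone []
  full-cone = record
    { dim = rank ; base = 𝟎 ∷ [] ; dir = id ; dir-⊞ = λ _ _ → refl ; dir-hom = λ _ → []
    ; base-sat = [] ∷ [] ; complete = λ u _ → 𝟎 , here refl , u , sym (⊞-identityˡ u) }

  add-equation : ∀ e {es} → Cone es → Cone (e ∷ es)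
  add-equation e {es} C = record
    { dim = length generators ; base = newBase ; dir = dir ∘ combine generators
    ; dir-⊞ = λ x y → trans (cong dir (combine-⊞ generators x y)) (dir-⊞ _ _)
    ; dir-hom = λ x → trans (p-dot _) (trans (combine-balanced x) (sym (q-dot _))) ∷ dir-hom
        (combine generators x)
    ; base-sat = Allₚ.concat⁺ (Allₚ.map⁺ (All.tabulate λ {v} v∈ →
        Allₚ.map⁺ (All.tabulate λ {x} x∈ → base-sat′ v x v∈ x∈)))
    ; complete = complete′ }
    where
    open Cone C
    open Eqn e
    pv qv : Vec ℕ rank → ℕ
    pv = lhs ∘ gen
    qv = rhs ∘ gen
    pv-⊞ : ∀ x y → pv (x ⊞ y) ≡ pv x + pv y
    pv-⊞ x y = trans (cong lhs (gen-⊞ x y)) (lhs-add _ _)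
    qv-⊞ : ∀ x y → qv (x ⊞ y) ≡ qv x + qv y
    qv-⊞ x y = trans (cong rhs (gen-⊞ x y)) (rhs-add _ _)
    p q : Vec ℕ dim → ℕ
    p = pv ∘ dir
    q = qv ∘ dir
    α β : Vec ℕ dim
    α = tabulate (p ∘ unit)
    β = tabulate (q ∘ unit)
    p-dot : ∀ x → p x ≡ dot α x
    p-dot = additive-dot p (λ x y → trans (cong pv (dir-⊞ x y)) (pv-⊞ _ _))
    q-dot : ∀ x → q x ≡ dot β x
    q-dot = additive-dot q (λ x y → trans (cong qv (dir-⊞ x y)) (qv-⊞ _ _))
    open Equation α β
    Solves : Vec ℕ rank → Vec ℕ dim → Set
    Solves v x = dot α x + (pv v + c) ≡ dot β x + (qv v + c′)
    solutions : Vec ℕ rank → List (Vec ℕ dim)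
    solutions v = filter (λ x → _ ≟ _) (box (irreducible-bound (pv v + c) (qv v + c′)) dim)
    -- All solutions in the box are taken, reducible or not; completeness asks only that the
    -- irreducible ones are among them.
    newBase = concatMap (λ v → map (λ x → v ⊞ dir x) (solutions v)) base
    arrange : ∀ d v c → d + (v + c) ≡ v + d + c
    arrange = solve-∀
    sat⇔ : ∀ v x → Sat (gen (v ⊞ dir x)) e ≡ Solves v x
    sat⇔ v x = cong₂ _≡_
      (trans (cong (_+ c) (trans (pv-⊞ v (dir x)) (cong (pv v +_) (p-dot x))))
          (sym (arrange (dot α x) (pv v) c)))
      (trans (cong (_+ c′) (trans (qv-⊞ v (dir x)) (cong (qv v +_) (q-dot x))))
          (sym (arrange (dot β x) (qv v) c′)))
    shift-sat : ∀ e′ v x → Hom (gen (dir x)) e′ → (Sat (gen v) e′ → Sat (gen (v ⊞ dir x)) e′)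
                                              × (Sat (gen (v ⊞ dir x)) e′ → Sat (gen v) e′)
    shift-sat e′ v x h = to , from
      where
      module E = Eqn e′
      k = E.rhs (gen (dir x))
      l-eq : E.lhs (gen (v ⊞ dir x)) + E.c ≡ k + (E.lhs (gen v) + E.c)
      l-eq = trans (cong (_+ E.c) (trans (cong E.lhs (gen-⊞ v (dir x)))
          (trans (E.lhs-add _ _) (cong (_ +_) h)))) (sym (arrange k _ E.c))
      r-eq : E.rhs (gen (v ⊞ dir x)) + E.c′ ≡ k + (E.rhs (gen v) + E.c′)
      r-eq = trans (cong (_+ E.c′) (trans (cong E.rhs (gen-⊞ v (dir x))) (E.rhs-add _ _)))
          (sym (arrange k _ E.c′))
      to : Sat (gen v) e′ → Sat (gen (v ⊞ dir x)) e′
      to s = trans l-eq (trans (cong (k +_) s) (sym r-eq))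
      from : Sat (gen (v ⊞ dir x)) e′ → Sat (gen v) e′
      from s = +-cancelˡ-≡ k _ _ (trans (sym l-eq) (trans s r-eq))
    base-sat′ : ∀ v x → v ∈ base → x ∈ solutions v → All (Sat (gen (v ⊞ dir x))) (e ∷ es)
    base-sat′ v x v∈ x∈ = subst id (sym (sat⇔ v x)) (proj₂
        (∈-filter⁻ (λ x → _ ≟ _) {xs = box (irreducible-bound (pv v + c) (qv v + c′)) dim} x∈))
      ∷ All.tabulate λ {e′} e∈ → proj₁ (shift-sat e′ v x (All.lookup (dir-hom x) e∈))
          (All.lookup (All.lookup base-sat v∈) e∈)
    complete′ : ∀ u → All (Sat (gen u)) (e ∷ es) → ∃ λ v → v ∈ newBase × ∃ λ x → u ≡ v ⊞ dir
        (combine generators x)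
    complete′ u (s ∷ ss) with complete u ss
    ... | v , v∈ , x , refl with reduce x
    ... | y , λs , refl , irr = v ⊞ dir y
        , ∈-concatMap⁺ _ (lose v∈ (∈-map⁺ (λ x → v ⊞ dir x) (∈-filter⁺ (λ x → _ ≟ _)
            (∈-box _ y (irreducible-bounded y (pv v + c) (qv v + c′) y-solves irr)) y-solves)))
        , λs , trans (cong (v ⊞_) (dir-⊞ y (combine generators λs))) (sym (⊞-assoc v (dir y) _))
      where
      y-solves : Solves v y
      y-solves = +-cancelˡ-≡ (dot α (combine generators λs)) _ _ (begin
        dot α g + (dot α y + (pv v + c))  ≡⟨ arr (dot α g) (dot α y) (pv v + c) ⟩
        dot α y + dot α g + (pv v + c)    ≡⟨ cong (_+ (pv v + c)) (sym (dot-⊞ α y g)) ⟩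
        dot α (y ⊞ g) + (pv v + c)        ≡⟨ subst id (sat⇔ v (y ⊞ g)) s ⟩
        dot β (y ⊞ g) + (qv v + c′)       ≡⟨ cong (_+ (qv v + c′)) (dot-⊞ β y g) ⟩
        dot β y + dot β g + (qv v + c′)   ≡⟨ sym (arr (dot β g) (dot β y) (qv v + c′)) ⟩
        dot β g + (dot β y + (qv v + c′)) ≡⟨ cong (_+ (dot β y + (qv v + c′))) (sym (combine-balanced λs)) ⟩
        dot α g + (dot β y + (qv v + c′)) ∎)
        where
        open ≡-Reasoning
        g = combine generators λs
        arr : ∀ g y r → g + (y + r) ≡ y + g + r
        arr = solve-∀

  cone : ∀ es → Cone es
  cone []       = full-cone
  cone (e ∷ es) = add-equation e (cone es)

  -- `agree` expresses that `direction` has maximal support. It speaks of additive functionals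
  -- instead of coordinates because the quantities to be bounded are sums of multiplicities as well
  -- as single entries of markings.
  record Solution (es : List (Eqn M)) : Set where
    field
      direction  : A
      bases      : List A
      hom        : All (Hom direction) es
      bases-sat  : All (λ u → All (Sat u) es) bases
      agree      : ∀ u → All (Sat u) es → ∃ λ v → v ∈ bases ×
                   (∀ π → Additive M π → π direction ≡ 0 → π u ≡ π v)

  solve : ∀ es → Solution es
  solve es = record
    -- The sum of all generators of the cone: a functional with values in ℕ that vanishes here
    -- vanishes on each generator, hence on the difference between a solution and its base.
    { direction = gen (dir ones) ; bases = map gen base ; hom = dir-hom ones
    ; bases-sat = Allₚ.map⁺ base-sat ; agree = agree′ }
    where
    open Cone (cone es)
    ones = replicate dim 1
    agree′ : ∀ u → All (Sat u) es → ∃ λ v → v ∈ map gen base ×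
             (∀ π → Additive M π → π (gen (dir ones)) ≡ 0 → π u ≡ π v)
    agree′ u s with gen-surj u
    ... | u′ , refl with complete u′ s
    ... | v , v∈ , x , refl = gen v , ∈-map⁺ gen v∈ , λ π π-add z →
      trans (cong π (gen-⊞ v (dir x))) (trans (π-add _ _) (trans (cong (π (gen v) +_)
        (trans (ρ-dot π π-add x) (dot-ones-zero (tabulate (π ∘ gen ∘ dir ∘ unit))
            (trans (sym (ρ-dot π π-add ones)) z) x))) (+-identityʳ _)))
      where
      ρ-dot : ∀ π → Additive M π → ∀ x → π (gen (dir x)) ≡ dot (tabulate (π ∘ gen ∘ dir ∘ unit)) x
      ρ-dot π π-add = additive-dot (π ∘ gen ∘ dir) λ x y →
        trans (cong π (trans (cong gen (dir-⊞ x y)) (gen-⊞ _ _))) (π-add _ _)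

ℕ-module : Module ℕ
ℕ-module = record { _⊕_ = _+_ ; rank = 1 ; gen = Vec.head ; gen-⊞ = λ { (x ∷ []) (y ∷ []) → refl } ;
    gen-surj = λ u → (u ∷ []) , refl }

⊤-module : Module ⊤
⊤-module = record { _⊕_ = λ _ _ → tt ; rank = 0 ; gen = λ _ → tt ; gen-⊞ = λ _ _ → refl ; gen-surj = λ _ →
    [] , refl }

Vec-module : ∀ n → Module (Vec ℕ n)
Vec-module n = record { _⊕_ = _⊞_ ; rank = n ; gen = id ; gen-⊞ = λ _ _ → refl ; gen-surj = λ u → u , refl }

infixr 2 _×-module_
_×-module_ : ∀ {A B} → Module A → Module B → Module (A × B)
MA ×-module MB = record
  { _⊕_ = λ (a , b) (a′ , b′) → (a MA.⊕₁ a′) , (b MB.⊕₁ b′) ; rank = MA.rank + MB.rank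
  ; gen = λ v → MA.gen (Vec.take MA.rank v) , MB.gen (Vec.drop MA.rank v)
  ; gen-⊞ = λ x y → cong₂ _,_
      (trans (cong MA.gen (Vecₚ.take-zipWith {m = MA.rank} _+_ x y)) (MA.gen-⊞ _ _))
      (trans (cong MB.gen (Vecₚ.drop-zipWith {m = MA.rank} _+_ x y)) (MB.gen-⊞ _ _))
  ; gen-surj = surj }
  where
  module MA = Module MA renaming (_⊕_ to _⊕₁_)
  module MB = Module MB renaming (_⊕_ to _⊕₁_)
  take-++ : ∀ {k l} (x : Vec ℕ k) (y : Vec ℕ l) → Vec.take k (x Vec.++ y) ≡ x × Vec.drop k (x Vec.++ y) ≡ y
  take-++ []       y = refl , refl
  take-++ (a ∷ xs) y with take-++ xs y
  ... | e , e′ = cong (a ∷_) e , e′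
  surj : ∀ u → ∃ λ x → (MA.gen (Vec.take MA.rank x) , MB.gen (Vec.drop MA.rank x)) ≡ u
  surj (a , b) with MA.gen-surj a | MB.gen-surj b
  ... | x , refl | y , refl with take-++ x y
  ... | e , e′ = x Vec.++ y , cong₂ _,_ (cong MA.gen e) (cong MB.gen e′)

-- Expressions

-- A star carries a partial marking: coordinates with value `just c` are frozen, i.e. every
-- word of the star leads from c to c there and cannot be blocked by that coordinate.
data Seq (Λ : Set) (d : ℕ) : Set where
  ε  : Seq Λ d
  lt : Λ → Seq Λ d → Seq Λ d
  st : (Fin d → Maybe ℕ) → List (Seq Λ d) → Seq Λ d → Seq Λ d


private variable
  Λ : Set
  d : ℕ
  w w₁ w₂ : List Λ
  s t : Seq Λ d
  E : List (Seq Λ d)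
  v : Fin d → Maybe ℕ

infixr 5 _◇_
_◇_ : Seq Λ d → Seq Λ d → Seq Λ d
ε        ◇ t = t
lt a s   ◇ t = lt a (s ◇ t)
st v E s ◇ t = st v E (s ◇ t)

infix 4 _∈L_
-- Annotations put no condition on membership; they matter only for `Run` and for the typing
-- relation. The concatenation in `loop` is an equation so that matching on a word does not have to
-- invert `_++_`.
data _∈L_ {Λ d} : List Λ → Seq Λ d → Set where
  empty : [] ∈L ε
  cons  : ∀ {a w s} → w ∈L s → a ∷ w ∈L lt a s
  stop  : ∀ {v E w s} → w ∈L s → w ∈L st v E s
  loop  : ∀ {v E e w w₁ w₂ s} → e ∈ E → w₁ ∈L e → w₂ ∈L st v E s → w ≡ w₁ ++ w₂ → w ∈L st v E s

◇-intro : w₁ ∈L s → w₂ ∈L t → w₁ ++ w₂ ∈L s ◇ t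
◇-intro empty             y = y
◇-intro (cons x)          y = cons (◇-intro x y)
◇-intro (stop x)          y = stop (◇-intro x y)
◇-intro {w₂ = u} (loop {w₁ = u₁} {u₂} e∈ x z refl) y = loop e∈ x (◇-intro z y) (++-assoc u₁ u₂ u)

◇-elim : ∀ (s : Seq Λ d) {t w} → w ∈L s ◇ t → ∃ λ w₁ → ∃ λ w₂ → w ≡ w₁ ++ w₂ × w₁ ∈L s × w₂ ∈L t
◇-elim ε        x        = _ , _ , refl , empty , x
◇-elim (lt a s) (cons x) with ◇-elim s x
... | w₁ , w₂ , refl , y , z = _ , _ , refl , cons y , z
◇-elim (st v E s) (stop x) with ◇-elim s x
... | w₁ , w₂ , refl , y , z = _ , _ , refl , stop y , z
◇-elim (st v E s) (loop e∈ x x′ refl) with ◇-elim (st v E s) x′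
... | w₁ , w₂ , refl , y , z = _ , _ , sym (++-assoc _ w₁ w₂) , loop e∈ x y refl , z

star-++ : ∀ {v v′ : Fin d → Maybe ℕ} {E : List (Seq Λ d)} {s} → w₁ ∈L st v E ε → w₂ ∈L st v′ E s → w₁ ++
    w₂ ∈L st v′ E s
star-++ (stop empty)       y = y
star-++ {w₂ = u} (loop {w₁ = u₁} {u₂} e∈ x z refl) y = loop e∈ x (star-++ z y) (++-assoc u₁ u₂ u)

-- CS s: how often the skeleton of each alternative of each star inside s is used, where the
-- skeleton of a sequence is its word with all stars empty.
CS : Seq Λ d → Set
CA : List (Seq Λ d) → Set
CS ε          = ⊤
CS (lt a s)   = CS s
CS (st v E s) = CA E × CS s
CA []      = ⊤
CA (e ∷ E) = ℕ × CS e × CA E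

CS-module : (s : Seq Λ d) → Module (CS s)
CA-module : (E : List (Seq Λ d)) → Module (CA E)
CS-module ε          = ⊤-module
CS-module (lt a s)   = CS-module s
CS-module (st v E s) = CA-module E ×-module CS-module s
CA-module []      = ⊤-module
CA-module (e ∷ E) = ℕ-module ×-module CS-module e ×-module CA-module E

addS : (s : Seq Λ d) → CS s → CS s → CS s
addS s = Module._⊕_ (CS-module s)

addA : (E : List (Seq Λ d)) → CA E → CA E → CA E
addA E = Module._⊕_ (CA-module E)

zeroS : (s : Seq Λ d) → CS s
zeroA : (E : List (Seq Λ d)) → CA E
zeroS ε          = tt
zeroS (lt a s)   = zeroS s
zeroS (st v E s) = zeroA E , zeroS s
zeroA []      = tt
zeroA (e ∷ E) = 0 , zeroS e , zeroA E

weight : (Λ → ℕ) → List Λ → ℕ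
weight φ []      = 0
weight φ (a ∷ w) = φ a + weight φ w

weight-++ : ∀ (φ : Λ → ℕ) w w′ → weight φ (w ++ w′) ≡ weight φ w + weight φ w′
weight-++ φ []      w′ = refl
weight-++ φ (a ∷ w) w′ = trans (cong (φ a +_) (weight-++ φ w w′)) (sym (+-assoc (φ a) _ _))

skeleton : Seq Λ d → List Λ
skeleton ε          = []
skeleton (lt a s)   = a ∷ skeleton s
skeleton (st v E s) = skeleton s

skeleton∈ : (s : Seq Λ d) → skeleton s ∈L s
skeleton∈ ε          = empty
skeleton∈ (lt a s)   = cons (skeleton∈ s)
skeleton∈ (st v E s) = stop (skeleton∈ s)

weightS : (Λ → ℕ) → (s : Seq Λ d) → CS s → ℕ
weightA : (Λ → ℕ) → (E : List (Seq Λ d)) → CA E → ℕ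
weightS φ ε          n         = 0
weightS φ (lt a s)   n         = weightS φ s n
weightS φ (st v E s) (n , n′)  = weightA φ E n + weightS φ s n′
weightA φ []      n            = 0
weightA φ (e ∷ E) (k , n , n′) = (k * weight φ (skeleton e) + weightS φ e n) + weightA φ E n′

weightS-add : ∀ (φ : Λ → ℕ) (s : Seq Λ d) m n → weightS φ s (addS s m n) ≡ weightS φ s m + weightS φ s n
weightA-add : ∀ (φ : Λ → ℕ) (E : List (Seq Λ d)) m n → weightA φ E (addA E m n) ≡ weightA φ E m + weightA
    φ E n
weightS-add φ ε          m n = refl
weightS-add φ (lt a s)   m n = weightS-add φ s m n
weightS-add φ (st v E s) (m , m′) (n , n′) = trans (cong₂ _+_ (weightA-add φ E m n) (weightS-add φ s m′ n′))
  (interchange (weightA φ E m) (weightA φ E n) (weightS φ s m′) (weightS φ s n′))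
weightA-add φ []      m n = refl
weightA-add φ (e ∷ E) (j , m , m′) (k , n , n′) = trans
    (cong₂ _+_ (cong₂ _+_ (*-distribʳ-+ _ j k) (weightS-add φ e m n)) (weightA-add φ E m′ n′))
  (lem (j * x) (k * x) (weightS φ e m) (weightS φ e n) (weightA φ E m′) (weightA φ E n′))
  where
  x = weight φ (skeleton e)
  lem : ∀ a b c d p q → (a + b) + (c + d) + (p + q) ≡ (a + c + p) + (b + d + q)
  lem = solve-∀

weightS-zero : ∀ (φ : Λ → ℕ) (s : Seq Λ d) → weightS φ s (zeroS s) ≡ 0
weightA-zero : ∀ (φ : Λ → ℕ) (E : List (Seq Λ d)) → weightA φ E (zeroA E) ≡ 0
weightS-zero φ ε          = refl
weightS-zero φ (lt a s)   = weightS-zero φ s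
weightS-zero φ (st v E s) = cong₂ _+_ (weightA-zero φ E) (weightS-zero φ s)
weightA-zero φ []      = refl
weightA-zero φ (e ∷ E) = cong₂ _+_ (weightS-zero φ e) (weightA-zero φ E)

inject : {e : Seq Λ d} → e ∈ E → CS e → CA E
inject {E = _ ∷ E} (here refl) n = 1 , n , zeroA E
inject {E = e ∷ E} (there e∈)  n = 0 , zeroS e , inject e∈ n

count : {s : Seq Λ d} → w ∈L s → CS s
count empty                            = tt
count (cons x)                         = count x
count {s = st v E s} (stop x)          = zeroA E , count x
count {s = st v E s} (loop e∈ x y refl) = addA E (inject e∈ (count x)) (proj₁ (count y)) , proj₂ (count y)

weight-inject : ∀ (φ : Λ → ℕ) {E} {e : Seq Λ d} (e∈ : e ∈ E) n →
                weightA φ E (inject e∈ n) ≡ weight φ (skeleton e) + weightS φ e n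
weight-inject φ {e ∷ E} (here refl) n rewrite weightA-zero φ E = trans (+-identityʳ _)
    (cong (_+ weightS φ e n) (+-identityʳ _))
weight-inject φ {e ∷ E} (there e∈)  n rewrite weightS-zero φ e = weight-inject φ e∈ n

-- Each iteration contributes the skeleton of its alternative and whatever the stars nested in it
-- contribute. As `φ` is arbitrary, this determines the letter counts of the word; with tokens taken
-- and put as weights it gives the effect on a counter.
weight-count : ∀ (φ : Λ → ℕ) {s : Seq Λ d} (x : w ∈L s) → weight φ w ≡ weight φ (skeleton s) + weightS φ s
    (count x)
weight-count φ empty    = refl
weight-count φ (cons {a} {w} x) = trans (cong (φ a +_) (weight-count φ x)) (sym (+-assoc (φ a) _ _))
weight-count φ {st v E s} (stop x) rewrite weightA-zero φ E = weight-count φ x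
weight-count φ {st v E s} (loop {e = e} {w₁ = w₁} {w₂} e∈ x y refl) = begin
  weight φ (w₁ ++ w₂)                         ≡⟨ weight-++ φ w₁ w₂ ⟩
  weight φ w₁ + weight φ w₂                   ≡⟨ cong₂ _+_
      (trans (weight-count φ x) (sym (weight-inject φ e∈ (count x)))) (weight-count φ y) ⟩
  i + (k + (p + q))                           ≡⟨ lem i k p q ⟩
  k + ((i + p) + q)                           ≡⟨ cong (λ z → k + (z + q)) (sym (weightA-add φ E _ _)) ⟩
  _                                           ∎
  where
  open ≡-Reasoning
  i = weightA φ E (inject e∈ (count x))
  k = weight φ (skeleton s)
  p = weightA φ E (proj₁ (count y))
  q = weightS φ s (proj₂ (count y))
  lem : ∀ i k p q → i + (k + (p + q)) ≡ k + ((i + p) + q)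
  lem = solve-∀

PosS : (s : Seq Λ d) → CS s → Set
PosA : (E : List (Seq Λ d)) → CA E → Set
PosS ε          n            = ⊤
PosS (lt a s)   n            = PosS s n
PosS (st v E s) (n , n′)     = PosA E n × PosS s n′
PosA []         n            = ⊤
PosA (e ∷ E)    (k , n , n′) = 0 < k × PosS e n × PosA E n′

power : ℕ → List Λ → List Λ
power zero    w = []
power (suc k) w = w ++ power k w

weight-power : ∀ (φ : Λ → ℕ) k w → weight φ (power k w) ≡ k * weight φ w
weight-power φ zero    w = refl
weight-power φ (suc k) w = trans (weight-++ φ w (power k w)) (cong (weight φ w +_) (weight-power φ k w))

power∈ : ∀ k → w ∈L st v E ε → power k w ∈L st v E ε
power∈ zero    x = stop empty
power∈ (suc k) x = star-++ x (power∈ k x)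

Realization : (s : Seq Λ d) → CS s → Set
Realization {Λ} s n = ∃ λ w → w ∈L s × (∀ (φ : Λ → ℕ) → weight φ w ≡ weight φ (skeleton s) + weightS φ s n)

-- Two lists are needed for the recursion: it consumes `F`, while the word remains in the star of
-- the whole list `E`.
StarRealization : (Fin d → Maybe ℕ) → (E F : List (Seq Λ d)) → CA F → Set
StarRealization {Λ = Λ} v E F n = ∃ λ w → w ∈L st v E ε × (∀ (φ : Λ → ℕ) → weight φ w ≡ weightA φ F n)

-- One copy of each alternative hosts all uses of the stars nested in it.
realizeS : (s : Seq Λ d) (n : CS s) → PosS s n → Realization s n
realizeA : ∀ v (E F : List (Seq Λ d)) → (∀ {e} → e ∈ F → e ∈ E) → (n : CA F) → PosA F n → StarRealization
    v E F n
realizeS ε          n p = [] , empty , λ φ → refl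
realizeS (lt a s)   n p with realizeS s n p
... | w , x , e = a ∷ w , cons x , λ φ → trans (cong (φ a +_) (e φ)) (sym (+-assoc (φ a) _ _))
realizeS (st v E s) (n , n′) (p , p′) with realizeA v E E id n p | realizeS s n′ p′
... | w , x , e | w′ , x′ , e′ = w ++ w′ , star-++ x (stop x′) , λ φ →
  trans (weight-++ φ w w′) (trans (cong₂ _+_ (e φ) (e′ φ))
      (lem (weightA φ E n) (weight φ (skeleton s)) (weightS φ s n′)))
  where
  lem : ∀ a b c → a + (b + c) ≡ b + (a + c)
  lem = solve-∀
realizeA v E []      sub n            p = [] , stop empty , λ φ → refl
realizeA v E (e ∷ F) sub (suc k , n , n′) (_ , p , p′) with realizeS e n p | realizeA v E F (sub ∘ there)
    n′ p′
... | w , x , eq | w′ , x′ , eq′ = (power k sk ++ w) ++ w′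
  , star-++ {v = v} (star-++ {v = v} (power∈ k (loop (sub (here refl)) (skeleton∈ e) (stop empty)
      (sym (++-identityʳ sk))))
                     (loop (sub (here refl)) x (stop empty) (sym (++-identityʳ w)))) x′
  , λ φ → trans (weight-++ φ (power k sk ++ w) w′) (cong₂ _+_ (trans (weight-++ φ (power k sk) w)
      (trans (cong₂ _+_ (weight-power φ k sk) (eq φ)) (lem (weight φ sk) k (weightS φ e n)))) (eq′ φ))
  where
  sk = skeleton e
  lem : ∀ x k y → k * x + (x + y) ≡ (x + k * x) + y
  lem = solve-∀

sizeS : Seq Λ d → ℕ
sizeA : List (Seq Λ d) → ℕ
sizeS ε          = 0
sizeS (lt a s)   = sizeS s
sizeS (st v E s) = sizeA E + sizeS s
sizeA []         = 0
sizeA (e ∷ E)    = suc (sizeS e + sizeA E)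

-- The multiplicities h serve as a mask: alternatives with multiplicity 0 are discarded.
cleanS : (s : Seq Λ d) → CS s → Seq Λ d
cleanA : (E : List (Seq Λ d)) → CA E → List (Seq Λ d)
cleanS ε          h        = ε
cleanS (lt a s)   h        = lt a (cleanS s h)
cleanS (st v E s) (h , h′) = st v (cleanA E h) (cleanS s h′)
cleanA []         h                = []
cleanA (e ∷ E)    (zero  , _ , h′) = cleanA E h′
cleanA (e ∷ E)    (suc _ , h , h′) = cleanS e h ∷ cleanA E h′

sizeS-clean : ∀ (s : Seq Λ d) h → sizeS (cleanS s h) ≤ sizeS s
sizeA-clean : ∀ (E : List (Seq Λ d)) h → sizeA (cleanA E h) ≤ sizeA E
sizeS-clean ε          h = z≤n
sizeS-clean (lt a s)   h = sizeS-clean s h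
sizeS-clean (st v E s) (h , h′) = +-mono-≤ (sizeA-clean E h) (sizeS-clean s h′)
sizeA-clean []      h = z≤n
sizeA-clean (e ∷ E) (zero  , _ , h′) = m≤n⇒m≤1+n (m≤n⇒m≤o+n (sizeS e) (sizeA-clean E h′))
sizeA-clean (e ∷ E) (suc _ , h , h′) = s≤s (+-mono-≤ (sizeS-clean e h) (sizeA-clean E h′))

pos-or-shrinksS : ∀ (s : Seq Λ d) h → PosS s h ⊎ sizeS (cleanS s h) < sizeS s
pos-or-shrinksA : ∀ (E : List (Seq Λ d)) h → PosA E h ⊎ sizeA (cleanA E h) < sizeA E
pos-or-shrinksS ε          h = inj₁ tt
pos-or-shrinksS (lt a s)   h = pos-or-shrinksS s h
pos-or-shrinksS (st v E s) (h , h′) with pos-or-shrinksA E h | pos-or-shrinksS s h′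
... | inj₁ p | inj₁ q = inj₁ (p , q)
... | inj₂ p | _      = inj₂ (+-mono-<-≤ p (sizeS-clean s h′))
... | inj₁ _ | inj₂ q = inj₂ (+-mono-≤-< (sizeA-clean E h) q)
pos-or-shrinksA []      h = inj₁ tt
pos-or-shrinksA (e ∷ E) (zero , _ , h′) = inj₂ (s≤s (m≤n⇒m≤o+n (sizeS e) (sizeA-clean E h′)))
pos-or-shrinksA (e ∷ E) (suc _ , h , h′) with pos-or-shrinksS e h | pos-or-shrinksA E h′
... | inj₁ p | inj₁ q = inj₁ (s≤s z≤n , p , q)
... | inj₂ p | _      = inj₂ (s≤s (+-mono-<-≤ p (sizeA-clean E h′)))
... | inj₁ _ | inj₂ q = inj₂ (s≤s (+-mono-≤-< (sizeS-clean e h) q))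

-- Unrolling rarely used alternatives

-- Counts k uses of an alternative if its multiplicity l in the mask is 0. For fixed l this is
-- additive in k and vanishes at k = l, so the sums `badS` and `badA` are functionals to which
-- `agree` applies.
badness : ℕ → ℕ → ℕ
badness zero    k = k
badness (suc _) k = 0

badS : (s : Seq Λ d) → CS s → CS s → ℕ
badA : (E : List (Seq Λ d)) → CA E → CA E → ℕ
badS ε          h        n        = 0
badS (lt a s)   h        n        = badS s h n
badS (st v E s) (h , h′) (n , n′) = badA E h n + badS s h′ n′
badA []      h             n            = 0
badA (e ∷ E) (l , h , h′) (k , n , n′)  = (badness l k + badS e h n) + badA E h′ n′

badness-add : ∀ l j k → badness l (j + k) ≡ badness l j + badness l k
badness-add zero    j k = refl
badness-add (suc l) j k = refl

badS-add : ∀ (s : Seq Λ d) h m n → badS s h (addS s m n) ≡ badS s h m + badS s h n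
badA-add : ∀ (E : List (Seq Λ d)) h m n → badA E h (addA E m n) ≡ badA E h m + badA E h n
badS-add ε          h m n = refl
badS-add (lt a s)   h m n = badS-add s h m n
badS-add (st v E s) (h , h′) (m , m′) (n , n′) = trans (cong₂ _+_ (badA-add E h m n) (badS-add s h′ m′ n′))
  (interchange (badA E h m) (badA E h n) (badS s h′ m′) (badS s h′ n′))
badA-add []      h m n = refl
badA-add (e ∷ E) (l , h , h′) (j , m , m′) (k , n , n′) =
  trans (cong₂ _+_ (trans (cong₂ _+_ (badness-add l j k) (badS-add e h m n))
                          (interchange (badness l j) (badness l k) (badS e h m) (badS e h n)))
                              (badA-add E h′ m′ n′))
        (interchange (badness l j + badS e h m) _ (badA E h′ m′) _)

badS-self : ∀ (s : Seq Λ d) h → badS s h h ≡ 0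
badA-self : ∀ (E : List (Seq Λ d)) h → badA E h h ≡ 0
badS-self ε          h        = refl
badS-self (lt a s)   h        = badS-self s h
badS-self (st v E s) (h , h′) = cong₂ _+_ (badA-self E h) (badS-self s h′)
badA-self []      h                = refl
badA-self (e ∷ E) (zero  , h , h′) = cong₂ _+_ (badS-self e h) (badA-self E h′)
badA-self (e ∷ E) (suc _ , h , h′) = cong₂ _+_ (badS-self e h) (badA-self E h′)

badS-zero : ∀ (s : Seq Λ d) h → badS s h (zeroS s) ≡ 0
badA-zero : ∀ (E : List (Seq Λ d)) h → badA E h (zeroA E) ≡ 0
badS-zero ε          h        = refl
badS-zero (lt a s)   h        = badS-zero s h
badS-zero (st v E s) (h , h′) = cong₂ _+_ (badA-zero E h) (badS-zero s h′)
badA-zero []      h                = refl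
badA-zero (e ∷ E) (zero  , h , h′) = cong₂ _+_ (badS-zero e h) (badA-zero E h′)
badA-zero (e ∷ E) (suc _ , h , h′) = cong₂ _+_ (badS-zero e h) (badA-zero E h′)

at : {e : Seq Λ d} → e ∈ E → CA E → ℕ × CS e
at (here refl) (l , h , _) = l , h
at (there e∈)  (_ , _ , h) = at e∈ h

bad-inject : ∀ {E} {e : Seq Λ d} (e∈ : e ∈ E) h n →
             badA E h (inject e∈ n) ≡ badness (proj₁ (at e∈ h)) 1 + badS e (proj₂ (at e∈ h)) n
bad-inject {E = e ∷ E} (here refl) (l , h , h′) n rewrite badA-zero E h′ = +-identityʳ _
bad-inject {E = e ∷ E} (there e∈)  (zero  , h , h′) n rewrite badS-zero e h = bad-inject e∈ h′ n
bad-inject {E = e ∷ E} (there e∈)  (suc _ , h , h′) n rewrite badS-zero e h = bad-inject e∈ h′ n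

clean∈ : ∀ {e : Seq Λ d} (e∈ : e ∈ E) h {k} → proj₁ (at e∈ h) ≡ suc k → cleanS e (proj₂ (at e∈ h)) ∈
    cleanA E h
clean∈ (here refl) (suc l , h , h′) eq = here refl
clean∈ (there e∈)  (zero  , h , h′) eq = clean∈ e∈ h′ eq
clean∈ (there e∈)  (suc _ , h , h′) eq = there (clean∈ e∈ h′ eq)

clean⊆S : ∀ (s : Seq Λ d) h {w} → w ∈L cleanS s h → w ∈L s
clean⊆A : ∀ {v} (E : List (Seq Λ d)) h {e′ w} → e′ ∈ cleanA E h → w ∈L e′ → ∃ λ e → e ∈ E × w ∈L e
clean⊆S ε          h x        = x
clean⊆S (lt a s)   h (cons x) = cons (clean⊆S s h x)
clean⊆S (st v E s) (h , h′) (stop x) = stop (clean⊆S s h′ x)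
clean⊆S (st v E s) (h , h′) (loop e∈ x y eq) with clean⊆A {v = v} E h e∈ x
... | e , e∈′ , x′ = loop e∈′ x′ (clean⊆S (st v E s) (h , h′) y) eq
clean⊆A {v = v} (e ∷ E) (zero  , _ , h′) e∈ x with clean⊆A {v = v} E h′ e∈ x
... | e′ , e∈′ , x′ = e′ , there e∈′ , x′
clean⊆A (e ∷ E) (suc _ , h , h′) (here refl) x = e , here refl , clean⊆S e h x
clean⊆A {v = v} (e ∷ E) (suc _ , h , h′) (there e∈) x with clean⊆A {v = v} E h′ e∈ x
... | e′ , e∈′ , x′ = e′ , there e∈′ , x′

badness-zero : ∀ l → badness l 1 ≡ 0 → ∃ λ k → l ≡ suc k
badness-zero (suc k) refl = k , refl

clean-complete : ∀ {s : Seq Λ d} h (x : w ∈L s) → badS s h (count x) ≡ 0 → w ∈L cleanS s h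
clean-complete h empty    z = empty
clean-complete h (cons x) z = cons (clean-complete h x z)
clean-complete {s = st v E s} (h , h′) (stop x) z = stop
    (clean-complete h′ x (m+n≡0⇒n≡0 (badA E h (zeroA E)) z))
clean-complete {s = st v E s} (h , h′) (loop {e = e} e∈ x y refl) z =
  loop (clean∈ e∈ h (proj₂ l)) (clean-complete (proj₂ (at e∈ h)) x
      (m+n≡0⇒n≡0 (badness (proj₁ (at e∈ h)) 1) z₃))
       (clean-complete (h , h′) y (cong₂ _+_ (m+n≡0⇒n≡0 (badA E h (inject e∈ (count x))) z₂)
           (m+n≡0⇒n≡0 (badA E h _) z))) refl
  where
  z₂ = trans (sym (badA-add E h (inject e∈ (count x)) (proj₁ (count y)))) (m+n≡0⇒m≡0 _ z)
  z₃ = trans (sym (bad-inject e∈ h (count x))) (m+n≡0⇒m≡0 _ z₂)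
  l = badness-zero (proj₁ (at e∈ h)) (m+n≡0⇒m≡0 _ z₃)

-- The star of `C`, interrupted at most k times by an element of `D`. In the application `C`
-- consists of the alternatives kept by the mask, with nested ones cleaned too, and `D` of unrolled
-- versions of all alternatives.
iterations : (Fin d → Maybe ℕ) → (C D : List (Seq Λ d)) → ℕ → List (Seq Λ d)
iterations v C D zero    = st v C ε ∷ []
iterations v C D (suc k) = st v C ε ∷ cartesianProductWith (λ e r → st v C (e ◇ r)) D (iterations v C D k)

iterations-elim : ∀ (P : Seq Λ d → Set) {v C D} → P (st v C ε) →
    (∀ e {r} → e ∈ D → P r → P (st v C (e ◇ r))) →
                  ∀ k {p} → p ∈ iterations v C D k → P p
iterations-elim P base step zero    (here refl) = base
iterations-elim P base step (suc k) (here refl) = base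
iterations-elim P {v} {C} {D} base step (suc k) (there p∈)
  with ∈-cartesianProductWith⁻ (λ e r → st v C (e ◇ r)) D (iterations v C D k) p∈
... | e , r , e∈ , r∈ , refl = step e e∈ (iterations-elim P base step k r∈)

module Unroll (K : ℕ) where

  -- Alternatives kept by the mask are unrolled as well, since a single iteration of one may use
  -- discarded alternatives deeper inside. The same budget `K` is granted at every depth.
  unrollS : (s : Seq Λ d) → CS s → List (Seq Λ d)
  unrollA : (E : List (Seq Λ d)) → CA E → List (Seq Λ d)
  unrollS ε          h        = ε ∷ []
  unrollS (lt a s)   h        = map (lt a) (unrollS s h)
  unrollS (st v E s) (h , h′) = cartesianProductWith _◇_ (iterations v (cleanA E h) (unrollA E h) K)
      (unrollS s h′)
  unrollA []      h             = []
  unrollA (e ∷ E) (_ , h , h′) = unrollS e h ++ unrollA E h′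

  unroll∈ : ∀ {e : Seq Λ d} (e∈ : e ∈ E) h {e′} → e′ ∈ unrollS e (proj₂ (at e∈ h)) → e′ ∈ unrollA E h
  unroll∈ (here refl) (l , h , h′) p = ∈-++⁺ˡ p
  unroll∈ {E = e ∷ E} (there e∈) (l , h , h′) p = ∈-++⁺ʳ (unrollS e h) (unroll∈ e∈ h′ p)

  unroll-soundS : ∀ (s : Seq Λ d) h {s′ w} → s′ ∈ unrollS s h → w ∈L s′ → w ∈L s
  unroll-soundA : ∀ (E : List (Seq Λ d)) h {e′ w} → e′ ∈ unrollA E h → w ∈L e′ → ∃ λ e → e ∈ E × w ∈L e
  unroll-star : ∀ v (E : List (Seq Λ d)) h k {p w} → p ∈ iterations v (cleanA E h) (unrollA E h) k → w ∈L
      p → w ∈L st v E ε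
  unroll-soundS ε          h (here refl) x = x
  unroll-soundS (lt a s)   h s∈ x with ∈-map⁻ (lt a) s∈
  unroll-soundS (lt a s)   h s∈ (cons x) | s′ , s′∈ , refl = cons (unroll-soundS s h s′∈ x)
  unroll-soundS (st v E s) (h , h′) s∈ x
    with ∈-cartesianProductWith⁻ _◇_ (iterations v (cleanA E h) (unrollA E h) K) (unrollS s h′) s∈
  ... | p , q , p∈ , q∈ , refl with ◇-elim p x
  ... | w₁ , w₂ , refl , y , z = star-++ (unroll-star v E h K p∈ y) (stop (unroll-soundS s h′ q∈ z))
  unroll-soundA (e ∷ E) (l , h , h′) e∈ x with ∈-++⁻ (unrollS e h) e∈
  ... | inj₁ q = e , here refl , unroll-soundS e h q x
  ... | inj₂ q with unroll-soundA E h′ q x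
  ... | e₁ , e₁∈ , y = e₁ , there e₁∈ , y
  unroll-star {Λ} {d} v E h k p∈ x = iterations-elim (λ p → ∀ {w} → w ∈L p → w ∈L st v E ε)
    (clean⊆S (st v E ε) (h , tt)) step k p∈ x
    where
    step : ∀ e {r} → e ∈ unrollA E h → (∀ {w} → w ∈L r → w ∈L st v E ε) → ∀ {w} → w ∈L st v (cleanA E h)
        (e ◇ r) → w ∈L st v E ε
    step e e∈ f x with split x
      where
      split : ∀ {C s} {w : List Λ} → w ∈L st v C s → ∃ λ w₁ → ∃ λ w₂ → w ≡ w₁ ++ w₂ × w₁ ∈L st v C ε × w₂ ∈L s
      split = ◇-elim (st v _ ε)
    ... | w₁ , w₂ , refl , y , z with ◇-elim e z
    ... | w₃ , w₄ , refl , z₁ , z₂ with unroll-soundA E h e∈ z₁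
    ... | e₁ , e₁∈ , z₁′ = star-++ {v = v} (clean⊆S (st v E ε) (h , tt) y) (loop e₁∈ z₁′ (f z₂) refl)

  -- Every member of `iterations` begins with the star of `C`, which accepts further iterations of
  -- `C` in front.
  absorb : ∀ {v} {C D : List (Seq Λ d)} {c} k {p} → c ∈ C → w₁ ∈L c → p ∈ iterations v C D k → w₂ ∈L p →
      w₁ ++ w₂ ∈L p
  absorb {w₁ = w₁} {v = v} {C} {D} k c∈ x p∈ = iterations-elim (λ p → ∀ {w₂} → w₂ ∈L p → w₁ ++ w₂ ∈L p)
    (λ y → loop c∈ x y refl) (λ e e∈ _ y → loop c∈ x y refl) k p∈

  iterations-first : ∀ v (C D : List (Seq Λ d)) k → st v C ε ∈ iterations v C D k
  iterations-first v C D zero    = here refl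
  iterations-first v C D (suc k) = here refl

  UnrollsStar : (v : Fin d → Maybe ℕ) (E : List (Seq Λ d)) → CA E → (s : Seq Λ d) → CS s → ℕ → List Λ → Set
  UnrollsStar v E h s h′ k w = ∃ λ w₁ → ∃ λ w₂ → w ≡ w₁ ++ w₂
    × (∃ λ p → p ∈ iterations v (cleanA E h) (unrollA E h) k × w₁ ∈L p) × (∃ λ q → q ∈ unrollS s h′ × w₂ ∈L q)

  unroll-complete : ∀ {s : Seq Λ d} h (x : w ∈L s) → badS s h (count x) ≤ K → ∃ λ s′ → s′ ∈ unrollS s h ×
      w ∈L s′
  -- An iteration that uses a discarded alternative, at its top or deeper inside, adds at least one
  -- to `badA` and is charged as one of the k interruptions. Any other iteration lies in the cleaned
  -- star and is absorbed for free. The condition k ≤ K is carried along because the interior of a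
  -- charged iteration is unrolled with budget `K`.
  unroll-complete-star : ∀ {v : Fin d → Maybe ℕ} {E : List (Seq Λ d)} {s : Seq Λ d} h h′
      (x : w ∈L st v E s) k → k ≤ K → badA E h (proj₁ (count x)) ≤ k →
                         badS s h′ (proj₂ (count x)) ≤ K → UnrollsStar v E h s h′ k w
  unroll-complete h empty    b = ε , here refl , empty
  unroll-complete h (cons {a} x) b with unroll-complete h x b
  ... | s′ , s′∈ , y = lt a s′ , ∈-map⁺ (lt a) s′∈ , cons y
  unroll-complete {s = st v E s} (h , h′) x@(stop _) b
    with unroll-complete-star h h′ x K ≤-refl (≤-trans (m≤m+n _ _) b)
        (≤-trans (m≤n+m _ (badA E h (proj₁ (count x)))) b)
  ... | _ , _ , refl , (p , p∈ , y) , (q , q∈ , z) = p ◇ q , ∈-cartesianProductWith⁺ _◇_ p∈ q∈ , ◇-intro y z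
  unroll-complete {s = st v E s} (h , h′) x@(loop _ _ _ _) b
    with unroll-complete-star h h′ x K ≤-refl (≤-trans (m≤m+n _ _) b)
        (≤-trans (m≤n+m _ (badA E h (proj₁ (count x)))) b)
  ... | _ , _ , refl , (p , p∈ , y) , (q , q∈ , z) = p ◇ q , ∈-cartesianProductWith⁺ _◇_ p∈ q∈ , ◇-intro y z
  unroll-complete-star {w = w} {v = v} {E} h h′ (stop x) k k≤ b b′ with unroll-complete h′ x b′
  ... | q , q∈ , y = [] , w , refl , (_ , iterations-first v (cleanA E h) (unrollA E h) k , stop empty) ,
      (q , q∈ , y)
  unroll-complete-star {v = v} {E} {s} h h′ (loop {e = e} {w₁ = u} {u′} e∈ x y refl) k k≤ b b′ = go
      (proj₁ (at e∈ h)) refl (badS e (proj₂ (at e∈ h)) (count x)) refl k k≤ total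
    where
    he = proj₂ (at e∈ h)
    rest = badA E h (proj₁ (count y))
    total : (badness (proj₁ (at e∈ h)) 1 + badS e he (count x)) + rest ≤ k
    total = subst (_≤ k) (trans (badA-add E h (inject e∈ (count x)) (proj₁ (count y)))
        (cong (_+ rest) (bad-inject e∈ h (count x)))) b
    dirty : ∀ k → suc k ≤ K → badS e he (count x) ≤ suc k → rest ≤ k → UnrollsStar v E h s h′ (suc k)
        (u ++ u′)
    dirty k k≤ bx by with unroll-complete he x (≤-trans bx k≤) | unroll-complete-star h h′ y k (<⇒≤ k≤) by b′
    ... | e′ , e′∈ , x′ | w₁ , w₂ , refl , (p , p∈ , y′) , q = u ++ w₁ , w₂ , sym (++-assoc u w₁ w₂)
      , (_ , there (∈-cartesianProductWith⁺ (λ e r → st v (cleanA E h) (e ◇ r)) (unroll∈ e∈ h e′∈) p∈) ,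
          stop (◇-intro x′ y′)) , q
    go : ∀ l → proj₁ (at e∈ h) ≡ l → ∀ m → badS e he (count x) ≡ m → ∀ k → k ≤ K →
         (badness l 1 + m) + rest ≤ k → UnrollsStar v E h s h′ k (u ++ u′)
    go (suc l) eq zero m≡ k k≤ tot with unroll-complete-star h h′ y k k≤ tot b′
    ... | w₁ , w₂ , refl , (p , p∈ , y′) , q = u ++ w₁ , w₂ , sym (++-assoc u w₁ w₂)
      , (p , p∈ , absorb k (clean∈ e∈ h eq) (clean-complete he x m≡) p∈ y′) , q
    go zero eq m refl (suc k) k≤ (s≤s tot) = dirty k k≤ (m≤n⇒m≤1+n (≤-trans (m≤m+n m rest) tot))
        (≤-trans (m≤n+m rest m) tot)
    go (suc l) eq (suc m) m≡ (suc k) k≤ (s≤s tot) = dirty k k≤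
        (subst (_≤ suc k) (sym m≡) (s≤s (≤-trans (m≤m+n m rest) tot))) (≤-trans (m≤n+m rest m) tot)

-- Termination order and firing

-- Stars nested inside alternatives are deliberately not visited: the procedure rewrites only stars
-- of the sequence itself, and the termination order speaks only of these.
Stars : ((Fin d → Maybe ℕ) → List (Seq Λ d) → Set) → Seq Λ d → Set
Stars P ε          = ⊤
Stars P (lt a s)   = Stars P s
Stars P (st v E s) = P v E × Stars P s

Stars-◇ : ∀ {P} (s : Seq Λ d) {t} → Stars P s → Stars P t → Stars P (s ◇ t)
Stars-◇ ε          p       q = q
Stars-◇ (lt a s)   p       q = Stars-◇ s p q
Stars-◇ (st v E s) (x , p) q = x , Stars-◇ s p q

Stars-map : ∀ {P Q} → (∀ {v E} → P v E → Q v E) → (s : Seq Λ d) → Stars P s → Stars Q s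
Stars-map f ε          p       = p
Stars-map f (lt a s)   p       = Stars-map f s p
Stars-map f (st v E s) (x , p) = f x , Stars-map f s p

Stars-zip : ∀ {P Q R} → (∀ {v E} → P v E → Q v E → R v E) → (s : Seq Λ d) → Stars P s → Stars Q s → Stars R s
Stars-zip f ε          p       q        = p
Stars-zip f (lt a s)   p       q        = Stars-zip f s p q
Stars-zip f (st v E s) (x , p) (x′ , q) = f x x′ , Stars-zip f s p q

unfrozen : Bool → ℕ
unfrozen true  = 0
unfrozen false = 1

free : (Fin d → Maybe ℕ) → ℕ
free {zero}  v = 0
free {suc d} v = unfrozen (is-just (v zero)) + free (v ∘ suc)

SameMask : (u v : Fin d → Maybe ℕ) → Set
SameMask u v = ∀ i → is-just (u i) ≡ is-just (v i)

free-cong : {u v : Fin d → Maybe ℕ} → SameMask u v → free u ≡ free v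
free-cong {zero}  m = refl
free-cong {suc d} m = cong₂ _+_ (cong unfrozen (m zero)) (free-cong (m ∘ suc))

unfrozen-mono : ∀ a b → (b ≡ true → a ≡ true) → unfrozen a ≤ unfrozen b
unfrozen-mono true  b     f = z≤n
unfrozen-mono false true  f = case f refl of λ ()
unfrozen-mono false false f = ≤-refl

free-mono : {u v : Fin d → Maybe ℕ} → (∀ i → is-just (v i) ≡ true → is-just (u i) ≡ true) → free u ≤ free v
free-mono {zero}          m = z≤n
free-mono {suc d} {u} {v} m = +-mono-≤ (unfrozen-mono (is-just (u zero)) (is-just (v zero)) (m zero))
    (free-mono (m ∘ suc))

free-< : {u v : Fin d → Maybe ℕ} → (∀ i → is-just (v i) ≡ true → is-just (u i) ≡ true) →
         ∀ i → is-just (v i) ≡ false → is-just (u i) ≡ true → free u < free v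
free-< {suc d} {u} {v} m zero    p q rewrite p | q = s≤s (free-mono (m ∘ suc))
free-< {suc d} {u} {v} m (suc i) p q = +-mono-≤-< (unfrozen-mono (is-just (u zero)) (is-just (v zero))
    (m zero)) (free-< (m ∘ suc) i p q)

data Lex : ℕ × ℕ → ℕ × ℕ → Set where
  fst : ∀ {a b a′ b′} → a < a′ → Lex (a , b) (a′ , b′)
  snd : ∀ {a a′ b b′} → a ≡ a′ → b < b′ → Lex (a , b) (a′ , b′)

Lex-wellFounded : ∀ x → Acc Lex x
Lex-wellFounded (a , b) = acc (go (<-wellFounded a) (<-wellFounded b))
  where
  go : ∀ {a b} → Acc _<_ a → Acc _<_ b → ∀ {y} → Lex y (a , b) → Acc Lex y
  go (acc ra) _        (fst p)      = acc (go (ra p) (<-wellFounded _))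
  go aa       (acc rb) (snd refl p) = acc (go aa (rb p))

measure : (Fin d → Maybe ℕ) → List (Seq Λ d) → ℕ × ℕ
measure v E = free v , sizeA E

Smaller : ℕ × ℕ → Seq Λ d → Set
Smaller m = Stars λ v E → Lex (measure v E) m

infix 4 _≺_
data _≺_ {Λ d} : Seq Λ d → Seq Λ d → Set where
  replace : ∀ {v E t s} → Smaller (measure v E) t → t ◇ s ≺ st v E s
  lt      : ∀ {a s s′} → s′ ≺ s → lt a s′ ≺ lt a s
  st      : ∀ {v E s s′} → s′ ≺ s → st v E s′ ≺ st v E s

≺-wellFounded-lt : ∀ a {s : Seq Λ d} → Acc _≺_ s → Acc _≺_ (lt a s)
≺-wellFounded-lt a (acc r) = acc λ { (lt p) → ≺-wellFounded-lt a (r p) }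

-- As for multiset orders: `star` inducts on the measure of a star and, below it, on the
-- accessibility of what follows; `many` puts the smaller stars that replace it in front of the tail
-- one at a time.
≺-wellFounded : (s : Seq Λ d) → Acc _≺_ s
≺-wellFounded ε          = acc λ ()
≺-wellFounded (lt a s)   = ≺-wellFounded-lt a (≺-wellFounded s)
≺-wellFounded (st v E s) = star (Lex-wellFounded (measure v E)) (≺-wellFounded s)
  where
  star : ∀ {v} {E : List (Seq Λ d)} {s} → Acc Lex (measure v E) → Acc _≺_ s → Acc _≺_ (st v E s)
  many : ∀ {m} → (∀ {m′} → Lex m′ m → Acc Lex m′) → (t : Seq Λ d) {s : Seq Λ d} → Smaller m t → Acc _≺_ s
      → Acc _≺_ (t ◇ s)
  below : ∀ {v} {E : List (Seq Λ d)} {s} → Acc Lex (measure v E) → Acc _≺_ s → ∀ {r} → r ≺ st v E s → Acc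
      _≺_ r
  star am as = acc (below am as)
  below (acc rm)    as       (replace {t = t} sm) = many rm t sm as
  below am          (acc rs) (st p)               = star am (rs p)
  many rm ε          sm       as = as
  many rm (lt a t)   sm       as = ≺-wellFounded-lt a (many rm t sm as)
  many rm (st v E t) (x , sm) as = star (rm x) (many rm t sm as)

module _ {Λ : Set} (pr po : Λ → ℕ) where

  Fire : List Λ → ℕ → ℕ → Set
  Fire []      m n = m ≡ n
  Fire (a ∷ w) m n = ∃ λ r → m ≡ pr a + r × Fire w (po a + r) n

  fire-++ : ∀ w {w′ k m n} → Fire w k m → Fire w′ m n → Fire (w ++ w′) k n
  fire-++ []      refl         g = g
  fire-++ (a ∷ w) (r , e , f) g = r , e , fire-++ w f g

  fire-split : ∀ w {w′ k n} → Fire (w ++ w′) k n → ∃ λ m → Fire w k m × Fire w′ m n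
  fire-split []      g           = _ , refl , g
  fire-split (a ∷ w) (r , e , f) with fire-split w f
  ... | m , g , h = m , (r , e , g) , h

  fire-effect : ∀ w {m n} → Fire w m n → n + weight pr w ≡ m + weight po w
  fire-effect []      refl           = refl
  fire-effect (a ∷ w) {n = n} (r , refl , f) = begin
    n + (pr a + weight pr w)      ≡⟨ lem n (pr a) (weight pr w) ⟩
    pr a + (n + weight pr w)      ≡⟨ cong (pr a +_) (fire-effect w f) ⟩
    pr a + (po a + r + weight po w) ≡⟨ lem′ (pr a) (po a) r (weight po w) ⟩
    pr a + r + (po a + weight po w) ∎
    where
    open ≡-Reasoning
    lem : ∀ n p q → n + (p + q) ≡ p + (n + q)
    lem = solve-∀
    lem′ : ∀ p o r q → p + (o + r + q) ≡ p + r + (o + q)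
    lem′ = solve-∀

  fire-deterministic : ∀ w {m n n′} → Fire w m n → Fire w m n′ → n ≡ n′
  fire-deterministic []      refl         refl           = refl
  fire-deterministic (a ∷ w) (r , refl , f) (r′ , e , f′) with +-cancelˡ-≡ (pr a) r r′ e
  ... | refl = fire-deterministic w f f′

  fire-mono : ∀ w {m n} k → Fire w m n → Fire w (k + m) (k + n)
  fire-mono []      k refl           = refl
  fire-mono (a ∷ w) {n = n} k (r , refl , f) = k + r , lem k (pr a) r , subst (λ z → Fire w z (k + n))
      (lem k (po a) r) (fire-mono w k f)
    where
    lem : ∀ k p r → k + (p + r) ≡ p + (k + r)
    lem = solve-∀

module _ {Λ : Set} {d : ℕ} where

  Step : (pr po : Λ → ℕ) → Λ → Maybe ℕ → Maybe ℕ → Set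
  Step pr po a nothing  nothing  = ⊤
  Step pr po a (just m) (just n) = ∃ λ r → m ≡ pr a + r × po a + r ≡ n
  Step pr po a _        _        = ⊥

  Matches : Maybe ℕ → ℕ → Set
  Matches nothing  x = ⊤
  Matches (just c) x = x ≡ c

  module Typing (pr po : Λ → ℕ) (i : Fin d) where

    -- A static evaluation of coordinate i. A `just` value is known exactly and guarantees that no
    -- word is blocked there; `nothing` means unknown throughout. A star must return to the value
    -- with which it is entered, and this value must be its annotation.
    TyS : Maybe ℕ → Seq Λ d → Maybe ℕ → Set
    TyA : Maybe ℕ → List (Seq Λ d) → Set
    TyS m ε          n = m ≡ n
    TyS m (lt a s)   n = ∃ λ m′ → Step pr po a m m′ × TyS m′ s n
    TyS m (st v E s) n = v i ≡ m × TyA m E × TyS m s n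
    TyA m []      = ⊤
    TyA m (e ∷ E) = TyS m e m × TyA m E

    TyA-lookup : ∀ {m E e} → TyA m E → e ∈ E → TyS m e m
    TyA-lookup (t , _) (here refl) = t
    TyA-lookup (_ , t) (there e∈)  = TyA-lookup t e∈

    TyA-tabulate : ∀ {m} E → (∀ {e} → e ∈ E → TyS m e m) → TyA m E
    TyA-tabulate []      f = tt
    TyA-tabulate (e ∷ E) f = f (here refl) , TyA-tabulate E (f ∘ there)

    TyS-◇ : ∀ {m k n} s {t} → TyS m s k → TyS k t n → TyS m (s ◇ t) n
    TyS-◇ ε          refl           q = q
    TyS-◇ (lt a s)   (m′ , y , p)   q = m′ , y , TyS-◇ s p q
    TyS-◇ (st v E s) (e , tE , p)   q = e , tE , TyS-◇ s p q

    typed-fires : ∀ {x n s w} → TyS (just x) s n → w ∈L s → ∃ λ y → n ≡ just y × Fire pr po w x y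
    typed-fires refl empty = _ , refl , refl
    typed-fires (just y , (r , e , refl) , t) (cons x) with typed-fires t x
    ... | z , eq , f = z , eq , r , e , f
    typed-fires (e , tE , t) (stop x) = typed-fires t x
    typed-fires (e , tE , t) (loop {w₁ = w₁} e∈ x y refl) with typed-fires (TyA-lookup tE e∈) x
    ... | _ , refl , f with typed-fires (e , tE , t) y
    ... | z , eq , g = z , eq , fire-++ pr po w₁ f g

    nothing-stays : ∀ {n} s → TyS nothing s n → n ≡ nothing
    nothing-stays ε          refl              = refl
    nothing-stays (lt a s)   (nothing , _ , t) = nothing-stays s t
    nothing-stays (st v E s) (_ , _ , t)       = nothing-stays s t

    typed-matches : ∀ {m n s w x y} → TyS m s n → Matches m x → w ∈L s → Fire pr po w x y → Matches n y
    typed-matches {nothing} {s = s} t _ x f rewrite nothing-stays s t = tt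
    typed-matches {just _}  {w = w} t refl x f with typed-fires t x
    ... | z , refl , g = fire-deterministic pr po w f g

    Step-mask : ∀ a m n → Step pr po a m n → is-just n ≡ is-just m
    Step-mask a nothing  nothing  _ = refl
    Step-mask a (just _) (just _) _ = refl

    clean-typedS : ∀ {m n} s h → TyS m s n → TyS m (cleanS s h) n
    clean-typedA : ∀ {m} E h → TyA m E → TyA m (cleanA E h)
    clean-typedS ε          h        t             = t
    clean-typedS (lt a s)   h        (m′ , p , t)  = m′ , p , clean-typedS s h t
    clean-typedS (st v E s) (h , h′) (e , tE , t)  = e , clean-typedA E h tE , clean-typedS s h′ t
    clean-typedA []      h               t        = tt
    clean-typedA (e ∷ E) (zero  , _ , h) (_ , t)  = clean-typedA E h t
    clean-typedA (e ∷ E) (suc _ , g , h) (t , t′) = clean-typedS e g t , clean-typedA E h t′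

    module _ (K : ℕ) where
      open Unroll K

      unroll-typedS : ∀ {m n} s h → TyS m s n → ∀ {s′} → s′ ∈ unrollS s h → TyS m s′ n
      unroll-typedA : ∀ {m} E h → TyA m E → TyA m (unrollA E h)
      iterations-typed : ∀ {m} v E h → v i ≡ m → TyA m E → ∀ k {p} → p ∈ iterations v (cleanA E h)
          (unrollA E h) k → TyS m p m
      unroll-typedS ε          h t (here refl) = t
      unroll-typedS (lt a s)   h (m′ , p , t) s∈ with ∈-map⁻ (lt a) s∈
      ... | s′ , s′∈ , refl = m′ , p , unroll-typedS s h t s′∈
      unroll-typedS (st v E s) (h , h′) (e , tE , t) s∈
        with ∈-cartesianProductWith⁻ _◇_ (iterations v (cleanA E h) (unrollA E h) K) (unrollS s h′) s∈
      ... | p , q , p∈ , q∈ , refl = TyS-◇ p (iterations-typed v E h e tE K p∈) (unroll-typedS s h′ t q∈)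
      unroll-typedA []      h             t        = tt
      unroll-typedA {m} (e ∷ E) (_ , h , h′) (t , t′) = TyA-tabulate (unrollS e h ++ unrollA E h′) λ e′∈ →
        case ∈-++⁻ (unrollS e h) e′∈ of λ
          { (inj₁ q) → unroll-typedS e h t q ; (inj₂ q) → TyA-lookup (unroll-typedA E h′ t′) q }
      iterations-typed {m} v E h e tE k = iterations-elim (λ p → TyS m p m) (e , tC , refl)
        (λ e′ e′∈ tr → e , tC , TyS-◇ e′ (TyA-lookup (unroll-typedA E h tE) e′∈) tr) k
        where tC = clean-typedA E h tE

module _ (K : ℕ) where
  open Unroll K

  private
    Bound : ℕ → Seq Λ d → Set
    Bound k = Stars λ _ E → sizeA E ≤ k

    weaken : ∀ {k l} → k ≤ l → (s : Seq Λ d) → Bound k s → Bound l s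
    weaken k≤l = Stars-map λ p → ≤-trans p k≤l

  iterations-bound : ∀ k v (C D : List (Seq Λ d)) → sizeA C ≤ k → (∀ {e} → e ∈ D → Bound k e) →
                     ∀ l {p} → p ∈ iterations v C D l → Bound k p
  iterations-bound k v C D c f = iterations-elim (Bound k) (c , tt) (λ e e∈ b → c , Stars-◇ e (f e∈) b)

  -- Unrolling brings stars nested in an alternative to the surface. Their sizes remain below
  -- `sizeA E` because `sizeA` charges one for the alternative that surrounded them.
  unroll-boundS : ∀ (s : Seq Λ d) h {s′} → s′ ∈ unrollS s h → Bound (sizeS s) s′
  unroll-boundA : ∀ (E : List (Seq Λ d)) h {e′} → e′ ∈ unrollA E h → ∃ λ k → k < sizeA E × Bound k e′
  unroll-boundS ε          h (here refl) = tt
  unroll-boundS (lt a s)   h s∈ with ∈-map⁻ (lt a) s∈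
  ... | s′ , s′∈ , refl = unroll-boundS s h s′∈
  unroll-boundS (st v E s) (h , h′) s∈
    with ∈-cartesianProductWith⁻ _◇_ (iterations v (cleanA E h) (unrollA E h) K) (unrollS s h′) s∈
  ... | p , q , p∈ , q∈ , refl = Stars-◇ p
    (iterations-bound _ v _ _ (≤-trans (sizeA-clean E h) (m≤m+n _ _))
      (λ {e} e∈ → let k , k< , b = unroll-boundA E h e∈ in weaken (≤-trans (<⇒≤ k<) (m≤m+n _ _)) e b) K p∈)
    (weaken (m≤n+m _ _) q (unroll-boundS s h′ q∈))
  unroll-boundA (e ∷ E) (_ , h , h′) e∈ with ∈-++⁻ (unrollS e h) e∈
  ... | inj₁ q = sizeS e , s≤s (m≤m+n _ _) , unroll-boundS e h q
  ... | inj₂ q with unroll-boundA E h′ q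
  ... | k , k< , b = k , m≤n⇒m≤1+n (m≤n⇒m≤o+n (sizeS e) k<) , b

  iterations-shrink : ∀ v (E : List (Seq Λ d)) h → sizeA (cleanA E h) < sizeA E → ∀ l {p} →
                      p ∈ iterations v (cleanA E h) (unrollA E h) l → Stars (λ _ E′ → sizeA E′ < sizeA E) p
  iterations-shrink v (e ∷ E) h c l {p} p∈ = Stars-map s≤s p
    (iterations-bound _ v _ _ (≤-pred c) (λ {e′} e′∈ → let k , k< , b = unroll-boundA (e ∷ E) h e′∈ in weaken (≤-pred k<) e′ b) l p∈)

-- Runs of an expression between markings

module Machine {Λ : Set} {d : ℕ} (pre post : Λ → Fin d → ℕ) where

  FireAt : Fin d → List Λ → ℕ → ℕ → Set
  FireAt i = Fire (λ a → pre a i) (λ a → post a i)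

  FireM : List Λ → Vec ℕ d → Vec ℕ d → Set
  FireM w M N = ∀ i → FireAt i w (lookup M i) (lookup N i)

  module Ty (i : Fin d) = Typing (λ a → pre a i) (λ a → post a i) i

  Typed : (v : Fin d → Maybe ℕ) → Seq Λ d → (v′ : Fin d → Maybe ℕ) → Set
  Typed v s v′ = ∀ i → Ty.TyS i (v i) s (v′ i)

  Frozen : (Fin d → Maybe ℕ) → List (Seq Λ d) → Set
  Frozen v E = ∀ i → Ty.TyA i (v i) E

  Good : Seq Λ d → Set
  Good = Stars Frozen

  MatchesM : (Fin d → Maybe ℕ) → Vec ℕ d → Set
  MatchesM v M = ∀ i → Matches {Λ} {d} (v i) (lookup M i)

  -- The markings between items are part of a run because a star checks its annotation against the
  -- marking on entry. Annotations nested inside the star are not checked here; typing ties them to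
  -- the outer one.
  Run : Seq Λ d → Vec ℕ d → Vec ℕ d → Set
  Run ε          M N = M ≡ N
  Run (lt a s)   M N = ∃ λ M′ → FireM (a ∷ []) M M′ × Run s M′ N
  Run (st v E s) M N = MatchesM v M × ∃ λ w → ∃ λ M′ → w ∈L st v E ε × FireM w M M′ × Run s M′ N

  fireM-++ : ∀ w {w′} M N P → FireM w M N → FireM w′ N P → FireM (w ++ w′) M P
  fireM-++ w M N P f g i = fire-++ _ _ w (f i) (g i)

  fireM-split : ∀ w {w′} M N → FireM (w ++ w′) M N → ∃ λ P → FireM w M P × FireM w′ P N
  fireM-split w {w′} M N f = tabulate (λ i → proj₁ (fs i))
    , (λ i → subst (FireAt i w (lookup M i)) (sym (lookup∘tabulate _ i)) (proj₁ (proj₂ (fs i))))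
    , (λ i → subst (λ z → FireAt i w′ z (lookup N i)) (sym (lookup∘tabulate _ i)) (proj₂ (proj₂ (fs i))))
    where
    fs : ∀ i → _
    fs i = fire-split (λ a → pre a i) (λ a → post a i) w (f i)

  run→word : ∀ s {M N} → Run s M N → ∃ λ w → w ∈L s × FireM w M N
  run→word ε refl = [] , empty , λ i → refl
  run→word (lt a s) {M} {N} (M′ , f , r) with run→word s r
  ... | w , x , g = a ∷ w , cons x , fireM-++ (a ∷ []) M M′ N f g
  run→word (st v E s) {M} {N} (_ , w , M′ , x , f , r) with run→word s r
  ... | w′ , y , g = w ++ w′ , star-++ x (stop y) , fireM-++ w M M′ N f g

  word→run : ∀ s {w v v′} M N → Typed v s v′ → MatchesM v M → w ∈L s → FireM w M N → Run s M N
  word→run ε M N t m empty f = lookup-ext {M = M} {N} f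
  word→run (lt a s) M N t m (cons {w = w} x) f with fireM-split (a ∷ []) {w} M N f
  ... | P , g , h = P , g , word→run s P N (λ i → proj₂ (proj₂ (t i)))
        (λ i → Ty.typed-matches i {s = lt a ε} (_ , proj₁ (proj₂ (t i)) , refl) (m i) (cons empty) (g i)) x h
  word→run (st u E s) {v = v} M N t m x f with ◇-elim (st u E ε) x
  ... | w₁ , w₂ , refl , y , z with fireM-split w₁ {w₂} M N f
  ... | P , g , h = (λ i → subst (λ c → Matches {Λ} {d} c (lookup M i)) (sym (proj₁ (t i))) (m i)) , w₁ ,
      P , y , g
      , word→run s P N (λ i → proj₂ (proj₂ (t i)))
          (λ i → Ty.typed-matches i {s = st u E ε} (proj₁ (t i) , proj₁ (proj₂ (t i)) , refl) (m i) y
              (g i)) z h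

  run-◇ : ∀ s {t M N P} → Run s M N → Run t N P → Run (s ◇ t) M P
  run-◇ ε          refl                        q = q
  run-◇ (lt a s)   (M′ , f , r)                q = M′ , f , run-◇ s r q
  run-◇ (st v E s) (m , w , M′ , x , f , r)    q = m , w , M′ , x , f , run-◇ s r q

  run-◇⁻ : ∀ s {t M P} → Run (s ◇ t) M P → ∃ λ N → Run s M N × Run t N P
  run-◇⁻ ε          q = _ , refl , q
  run-◇⁻ (lt a s)   (M′ , f , r) with run-◇⁻ s r
  ... | N , r₁ , r₂ = N , (M′ , f , r₁) , r₂
  run-◇⁻ (st v E s) (m , w , M′ , x , f , r) with run-◇⁻ s r
  ... | N , r₁ , r₂ = N , (m , w , M′ , x , f , r₁) , r₂

  typed→good : ∀ s {v v′} → Typed v s v′ → Good s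
  typed→good ε          t = tt
  typed→good (lt a s)   t = typed→good s (λ i → proj₂ (proj₂ (t i)))
  typed→good (st u E s) {v} t = (λ i → subst (λ m → Ty.TyA i m E) (sym (proj₁ (t i))) (proj₁ (proj₂ (t i))))
                            , typed→good s (λ i → proj₂ (proj₂ (t i)))

  typed→mask : ∀ s {v v′} → Typed v s v′ → Stars (λ u _ → SameMask u v) s
  typed→mask ε          t = tt
  typed→mask (lt a s) {v} t = Stars-map (λ m i → trans (m i)
      (Ty.Step-mask i a (v i) (proj₁ (t i)) (proj₁ (proj₂ (t i))))) s
                            (typed→mask s (λ i → proj₂ (proj₂ (t i))))
  typed→mask (st u E s) t = (λ i → cong is-just (proj₁ (t i))) , typed→mask s (λ i → proj₂ (proj₂ (t i)))

-- Bounded coordinates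

-- Kleene's construction: the words of a sequence that drive a finite automaton with
-- states Z from x to y. The star of the loops at state z gets the annotation ann v z.
module Restrict {Λ : Set} {d : ℕ} {X : Set} (_≟X_ : DecidableEquality X) (step : Λ → X → Maybe X)
                (Z : List X) (ann : (Fin d → Maybe ℕ) → X → (Fin d → Maybe ℕ)) where

  RunX : List Λ → X → X → Set
  RunX []      x y = x ≡ y
  RunX (a ∷ w) x y = ∃ λ x′ → step a x ≡ just x′ × RunX w x′ y

  runX-++ : ∀ w {w′ x y z} → RunX w x y → RunX w′ y z → RunX (w ++ w′) x z
  runX-++ []      refl         q = q
  runX-++ (a ∷ w) (x′ , e , p) q = x′ , e , runX-++ w p q

  Inside : List Λ → X → X → Set
  Inside []      x y = x ∈ Z × x ≡ y
  Inside (a ∷ w) x y = x ∈ Z × ∃ λ x′ → step a x ≡ just x′ × Inside w x′ y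

  inside-start : ∀ w {x y} → Inside w x y → x ∈ Z
  inside-start []      p = proj₁ p
  inside-start (a ∷ w) p = proj₁ p

  inside-split : ∀ w {w′ x y} → Inside (w ++ w′) x y → ∃ λ z → Inside w x z × Inside w′ z y
  inside-split []      {w′} p = _ , (inside-start w′ p , refl) , p
  inside-split (a ∷ w) (x∈ , x′ , e , p) with inside-split w p
  ... | z , q , r = z , (x∈ , x′ , e , q) , r

  -- `D x y` describes one iteration from x to y, and the list contains the states permitted between
  -- iterations. At least one iteration is made; `trivialLoop` accounts for none.
  kleene : (Fin d → Maybe ℕ) → (X → X → List (Seq Λ d)) → List X → X → X → List (Seq Λ d)
  kleene v D []       x y = D x y
  kleene v D (z ∷ Zs) x y = kleene v D Zs x y ++
    cartesianProductWith (λ p q → p ◇ st (ann v z) (kleene v D Zs z z) q) (kleene v D Zs x z)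
        (kleene v D Zs z y)

  trivialLoop : X → X → List (Seq Λ d)
  trivialLoop x y with x ≟X y
  ... | yes _ = ε ∷ []
  ... | no  _ = []

  after : Maybe X → (X → List (Seq Λ d)) → List (Seq Λ d)
  after nothing  f = []
  after (just x) f = f x

  restrictS : Seq Λ d → X → X → List (Seq Λ d)
  restrictA : List (Seq Λ d) → X → X → List (Seq Λ d)
  restrictS ε          x y = trivialLoop x y
  restrictS (lt a s)   x y = after (step a x) λ x′ → map (lt a) (restrictS s x′ y)
  restrictS (st v E s) x y = concatMap (λ z → cartesianProductWith _◇_
    (trivialLoop x z ++ kleene v (restrictA E) Z x z) (restrictS s z y)) Z
  restrictA []      x y = []
  restrictA (e ∷ E) x y = restrictS e x y ++ restrictA E x y

  -- An induction principle for the construction: soundness and the two typing properties of the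
  -- result are all proved by checking these clauses.
  record Closed (P : Seq Λ d → X → X → Seq Λ d → Set) : Set where
    field
      P-ε    : ∀ {x} → P ε x x ε
      P-lt   : ∀ {a s x x′ y s′} → step a x ≡ just x′ → P s x′ y s′ → P (lt a s) x y (lt a s′)
      P-◇    : ∀ {v E s x z y p q} → P (st v E ε) x z p → P s z y q → P (st v E s) x y (p ◇ q)
      P-stop : ∀ {v E x} → P (st v E ε) x x ε
      P-one  : ∀ {v E e x y p} → e ∈ E → P e x y p → P (st v E ε) x y p
      P-loop : ∀ {v E x z y L p q} → P (st v E ε) x z p → (∀ {l} → l ∈ L → P (st v E ε) z z l) → P
          (st v E ε) z y q →
               P (st v E ε) x y (p ◇ st (ann v z) L q)

  module Elim {P : Seq Λ d → X → X → Seq Λ d → Set} (closed : Closed P) where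
    open Closed closed

    elim-kleene : ∀ v E D → (∀ {x y p} → p ∈ D x y → P (st v E ε) x y p) → ∀ Zs {x y p} → p ∈ kleene v D
        Zs x y → P (st v E ε) x y p
    elim-kleene v E D f []       p∈ = f p∈
    elim-kleene v E D f (z ∷ Zs) {x} {y} p∈ with ∈-++⁻ (kleene v D Zs x y) p∈
    ... | inj₁ p∈′ = elim-kleene v E D f Zs p∈′
    ... | inj₂ p∈′ with ∈-cartesianProductWith⁻ (λ p q → p ◇ st (ann v z) (kleene v D Zs z z) q)
        (kleene v D Zs x z) (kleene v D Zs z y) p∈′
    ... | p , q , p∈″ , q∈ , refl = P-loop (elim-kleene v E D f Zs p∈″) (elim-kleene v E D f Zs)
        (elim-kleene v E D f Zs q∈)

    elimS : ∀ s {x y s′} → s′ ∈ restrictS s x y → P s x y s′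
    elimA : ∀ v E {x y s′} → s′ ∈ restrictA E x y → P (st v E ε) x y s′
    elimA′ : ∀ E {x y s′} → s′ ∈ restrictA E x y → ∃ λ e → e ∈ E × P e x y s′
    elim-star : ∀ v E {x y p} → p ∈ trivialLoop x y ++ kleene v (restrictA E) Z x y → P (st v E ε) x y p
    elimS ε {x} {y} s∈ with x ≟X y
    elimS ε (here refl) | yes refl = P-ε
    elimS (lt a s) {x} s∈ with step a x in eq
    ... | just x′ with ∈-map⁻ (lt a) s∈
    ... | s′ , s′∈ , refl = P-lt eq (elimS s s′∈)
    elimS (st v E s) {x} {y} s∈ with find (∈-concatMap⁻
        (λ z → cartesianProductWith _◇_ (trivialLoop x z ++ kleene v (restrictA E) Z x z)
        (restrictS s z y)) {xs = Z} s∈)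
    ... | z , z∈ , s∈′ with ∈-cartesianProductWith⁻ _◇_ (trivialLoop x z ++ kleene v (restrictA E) Z x z)
        (restrictS s z y) s∈′
    ... | p , q , p∈ , q∈ , refl = P-◇ (elim-star v E p∈) (elimS s q∈)
    elim-star v E {x} {y} p∈ with ∈-++⁻ (trivialLoop x y) p∈
    elim-star v E {x} {y} p∈ | inj₁ q with x ≟X y
    elim-star v E p∈ | inj₁ (here refl) | yes refl = P-stop
    elim-star v E p∈ | inj₂ q = elim-kleene v E (restrictA E) (elimA v E) Z q
    elimA v E s∈ with elimA′ E s∈
    ... | e , e∈ , p = P-one e∈ p
    elimA′ (e ∷ E) {x} {y} s∈ with ∈-++⁻ (restrictS e x y) s∈
    ... | inj₁ q = e , here refl , elimS e q
    ... | inj₂ q with elimA′ E q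
    ... | e′ , e∈ , p = e′ , there e∈ , p

  Sound : Seq Λ d → X → X → Seq Λ d → Set
  Sound s x y s′ = ∀ {w} → w ∈L s′ → w ∈L s × RunX w x y

  sound-loop : ∀ {v E x z y L p q} → Sound (st v E ε) x z p → (∀ {l} → l ∈ L → Sound (st v E ε) z z l) →
      Sound (st v E ε) z y q →
               Sound (st v E ε) x y (p ◇ st (ann v z) L q)
  sound-loop {v} {E} {x} {z} {y} {L} {p} {q} f g h m with ◇-elim p m
  ... | w₁ , w₂ , refl , a , b with f a | go b
    where
    go : ∀ {w} → w ∈L st (ann v z) L q → w ∈L st v E ε × RunX w z y
    go (stop c) = h c
    go (loop {w₁ = u} l∈ c c′ refl) with g l∈ c | go c′
    ... | i , r | i′ , r′ = star-++ {v = v} i i′ , runX-++ u r r′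
  ... | i , r | i′ , r′ = star-++ {v = v} i i′ , runX-++ w₁ r r′

  sound-◇ : ∀ {v E s x z y p q} → Sound (st v E ε) x z p → Sound s z y q → Sound (st v E s) x y (p ◇ q)
  sound-◇ {p = p} f g m with ◇-elim p m
  ... | w₁ , w₂ , refl , a , b with f a | g b
  ... | i , r | i′ , r′ = star-++ i (stop i′) , runX-++ w₁ r r′

  sound-closed : Closed Sound
  sound-closed = record
    { P-ε    = λ { empty → empty , refl }
    ; P-lt   = λ { e f (cons m) → let i , r = f m in cons i , _ , e , r }
    ; P-◇    = λ {v} {E} {s} {x} {z} {y} {p} {q} → sound-◇ {v} {E} {s} {x} {z} {y} {p} {q}
    ; P-stop = λ { empty → stop empty , refl }
    ; P-one  = λ e∈ f m → let i , r = f m in loop e∈ i (stop empty) (sym (++-identityʳ _)) , r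
    ; P-loop = λ {v} {E} {x} {z} {y} {L} {p} {q} → sound-loop {v} {E} {x} {z} {y} {L} {p} {q} }

  restrict-sound : ∀ s {x y s′} → s′ ∈ restrictS s x y → Sound s x y s′
  restrict-sound = Elim.elimS sound-closed

  module _ (v : Fin d → Maybe ℕ) (D : X → X → List (Seq Λ d)) where

    data Chain (Zs : List X) : X → X → List Λ → Set where
      one  : ∀ {x y c w} → c ∈ D x y → w ∈L c → Chain Zs x y w
      more : ∀ {x z y c w₁ w₂} → c ∈ D x z → w₁ ∈L c → z ∈ Zs → Chain Zs z y w₂ → Chain Zs x y (w₁ ++ w₂)

    Through : X → List X → X → X → List Λ → Set
    Through z Zs x y w = ∃ λ w₁ → ∃ λ w₂ → ∃ λ w₃ → w ≡ w₁ ++ (w₂ ++ w₃) ×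
      Chain Zs x z w₁ × w₂ ∈L st (ann v z) (kleene v D Zs z z) ε × Chain Zs z y w₃

    chain-complete : ∀ Zs {x y w} → Chain Zs x y w → ∃ λ p → p ∈ kleene v D Zs x y × w ∈L p
    -- The chain is cut at the first and the last occurrence of z between iterations. What lies
    -- between them is a sequence of loops at z, each of which passes only through `Zs` and is
    -- therefore covered by `chain-complete` for the shorter list.
    visit : ∀ z Zs {x y w} → Chain (z ∷ Zs) x y w → Chain Zs x y w ⊎ Through z Zs x y w
    chain-complete []       (one c∈ m) = _ , c∈ , m
    chain-complete (z ∷ Zs) {x} {y} c with visit z Zs c
    ... | inj₁ c′ with chain-complete Zs c′
    ... | p , p∈ , m = p , ∈-++⁺ˡ p∈ , m
    chain-complete (z ∷ Zs) {x} {y} c | inj₂ (w₁ , w₂ , w₃ , refl , c₁ , l , c₃) with chain-complete Zs c₁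
        | chain-complete Zs c₃
    ... | p , p∈ , m | q , q∈ , m′ = _ , ∈-++⁺ʳ (kleene v D Zs x y)
      (∈-cartesianProductWith⁺ (λ p q → p ◇ st (ann v z) (kleene v D Zs z z) q) p∈ q∈) , ◇-intro m
          (star-++ l (stop m′))
    visit z Zs (one c∈ m) = inj₁ (one c∈ m)
    visit z Zs (more {w₁ = u} c∈ m (here refl) c) with visit z Zs c
    ... | inj₁ c′ = inj₂ (_ , [] , _ , refl , one c∈ m , stop empty , c′)
    ... | inj₂ (w₁ , w₂ , w₃ , refl , c₁ , l , c₃) with chain-complete Zs c₁
    ... | p , p∈ , m′ = inj₂ (_ , w₁ ++ w₂ , w₃ , cong (u ++_) (sym (++-assoc w₁ w₂ w₃)) , one c∈ m , loop
        p∈ m′ l refl , c₃)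
    visit z Zs (more {w₁ = u} c∈ m (there t∈) c) with visit z Zs c
    ... | inj₁ c′ = inj₁ (more c∈ m t∈ c′)
    ... | inj₂ (w₁ , w₂ , w₃ , refl , c₁ , l , c₃) =
      inj₂ (u ++ w₁ , w₂ , w₃ , sym (++-assoc u w₁ (w₂ ++ w₃)) , more c∈ m t∈ c₁ , l , c₃)

  trivial∈ : ∀ x → ε ∈ trivialLoop x x
  trivial∈ x with x ≟X x
  ... | yes _ = here refl
  ... | no ¬p = ⊥-elim (¬p refl)

  restrictA∈ : ∀ {E e x y p} → e ∈ E → p ∈ restrictS e x y → p ∈ restrictA E x y
  restrictA∈ (here refl) p∈ = ∈-++⁺ˡ p∈
  restrictA∈ {e ∷ E} {x = x} {y} (there e∈) p∈ = ∈-++⁺ʳ (restrictS e x y) (restrictA∈ e∈ p∈)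

  restrict-complete : ∀ {s w x y} → w ∈L s → Inside w x y → ∃ λ s′ → s′ ∈ restrictS s x y × w ∈L s′
  restrict-chain : ∀ {v E s w x y} → w ∈L st v E s → Inside w x y → ∃ λ z → ∃ λ w₁ → ∃ λ w₂ → w ≡ w₁ ++ w₂
      × z ∈ Z ×
    ((w₁ ≡ [] × x ≡ z) ⊎ Chain v (restrictA E) Z x z w₁) × (∃ λ q → q ∈ restrictS s z y × w₂ ∈L q)
  restrict-star : ∀ {v E s w x y} → w ∈L st v E s → Inside w x y → ∃ λ s′ → s′ ∈ restrictS (st v E s) x y
      × w ∈L s′
  restrict-complete {x = x} empty (_ , refl) = ε , trivial∈ x , empty
  restrict-complete {lt a s} {x = x} {y} (cons m) (_ , x′ , e , i) with restrict-complete m i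
  ... | s′ , s′∈ , m′ = lt a s′ , subst (λ m → lt a s′ ∈ after m λ x′ → map (lt a) (restrictS s x′ y))
      (sym e) (∈-map⁺ (lt a) s′∈) , cons m′
  restrict-complete m@(stop _)       i = restrict-star m i
  restrict-complete m@(loop _ _ _ _) i = restrict-star m i
  restrict-star {v} {E} {s} {x = x} {y} m i with restrict-chain m i
  ... | z , w₁ , w₂ , refl , z∈ , c , (q , q∈ , m₂) = p ◇ q
    , ∈-concatMap⁺ _ (lose z∈ (∈-cartesianProductWith⁺ _◇_ p∈ q∈)) , ◇-intro m₁ m₂
    where
    first : ((w₁ ≡ [] × x ≡ z) ⊎ Chain v (restrictA E) Z x z w₁) → ∃ λ p → p ∈ trivialLoop x z ++ kleene v
        (restrictA E) Z x z × w₁ ∈L p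
    first (inj₁ (refl , refl)) = ε , ∈-++⁺ˡ (trivial∈ x) , empty
    first (inj₂ c) with chain-complete v (restrictA E) Z c
    ... | p , p∈ , m = p , ∈-++⁺ʳ (trivialLoop x z) p∈ , m
    p = proj₁ (first c)
    p∈ = proj₁ (proj₂ (first c))
    m₁ = proj₂ (proj₂ (first c))
  restrict-chain {w = w} {x = x} (stop m) i with restrict-complete m i
  ... | q , q∈ , m′ = x , [] , w , refl , inside-start w i , inj₁ (refl , refl) , (q , q∈ , m′)
  restrict-chain {v} {E} {s} (loop {w₁ = u} {u′} e∈ m m′ refl) i with inside-split u {u′} i
  ... | t , i₁ , i₂ with restrict-complete m i₁ | restrict-chain m′ i₂
  ... | p , p∈ , n | z , w₁ , w₂ , refl , z∈ , inj₁ (refl , refl) , q = z , u , w₂ , refl , z∈ , inj₂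
      (one (restrictA∈ e∈ p∈) n) , q
  ... | p , p∈ , n | z , w₁ , w₂ , refl , z∈ , inj₂ c , q = z , u ++ w₁ , w₂ , sym (++-assoc u w₁ w₂) , z∈
                   , inj₂ (more (restrictA∈ e∈ p∈) n (inside-start (w₁ ++ w₂) i₂) c) , q

-- Short covering runs

maxOver : ∀ {A : Set} → (A → ℕ) → List A → ℕ
maxOver f []       = 0
maxOver f (x ∷ xs) = f x ⊔ maxOver f xs

≤-maxOver : ∀ {A : Set} (f : A → ℕ) {x xs} → x ∈ xs → f x ≤ maxOver f xs
≤-maxOver f (here refl) = m≤m⊔n _ _
≤-maxOver f {xs = y ∷ xs} (there x∈) = ≤-trans (≤-maxOver f x∈) (m≤n⊔m (f y) _)

-- Finitely many pairs describe all ways of cutting words of s in two, in the manner of partial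
-- derivatives. The second components are the expressions to which the recursion in `shorten` is
-- applied, so a bound over all of them does not depend on the run.
splits  : Seq Λ d → List (Seq Λ d × Seq Λ d)
splitsA : List (Seq Λ d) → List (Seq Λ d × Seq Λ d)
splits ε          = (ε , ε) ∷ []
splits (lt a s)   = (ε , lt a s) ∷ map (λ (p , q) → lt a p , q) (splits s)
splits (st v E s) = map (λ (p , q) → st v E p , q) (splits s) ++ map (λ (p , q) → st v E p , q ◇ st v E s)
    (splitsA E)
splitsA []      = []
splitsA (e ∷ E) = splits e ++ splitsA E

split-sound  : ∀ (s : Seq Λ d) {p q w₁ w₂} → (p , q) ∈ splits s → w₁ ∈L p → w₂ ∈L q → w₁ ++ w₂ ∈L s
split-soundA : ∀ (E : List (Seq Λ d)) {p q w₁ w₂} → (p , q) ∈ splitsA E → w₁ ∈L p → w₂ ∈L q → ∃ λ e → e ∈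
    E × w₁ ++ w₂ ∈L e
split-sound ε        (here refl) empty m = m
split-sound (lt a s) (here refl) empty m = m
split-sound (lt a s) (there pq∈) m₁ m₂ with ∈-map⁻ _ pq∈
split-sound (lt a s) (there pq∈) (cons m₁) m₂ | _ , pq∈′ , refl = cons (split-sound s pq∈′ m₁ m₂)
split-sound (st v E s) pq∈ m₁ m₂ with ∈-++⁻ (map _ (splits s)) pq∈
split-sound (st v E s) {w₂ = w₂} pq∈ m₁ m₂ | inj₁ q with ∈-map⁻ _ q
... | (p , _) , pq∈′ , refl with ◇-elim (st v E ε) m₁
... | u , u′ , refl , a , b = subst (_∈L st v E s) (sym (++-assoc u u′ w₂))
    (star-++ a (stop (split-sound s pq∈′ b m₂)))
split-sound (st v E s) {w₂ = w₂} pq∈ m₁ m₂ | inj₂ q with ∈-map⁻ _ q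
... | (p , r) , pq∈′ , refl with ◇-elim (st v E ε) m₁ | ◇-elim r m₂
... | u , u′ , refl , a , b | y , y′ , refl , c , e with split-soundA E pq∈′ b c
... | e₁ , e₁∈ , m = subst (_∈L st v E s) (trans (cong (u ++_) (++-assoc u′ y y′))
    (sym (++-assoc u u′ (y ++ y′)))) (star-++ a (loop e₁∈ m e refl))
split-soundA (e ∷ E) pq∈ m₁ m₂ with ∈-++⁻ (splits e) pq∈
... | inj₁ q = e , here refl , split-sound e q m₁ m₂
... | inj₂ q with split-soundA E q m₁ m₂
... | e′ , e∈ , m = e′ , there e∈ , m

splitsA∈ : ∀ {E : List (Seq Λ d)} {e x} → e ∈ E → x ∈ splits e → x ∈ splitsA E
splitsA∈ (here refl) x∈ = ∈-++⁺ˡ x∈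
splitsA∈ {E = e ∷ E} (there e∈) x∈ = ∈-++⁺ʳ (splits e) (splitsA∈ e∈ x∈)

++-overlap : ∀ (u : List Λ) {u′} w₁ {w₂} → u ++ u′ ≡ w₁ ++ w₂ →
             (∃ λ z → u ≡ w₁ ++ z × w₂ ≡ z ++ u′) ⊎ (∃ λ z → w₁ ≡ u ++ z × u′ ≡ z ++ w₂)
++-overlap []      w₁       e = inj₂ (w₁ , refl , e)
++-overlap (a ∷ u) []       e = inj₁ (a ∷ u , refl , sym e)
++-overlap (a ∷ u) (b ∷ w₁) e with ∷-injective e
... | refl , e′ with ++-overlap u w₁ e′
... | inj₁ (z , p , q) = inj₁ (z , cong (a ∷_) p , q)
... | inj₂ (z , p , q) = inj₂ (z , cong (a ∷_) p , q)

split-complete : ∀ {s : Seq Λ d} {w} w₁ w₂ → w ∈L s → w ≡ w₁ ++ w₂ →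
                 ∃ λ p → ∃ λ q → (p , q) ∈ splits s × w₁ ∈L p × w₂ ∈L q
-- The statement records that the prefix expression begins with the star itself: if the cut lies
-- beyond the first iteration, that iteration has to be prepended.
split-star : ∀ {v E} {s : Seq Λ d} {w} w₁ w₂ → w ∈L st v E s → w ≡ w₁ ++ w₂ →
             ∃ λ p → ∃ λ q → (st v E p , q) ∈ splits (st v E s) × w₁ ∈L st v E p × w₂ ∈L q
split-complete []       _  empty    refl = ε , ε , here refl , empty , empty
split-complete []       _  (cons m) refl = ε , _ , here refl , empty , cons m
split-complete (a ∷ w₁) w₂ (cons m) refl with split-complete w₁ w₂ m refl
... | p , q , pq∈ , m₁ , m₂ = lt a p , q , there (∈-map⁺ _ pq∈) , cons m₁ , m₂
split-complete w₁ w₂ m@(stop _)       e with split-star w₁ w₂ m e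
... | p , r = _ , r
split-complete w₁ w₂ m@(loop _ _ _ _) e with split-star w₁ w₂ m e
... | p , r = _ , r
split-star w₁ w₂ (stop m) e with split-complete w₁ w₂ m e
... | p , q , pq∈ , m₁ , m₂ = p , q , ∈-++⁺ˡ (∈-map⁺ _ pq∈) , stop m₁ , m₂
split-star {s = s} w₁ w₂ (loop {w₁ = u} e∈ m m′ refl) e with ++-overlap u w₁ e
... | inj₁ (z , refl , refl) with split-complete w₁ z m refl
... | p , q , pq∈ , m₁ , m₂ = p , _ , ∈-++⁺ʳ (map _ (splits s)) (∈-map⁺ _ (splitsA∈ e∈ pq∈)) , stop m₁ ,
    ◇-intro m₂ m′
split-star {s = s} w₁ w₂ (loop {w₁ = u} e∈ m m′ refl) e | inj₂ (z , refl , refl) with split-star z w₂ m′ refl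
... | p , q , pq∈ , m₁ , m₂ = p , q , pq∈ , loop e∈ m m₁ refl , m₂

module _ {Λ : Set} (pr po : Λ → ℕ) (B : ℕ) where

  -- Truncated subtraction defines this for every word; along a word that fires, the subtractions
  -- are exact and the values are those of the counter, start and end included.
  Peak : List Λ → ℕ → Set
  Peak []      m = B < m
  Peak (a ∷ w) m = B < m ⊎ Peak w (po a + (m ∸ pr a))

  peak? : ∀ w m → Dec (Peak w m)
  peak? []      m = B <? m
  peak? (a ∷ w) m = (B <? m) ⊎-dec peak? w _

peak-mono : ∀ (pr po : Λ → ℕ) {B B′} w {m} → B ≤ B′ → Peak pr po B′ w m → Peak pr po B w m
peak-mono pr po []      le p        = ≤-<-trans le p
peak-mono pr po (a ∷ w) le (inj₁ p) = inj₁ (≤-<-trans le p)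
peak-mono pr po (a ∷ w) le (inj₂ p) = inj₂ (peak-mono pr po w le p)

fire-long : ∀ (pr po : Λ → ℕ) → (∀ a → pr a ≤ 1) → ∀ w m t → length w + t ≤ m → ∃ λ n → Fire pr po w m n ×
    t ≤ n
fire-long pr po pr≤1 []      m t le = m , refl , le
fire-long pr po pr≤1 (a ∷ w) m t le with fire-long pr po pr≤1 w (po a + (m ∸ pr a)) t
    (≤-trans (∸-mono le (pr≤1 a)) (m≤n+m _ (po a)))
... | n , f , t≤n = n , (m ∸ pr a , sym (m+[n∸m]≡n (≤-trans (pr≤1 a) (≤-trans (s≤s z≤n) le))) , f) , t≤n

fire? : ∀ (pr po : Λ → ℕ) w m → Dec (∃ (Fire pr po w m))
fire? pr po []      m = yes (m , refl)
fire? pr po (a ∷ w) m with pr a ≤? m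
... | no ¬p = no λ { (_ , r , refl , _) → ¬p (m≤m+n _ r) }
... | yes p with fire? pr po w (po a + (m ∸ pr a))
... | yes (n , f) = yes (n , m ∸ pr a , sym (m+[n∸m]≡n p) , f)
... | no ¬f = no λ { (n , r , refl , f) → ¬f (n , subst (λ z → Fire pr po w (po a + z) n)
    (sym (m+n∸m≡n (pr a) r)) f) }

fire-reach? : ∀ (pr po : Λ → ℕ) w m t → Dec (∃ λ n → Fire pr po w m n × t ≤ n)
fire-reach? pr po w m t with fire? pr po w m
... | no ¬f = no λ (n , f , _) → ¬f (n , f)
... | yes (n , f) with t ≤? n
... | yes p = yes (n , f , p)
... | no ¬p = no λ (n′ , f′ , p) → ¬p (subst (t ≤_) (fire-deterministic pr po w f′ f) p)

module Box {Λ : Set} {n : ℕ} (pr po : Λ → Fin n → ℕ) (H : ℕ) where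

  FireV : List Λ → Vec ℕ n → Vec ℕ n → Set
  FireV w x y = ∀ k → Fire (λ a → pr a k) (λ a → po a k) w (lookup x k) (lookup y k)

  next : Λ → Vec ℕ n → Vec ℕ n
  next a x = tabulate λ k → po a k + (lookup x k ∸ pr a k)

  step : Λ → Vec ℕ n → Maybe (Vec ℕ n)
  step a x with Finₚ.all? (λ k → pr a k ≤? lookup x k)
  ... | yes _ = just (next a x)
  ... | no  _ = nothing

  step-yes : ∀ a x → (∀ k → pr a k ≤ lookup x k) → step a x ≡ just (next a x)
  step-yes a x p with Finₚ.all? (λ k → pr a k ≤? lookup x k)
  ... | yes _ = refl
  ... | no ¬p = ⊥-elim (¬p p)

  step-enabled : ∀ a x {x′} → step a x ≡ just x′ → (∀ k → pr a k ≤ lookup x k) × next a x ≡ x′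
  step-enabled a x e with Finₚ.all? (λ k → pr a k ≤? lookup x k)
  step-enabled a x refl | yes p = p , refl

  module R {d} = Restrict {Λ} {d} {Vec ℕ n} (Vecₚ.≡-dec _≟_) step (box H n) (λ v _ → v)

  runX→fire : ∀ {d} w {x y} → R.RunX {d} w x y → FireV w x y
  runX→fire []      refl k = refl
  runX→fire {d} (a ∷ w) {x} {y} (x′ , e , r) k with step-enabled a x e
  ... | p , refl = lookup x k ∸ pr a k , sym (m+[n∸m]≡n (p k))
      , subst (λ z → Fire _ _ w z (lookup y k)) (lookup∘tabulate _ k) (runX→fire {d} w r k)

  -- Every word of a restricted expression leads from its x to its y, so its skeleton can replace
  -- any run in the box with the same end points. This takes the place of deleting loops between
  -- repeated configurations.
  shortcuts : ∀ {d} → Seq Λ d → List (List Λ)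
  shortcuts s = concatMap (λ x → concatMap (λ y → map skeleton (R.restrictS s x y)) (box H n)) (box H n)

  shortcuts-sound : ∀ {d} (s : Seq Λ d) {c} → c ∈ shortcuts s → c ∈L s
  shortcuts-sound s c∈ with find (∈-concatMap⁻ (λ x → concatMap (λ y → map skeleton (R.restrictS s x y))
      (box H n)) {xs = box H n} c∈)
  ... | x , _ , c∈₁ with find (∈-concatMap⁻ (λ y → map skeleton (R.restrictS s x y)) {xs = box H n} c∈₁)
  ... | y , _ , c∈₂ with ∈-map⁻ skeleton c∈₂
  ... | s′ , s′∈ , refl = proj₁ (R.restrict-sound s s′∈ (skeleton∈ s′))

  inside-end : ∀ {d} w {x y} → R.Inside {d} w x y → y ∈ box H n
  inside-end []      (x∈ , refl)          = x∈
  inside-end {d} (a ∷ w) (_ , x′ , _ , i) = inside-end {d} w i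

  shortcut : ∀ {d} (s : Seq Λ d) {w x y} → w ∈L s → R.Inside {d} w x y → ∃ λ c → c ∈ shortcuts s × FireV c x y
  shortcut {d} s {w} {x} {y} m i with R.restrict-complete m i
  ... | s′ , s′∈ , _ = skeleton s′ , ∈-concatMap⁺ _ (lose (R.inside-start {d} w i)
        (∈-concatMap⁺ _ (lose (inside-end {d} w i) (∈-map⁺ skeleton s′∈))))
      , runX→fire {d} (skeleton s′) (proj₂ (R.restrict-sound s s′∈ (skeleton∈ s′)))

module FirstPeak {Λ : Set} {n : ℕ} (pr po : Λ → Fin n → ℕ) (po≤1 : ∀ a k → po a k ≤ 1) (H : ℕ) where
  -- A letter puts at most one token on a counter, so the first marking above `H` still lies in the
  -- box for `suc H`.
  open Box pr po (suc H)

  PeakAt : Fin n → List Λ → ℕ → Set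
  PeakAt k = Peak (λ a → pr a k) (λ a → po a k) H

  fire-next : ∀ a w {x y} → FireV (a ∷ w) x y → (∀ k → pr a k ≤ lookup x k) × FireV w (next a x) y
  fire-next a w {x} {y} f = (λ k → enabled (f k)) , λ k →
    subst (λ z → Fire _ _ w z (lookup y k)) (trans (cong (po a k +_) (remaining (f k)))
        (sym (lookup∘tabulate _ k))) (proj₂ (proj₂ (f k)))
    where
    enabled : ∀ {k m n} → Fire (λ a → pr a k) (λ a → po a k) (a ∷ w) m n → pr a k ≤ m
    enabled (r , refl , _) = m≤m+n _ r
    remaining : ∀ {k m n} (f : Fire (λ a → pr a k) (λ a → po a k) (a ∷ w) m n) → proj₁ f ≡ m ∸ pr a k
    remaining {k} (r , refl , _) = sym (m+n∸m≡n (pr a k) r)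

  -- The last component saves the peak hypotheses for the rest of the run: before the cut no counter
  -- exceeds `H`, so every peak occurs at the cut or later.
  Peaks : ℕ → List Λ → Vec ℕ n → Vec ℕ n → Set
  Peaks d w x y = ∃ λ w₁ → ∃ λ w₂ → w ≡ w₁ ++ w₂ × ∃ λ x₁ → R.Inside {d} w₁ x x₁ × FireV w₁ x x₁ ×
      (∃ λ k → H < lookup x₁ k)
    × FireV w₂ x₁ y × (∀ k → PeakAt k w (lookup x k) → PeakAt k w₂ (lookup x₁ k))

  first-peak : ∀ d w {x y} → FireV w x y → (∀ k → lookup x k ≤ H) →
               (R.Inside {d} w x y × (∀ k → ¬ PeakAt k w (lookup x k))) ⊎ Peaks d w x y
  first-peak d [] {x} {y} f low = inj₁ ((∈-box _ x (λ k → m≤n⇒m≤1+n (low k)) , lookup-ext {M = x} {y} f) ,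
      λ k p → <⇒≱ p (low k))
  first-peak d (a ∷ w) {x} {y} f low with fire-next a w {x} {y} f
  ... | en , g with Finₚ.any? (λ k → H <? lookup (next a x) k)
  ... | yes peak = inj₂ (a ∷ [] , w , refl , next a x ,
      (x∈ , next a x , step-yes a x en , (∈-box _ (next a x) next≤ , refl)) , f₁ , peak , g , carry)
    where
    x∈ = ∈-box _ x (λ k → m≤n⇒m≤1+n (low k))
    next≤ : ∀ k → lookup (next a x) k ≤ suc H
    next≤ k = subst (_≤ suc H) (sym (lookup∘tabulate _ k))
        (+-mono-≤ (po≤1 a k) (≤-trans (m∸n≤m _ (pr a k)) (low k)))
    f₁ : FireV (a ∷ []) x (next a x)
    f₁ k = lookup x k ∸ pr a k , sym (m+[n∸m]≡n (en k)) , sym (lookup∘tabulate _ k)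
    carry : ∀ k → PeakAt k (a ∷ w) (lookup x k) → PeakAt k w (lookup (next a x) k)
    carry k (inj₁ p) = ⊥-elim (<⇒≱ p (low k))
    carry k (inj₂ p) = subst (PeakAt k w) (sym (lookup∘tabulate _ k)) p
  ... | no ¬peak with first-peak d w {next a x} {y} g (λ k → ≮⇒≥ λ p → ¬peak (k , p))
  ... | inj₁ (i , np) = inj₁ ((∈-box _ x (λ k → m≤n⇒m≤1+n (low k)) , next a x , step-yes a x en , i) , np′)
    where
    np′ : ∀ k → ¬ PeakAt k (a ∷ w) (lookup x k)
    np′ k (inj₁ p) = <⇒≱ p (low k)
    np′ k (inj₂ p) = np k (subst (PeakAt k w) (sym (lookup∘tabulate _ k)) p)
  ... | inj₂ (w₁ , w₂ , refl , x₁ , i , f₁ , peak , f₂ , carry) = inj₂ (a ∷ w₁ , w₂ , refl , x₁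
      , (∈-box _ x (λ k → m≤n⇒m≤1+n (low k)) , next a x , step-yes a x en , i)
      , (λ k → lookup x k ∸ pr a k , sym (m+[n∸m]≡n (en k)) , subst (λ z → Fire _ _ w₁ z (lookup x₁ k))
          (lookup∘tabulate _ k) (f₁ k))
      , peak , f₂ , carry′)
    where
    carry′ : ∀ k → PeakAt k (a ∷ w₁ ++ w₂) (lookup x k) → PeakAt k w₂ (lookup x₁ k)
    carry′ k (inj₁ p) = ⊥-elim (<⇒≱ p (low k))
    carry′ k (inj₂ p) = carry k (subst (PeakAt k (w₁ ++ w₂)) (sym (lookup∘tabulate _ k)) p)

-- The candidates are chosen before x and y, hence uniform in the marking. A counter may either meet
-- its target at the end or exceed `bound` on the way: the first form serves for covering, the
-- second for showing that some counter stays bounded when no candidate succeeds.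
record Shortening {Λ : Set} {d n : ℕ} (pr po : Λ → Fin n → ℕ) (t : Fin n → ℕ) (s : Seq Λ d) : Set where
  FireK : Fin n → List Λ → ℕ → ℕ → Set
  FireK k = Fire (λ a → pr a k) (λ a → po a k)
  field
    bound      : ℕ
    candidates : List (List Λ)
    sound      : ∀ {c} → c ∈ candidates → c ∈L s
    reach      : ∀ {w} (x y : Vec ℕ n) → w ∈L s → (∀ k → FireK k w (lookup x k) (lookup y k)) →
                 (∀ k → Peak (λ a → pr a k) (λ a → po a k) bound w (lookup x k) ⊎ t k ≤ lookup y k) →
                 ∃ λ c → c ∈ candidates × (∀ k → ∃ λ z → FireK k c (lookup x k) z × t k ≤ z)

-- Rackoff's argument: cut a run where some counter first exceeds H, shorten the part before
-- inside the box, and treat the rest by induction without that counter, which is large enough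
-- to survive every candidate for the rest.
shorten : ∀ {Λ d} n (pr po : Λ → Fin n → ℕ) → (∀ a k → pr a k ≤ 1) → (∀ a k → po a k ≤ 1) →
          ∀ t (s : Seq Λ d) → Shortening pr po t s
shorten zero pr po pr≤1 po≤1 t s = record
  { bound = 0 ; candidates = skeleton s ∷ [] ; sound = λ { (here refl) → skeleton∈ s }
  ; reach = λ _ _ _ _ _ → _ , here refl , λ () }
shorten {Λ} {d} (suc n) pr po pr≤1 po≤1 t s = record { bound = H ; candidates = candidates ; sound = sound
    ; reach = reach }
  where
  rest : ∀ k (q : Seq Λ d) → Shortening (λ a → pr a ∘ punchIn k) (λ a → po a ∘ punchIn k) (t ∘ punchIn k) q
  rest k q = shorten n _ _ (λ a → pr≤1 a ∘ punchIn k) (λ a → po≤1 a ∘ punchIn k) (t ∘ punchIn k) q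
  module Rest k q = Shortening (rest k q)
  -- A counter above `length c + t k` can pay for every letter of c and still end at `t k` or more.
  -- Including `Rest.bound` lets a peak above `H` count as a peak for the recursive instance.
  need : Fin (suc n) → Seq Λ d → ℕ
  need k q = Rest.bound k q ⊔ maxOver (λ c → length c + t k) (Rest.candidates k q)
  tails : List (Seq Λ d)
  tails = s ∷ map proj₂ (splits s)
  H : ℕ
  H = maxOver (λ q → maxOver (λ k → need k q) (allFin (suc n))) tails
  open Box pr po (suc H)
  open FirstPeak pr po po≤1 H
  need≤H : ∀ k {q} → q ∈ tails → need k q ≤ H
  need≤H k q∈ = ≤-trans (≤-maxOver (λ k → need k _) (∈-allFin k))
      (≤-maxOver (λ q → maxOver (λ k → need k q) (allFin (suc n))) q∈)
  restCandidates : Seq Λ d → List (List Λ)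
  restCandidates q = concatMap (λ k → Rest.candidates k q) (allFin (suc n))
  splitCandidates : Seq Λ d × Seq Λ d → List (List Λ)
  splitCandidates (p , q) = cartesianProductWith _++_ (shortcuts p) (restCandidates q)
  candidates : List (List Λ)
  candidates = shortcuts s ++ restCandidates s ++ concatMap splitCandidates (splits s)
  rest-sound : ∀ q {c} → c ∈ restCandidates q → c ∈L q
  rest-sound q c∈ with find (∈-concatMap⁻ (λ k → Rest.candidates k q) {xs = allFin (suc n)} c∈)
  ... | k , _ , c∈′ = Rest.sound k q c∈′
  sound : ∀ {c} → c ∈ candidates → c ∈L s
  sound c∈ with ∈-++⁻ (shortcuts s) c∈
  ... | inj₁ c∈₁ = shortcuts-sound s c∈₁
  ... | inj₂ c∈₂ with ∈-++⁻ (restCandidates s) c∈₂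
  ... | inj₁ c∈₃ = rest-sound s c∈₃
  ... | inj₂ c∈₃ with find (∈-concatMap⁻ splitCandidates {xs = splits s} c∈₃)
  ... | (p , q) , pq∈ , c∈₄ with ∈-cartesianProductWith⁻ _++_ (shortcuts p) (restCandidates q) c∈₄
  ... | c₁ , c₂ , c₁∈ , c₂∈ , refl = split-sound s pq∈ (shortcuts-sound p c₁∈) (rest-sound q c₂∈)
  FireK : Fin (suc n) → List Λ → ℕ → ℕ → Set
  FireK k = Fire (λ a → pr a k) (λ a → po a k)
  Reaches : List Λ → Vec ℕ (suc n) → Set
  Reaches c x = ∀ k → ∃ λ z → FireK k c (lookup x k) z × t k ≤ z
  PeakOr : List Λ → Vec ℕ (suc n) → Vec ℕ (suc n) → Set
  PeakOr w x y = ∀ k → PeakAt k w (lookup x k) ⊎ t k ≤ lookup y k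
  peak-case : ∀ {q w} x y k → q ∈ tails → H < lookup x k → w ∈L q → FireV w x y → PeakOr w x y →
              ∃ λ c → c ∈ restCandidates q × Reaches c x
  peak-case {q} {w} x y k q∈ large m f g with Rest.reach k q x′ y′ m f′ g′
    where
    x′ = tabulate (lookup x ∘ punchIn k)
    y′ = tabulate (lookup y ∘ punchIn k)
    f′ : ∀ j → FireK (punchIn k j) w (lookup x′ j) (lookup y′ j)
    f′ j = subst₂ (FireK (punchIn k j) w) (sym (lookup∘tabulate _ j)) (sym (lookup∘tabulate _ j))
        (f (punchIn k j))
    g′ : ∀ j → Peak (λ a → pr a (punchIn k j)) (λ a → po a (punchIn k j)) (Rest.bound k q) w (lookup x′ j)
        ⊎ t (punchIn k j) ≤ lookup y′ j
    g′ j = Sum.map (λ p → subst (Peak _ _ _ w) (sym (lookup∘tabulate _ j))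
                       (peak-mono _ _ w (≤-trans (m≤m⊔n _ _) (need≤H k q∈)) p))
                   (subst (t (punchIn k j) ≤_) (sym (lookup∘tabulate _ j))) (g (punchIn k j))
  ... | c , c∈ , r = c , ∈-concatMap⁺ (λ k → Rest.candidates k q) (lose (∈-allFin k) c∈) , r′
    where
    r′ : Reaches c x
    r′ j with k Finₚ.≟ j
    ... | yes refl = fire-long _ _ (λ a → pr≤1 a k) c (lookup x k) (t k)
      (≤-trans (≤-trans (≤-maxOver (λ c → length c + t k) c∈)
          (≤-trans (m≤n⊔m (Rest.bound k q) _) (need≤H k q∈))) (<⇒≤ large))
    ... | no k≢j with r (punchOut k≢j)
    ... | z , fz , tz = z
      , subst₂ (λ i l → FireK i c l z) (Finₚ.punchIn-punchOut k≢j)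
          (trans (lookup∘tabulate _ (punchOut k≢j)) (cong (lookup x) (Finₚ.punchIn-punchOut k≢j))) fz
      , subst (λ i → t i ≤ z) (Finₚ.punchIn-punchOut k≢j) tz
  fire-then : ∀ c₁ c₂ x x₁ → FireV c₁ x x₁ → Reaches c₂ x₁ → Reaches (c₁ ++ c₂) x
  fire-then c₁ c₂ x x₁ f r k with r k
  ... | z , g , tz = z , fire-++ _ _ c₁ (f k) g , tz
  reach : ∀ {w} x y → w ∈L s → FireV w x y → PeakOr w x y → ∃ λ c → c ∈ candidates × Reaches c x
  reach {w} x y m f g with Finₚ.any? (λ k → H <? lookup x k)
  ... | yes (k , large) with peak-case x y k (here refl) large m f g
  ... | c , c∈ , r = c , ∈-++⁺ʳ (shortcuts s) (∈-++⁺ˡ c∈) , r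
  reach {w} x y m f g | no ¬large with first-peak d w {x} {y} f (λ k → ≮⇒≥ λ p → ¬large (k , p))
  ... | inj₁ (i , np) with shortcut s m i
  ... | c , c∈ , fc = c , ∈-++⁺ˡ c∈ , λ k → lookup y k , fc k , ended k (g k)
    where
    ended : ∀ k → PeakAt k w (lookup x k) ⊎ t k ≤ lookup y k → t k ≤ lookup y k
    ended k (inj₁ p) = ⊥-elim (np k p)
    ended k (inj₂ p) = p
  reach {w} x y m f g | no ¬large | inj₂ (w₁ , w₂ , refl , x₁ , i , f₁ , (k , large) , f₂ , carry)
    with split-complete w₁ w₂ m refl
  ... | p , q , pq∈ , m₁ , m₂ with shortcut p m₁ i | peak-case x₁ y k (there (∈-map⁺ proj₂ pq∈)) large m₂
      f₂ (λ k → Sum.map₁ (carry k) (g k))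
  ... | c₁ , c₁∈ , g₁ | c₂ , c₂∈ , r = c₁ ++ c₂
    , ∈-++⁺ʳ (shortcuts s) (∈-++⁺ʳ (restCandidates s) (∈-concatMap⁺ splitCandidates
        (lose pq∈ (∈-cartesianProductWith⁺ _++_ c₁∈ c₂∈))))
    , fire-then c₁ c₂ x x₁ g₁ r

-- Replacing a star by smaller expressions

module Refine {Λ : Set} {d : ℕ} (pre post : Λ → Fin d → ℕ) where
  open Machine pre post

  StarRun : (Fin d → Maybe ℕ) → List (Seq Λ d) → Vec ℕ d → Vec ℕ d → Set
  StarRun v E M N = MatchesM v M × ∃ λ w → w ∈L st v E ε × FireM w M N

  record Valid (v : Fin d → Maybe ℕ) (E : List (Seq Λ d)) (t : Seq Λ d) : Set where
    field
      smaller : Smaller (measure v E) t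
      good    : Good t
      refines : ∀ {M N} → Run t M N → StarRun v E M N

  iterations-matches : ∀ k {v C D p M N} → p ∈ iterations v C D k → Run p M N → MatchesM v M
  iterations-matches k {v} {M = M} {N} = iterations-elim (λ p → Run p M N → MatchesM v M) {v}
    proj₁ (λ _ _ _ r → proj₁ r) k

  unroll-valid : ∀ K v E h → Frozen v E → sizeA (cleanA E h) < sizeA E →
                 ∀ {p} → p ∈ iterations v (cleanA E h) (Unroll.unrollA K E h) K → Valid v E p
  unroll-valid K v E h fr c {p} p∈ = record
    { smaller = Stars-zip (λ m lt → snd (free-cong m) lt) p (typed→mask p typed)
        (iterations-shrink K v E h c K p∈)
    ; good = typed→good p typed
    ; refines = λ r → iterations-matches K p∈ r ,
        (let w , m , f = run→word p r in w , Unroll.unroll-star K v E h K p∈ m , f) }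
    where
    typed : Typed v p v
    typed i = Ty.iterations-typed i K v E h refl (fr i) K p∈

  module Counter (i : Fin d) (B : ℕ) where

    step : Λ → ℕ → Maybe ℕ
    step a x with pre a i ≤? x
    ... | yes _ = just (post a i + (x ∸ pre a i))
    ... | no  _ = nothing

    freeze : (Fin d → Maybe ℕ) → ℕ → Fin d → Maybe ℕ
    freeze v z j with j Finₚ.≟ i
    ... | yes _ = just z
    ... | no  _ = v j

    freeze-same : ∀ v z → freeze v z i ≡ just z
    freeze-same v z with i Finₚ.≟ i
    ... | yes _ = refl
    ... | no ¬p = ⊥-elim (¬p refl)

    freeze-other : ∀ v z {j} → j ≢ i → freeze v z j ≡ v j
    freeze-other v z {j} j≢i with j Finₚ.≟ i
    ... | yes p = ⊥-elim (j≢i p)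
    ... | no  _ = refl

    module R = Restrict _≟_ step (upTo (suc B)) freeze

    fire→inside : ∀ w {m n} → FireAt i w m n → ¬ Peak (λ a → pre a i) (λ a → post a i) B w m → R.Inside w m n
    fire→inside [] refl np = ∈-upTo⁺ (s≤s (≮⇒≥ np)) , refl
    fire→inside (a ∷ w) {m} {n} (r , e , f) np = ∈-upTo⁺ (s≤s (≮⇒≥ (np ∘ inj₁))) , _ , enabled
      , fire→inside w (subst (λ z → FireAt i w z n) (cong (post a i +_) r≡) f) (np ∘ inj₂)
      where
      r≡ : r ≡ m ∸ pre a i
      r≡ = trans (sym (m+n∸m≡n (pre a i) r)) (cong (_∸ pre a i) (sym e))
      enabled : step a m ≡ just (post a i + (m ∸ pre a i))
      enabled with pre a i ≤? m
      ... | yes _ = refl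
      ... | no ¬p = ⊥-elim (¬p (subst (pre a i ≤_) (sym e) (m≤m+n _ r)))

    step-typed : ∀ a x x′ → step a x ≡ just x′ → Step {d = d} (λ a → pre a i) (λ a → post a i) a (just x)
        (just x′)
    step-typed a x x′ e with pre a i ≤? x
    step-typed a x x′ e | yes p = x ∸ pre a i , sym (m+[n∸m]≡n p) , just-injective e

    TypedHere : Seq Λ d → ℕ → ℕ → Seq Λ d → Set
    TypedHere s x y s′ = Ty.TyS i (just x) s′ (just y)

    typed-here : ∀ s {x y s′} → s′ ∈ R.restrictS s x y → TypedHere s x y s′
    typed-here = R.Elim.elimS {TypedHere} record
      { P-ε    = refl
      ; P-lt   = λ {a} {s} {x} {x′} e t → just x′ , step-typed a x x′ e , t
      ; P-◇    = λ {v} {E} {s} {x} {z} {y} {p} {q} → Ty.TyS-◇ i p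
      ; P-stop = refl
      ; P-one  = λ _ t → t
      ; P-loop = λ {v} {E} {x} {z} {y} {L} {p} {q} t f t′ → Ty.TyS-◇ i p t
          (freeze-same v z , Ty.TyA-tabulate i L f , t′) }

    TypedThere : Fin d → Seq Λ d → ℕ → ℕ → Seq Λ d → Set
    TypedThere j s x y s′ = ∀ m n → Ty.TyS j m s n → Ty.TyS j m s′ n

    typed-there : ∀ {j} → j ≢ i → ∀ s {x y s′} → s′ ∈ R.restrictS s x y → TypedThere j s x y s′
    typed-there {j} j≢i = R.Elim.elimS {TypedThere j} record
      { P-ε    = λ m n t → t
      ; P-lt   = λ e f m n (m′ , p , t) → m′ , p , f m′ n t
      ; P-◇    = λ {v} {E} {s} {x} {z} {y} {p} {q} f g m n (e , tE , t) → Ty.TyS-◇ j p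
          (f m m (e , tE , refl)) (g m n t)
      ; P-stop = λ { m n (_ , _ , t) → t }
      ; P-one  = λ { e∈ f m n (_ , tE , refl) → f m m (Ty.TyA-lookup j tE e∈) }
      ; P-loop = λ { {v} {E} {x} {z} {y} {L} {p} {q} f g h m n (e , tE , refl) → Ty.TyS-◇ j p
          (f m m (e , tE , refl))
          (trans (freeze-other v z j≢i) e , Ty.TyA-tabulate j L (λ l∈ → g l∈ m m (e , tE , refl)) , h m m
              (e , tE , refl)) } }

    -- A star without alternatives contains only the empty word, but in a run it tests the entry
    -- marking. This supplies the `MatchesM` part of `refines` even if s contains no star.
    test : (Fin d → Maybe ℕ) → ℕ → Seq Λ d → Seq Λ d
    test v x s = st (freeze v x) [] s

    test-typed : ∀ v E x y → Frozen v E → ∀ {s} → s ∈ R.restrictS (st v E ε) x y → Typed (freeze v x)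
        (test v x s) (freeze v y)
    test-typed v E x y fr {s} s∈ j = refl , tt , typed j (j Finₚ.≟ i)
      where
      typed : ∀ j → Dec (j ≡ i) → Ty.TyS j (freeze v x j) s (freeze v y j)
      typed .i (yes refl) = subst₂ (λ m n → Ty.TyS i m s n) (sym (freeze-same v x))
          (sym (freeze-same v y)) (typed-here (st v E ε) {x} {y} s∈)
      typed j  (no j≢i)   = subst₂ (λ m n → Ty.TyS j m s n) (sym (freeze-other v x j≢i))
          (sym (freeze-other v y j≢i))
                              (typed-there j≢i (st v E ε) {x} {y} s∈ (v j) (v j) (refl , fr j , refl))

    freeze-mask : ∀ v z j → is-just (v j) ≡ true → is-just (freeze v z j) ≡ true
    freeze-mask v z j p with j Finₚ.≟ i
    ... | yes _ = refl
    ... | no  _ = p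

    freeze-free : ∀ v z → v i ≡ nothing → free (freeze v z) < free v
    freeze-free v z e = free-< (freeze-mask v z) i (cong is-just e) (cong is-just (freeze-same v z))

    test-valid : ∀ v E x y → Frozen v E → v i ≡ nothing → ∀ {s} → s ∈ R.restrictS (st v E ε) x y → Valid v
        E (test v x s)
    test-valid v E x y fr e {s} s∈ = record
      { smaller = Stars-map (λ {u} m → fst (subst (_< free v) (sym (free-cong m)) (freeze-free v x e)))
          (test v x s)
                    (typed→mask (test v x s) (test-typed v E x y fr s∈))
      ; good = typed→good (test v x s) (test-typed v E x y fr s∈)
      ; refines = λ { {M} {N} (m , w , M′ , x∈ , f , r) → (λ j → unfreeze j (j Finₚ.≟ i) (m j)) ,
          (let w′ , m′ , f′ = run→word s r in w ++ w′ , star-++ (emptyStar x∈) (proj₁ (R.restrict-sound (st v E ε) {x} {y} s∈ m′)) , fireM-++ w M M′ N f f′) } }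
      where
      unfreeze : ∀ j → Dec (j ≡ i) → ∀ {M} → Matches {Λ} {d} (freeze v x j) M → Matches {Λ} {d} (v j) M
      unfreeze .i (yes refl) m rewrite e = tt
      unfreeze j  (no j≢i) {M} m = subst (λ z → Matches {Λ} {d} z M) (freeze-other v x j≢i) m
      emptyStar : ∀ {u w} → w ∈L st u [] ε → w ∈L st v E ε
      emptyStar (stop empty) = stop empty

    test-complete : ∀ v E → Frozen v E → ∀ {w} M N → MatchesM v M → w ∈L st v E ε → FireM w M N →
      ¬ Peak (λ a → pre a i) (λ a → post a i) B w (lookup M i) →
      ∃ λ s → s ∈ R.restrictS (st v E ε) (lookup M i) (lookup N i) × lookup M i ∈ upTo (suc B) × lookup N
          i ∈ upTo (suc B)
            × Run (test v (lookup M i) s) M N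
    test-complete v E fr {w} M N m w∈ f np with R.restrict-complete w∈ (fire→inside w (f i) np)
    ... | s , s∈ , w∈s = s , s∈ , R.inside-start w ins , inside-end w ins
        , word→run (test v (lookup M i) s) M N (test-typed v E _ _ fr s∈) matches (stop w∈s) f
      where
      ins = fire→inside w (f i) np
      inside-end : ∀ w {x y} → R.Inside w x y → y ∈ upTo (suc B)
      inside-end []      (x∈ , refl)          = x∈
      inside-end (a ∷ w) (_ , x′ , _ , i) = inside-end w i
      matches : MatchesM (freeze v (lookup M i)) M
      matches j with j Finₚ.≟ i
      ... | yes refl = refl
      ... | no  _    = m j

  -- Which coordinate stays below `B`, and with which values it enters and leaves, depends on the
  -- run; hence the union over all unfrozen coordinates and all pairs of values.
  counterCases : (Fin d → Maybe ℕ) → List (Seq Λ d) → ℕ → List (Seq Λ d)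
  counterCases v E B = concatMap (λ i → casesAt i (v i)) (allFin d)
    module CounterCases where
    open Counter using (test; module R)
    casesAt : Fin d → Maybe ℕ → List (Seq Λ d)
    casesAt i (just _) = []
    casesAt i nothing  = concatMap (λ x → concatMap (λ y → map (test i B v x)
        (R.restrictS i B (st v E ε) x y)) (upTo (suc B))) (upTo (suc B))

  counter-valid : ∀ v E B → Frozen v E → ∀ {t} → t ∈ counterCases v E B → Valid v E t
  counter-valid v E B fr t∈ with find (∈-concatMap⁻ (λ i → CounterCases.casesAt v E B i (v i))
      {xs = allFin d} t∈)
  ... | i , _ , t∈₁ with v i in e
  ... | nothing with find (∈-concatMap⁻ (λ x → concatMap
      (λ y → map (Counter.test i B v x) (Counter.R.restrictS i B (st v E ε) x y)) (upTo (suc B)))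
      {xs = upTo (suc B)} t∈₁)
  ... | x , _ , t∈₂ with find (∈-concatMap⁻ (λ y → map (Counter.test i B v x)
      (Counter.R.restrictS i B (st v E ε) x y)) {xs = upTo (suc B)} t∈₂)
  ... | y , _ , t∈₃ with ∈-map⁻ (Counter.test i B v x) t∈₃
  ... | s , s∈ , refl = Counter.test-valid i B v E x y fr e s∈

  counter-complete : ∀ v E B → Frozen v E → ∀ {w} M N → MatchesM v M → w ∈L st v E ε → FireM w M N → ∀ i →
      v i ≡ nothing →
    ¬ Peak (λ a → pre a i) (λ a → post a i) B w (lookup M i) → ∃ λ t → t ∈ counterCases v E B × Run t M N
  counter-complete v E B fr M N m w∈ f i e np with Counter.test-complete i B v E fr M N m w∈ f np
  ... | s , s∈ , x∈ , y∈ , r = case′ , ∈-concatMap⁺ (λ i → casesAt i (v i))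
      (lose (∈-allFin i) (subst (λ z → case′ ∈ casesAt i z) (sym e)
        (∈-concatMap⁺ (λ x → concatMap (results x) (upTo (suc B)))
            (lose x∈ (∈-concatMap⁺ (results (lookup M i))
          (lose y∈ (∈-map⁺ (Counter.test i B v (lookup M i)) s∈))))))) , r
    where
    open CounterCases v E B
    case′ = Counter.test i B v (lookup M i) s
    results : ℕ → ℕ → List (Seq Λ d)
    results x y = map (Counter.test i B v x) (Counter.R.restrictS i B (st v E ε) x y)


-- Reversal of expressions and runs

revS : Seq Λ d → Seq Λ d
revA : List (Seq Λ d) → List (Seq Λ d)
revS ε          = ε
revS (lt a s)   = revS s ◇ lt a ε
revS (st v E s) = revS s ◇ st v (revA E) ε
revA []      = []
revA (e ∷ E) = revS e ∷ revA E

rev∈  : {s : Seq Λ d} {w : List Λ} → w ∈L s → reverse w ∈L revS s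
revA∈ : {E : List (Seq Λ d)} {e : Seq Λ d} → e ∈ E → revS e ∈ revA E
rev∈ empty = empty
rev∈ (cons {a} {w} m) = subst (_∈L _) (sym (unfold-reverse a w)) (◇-intro (rev∈ m) (cons empty))
rev∈ (stop {w = w} m) = subst (_∈L _) (++-identityʳ (reverse w)) (◇-intro (rev∈ m) (stop empty))
rev∈ {s = st v E s} (loop {w₁ = w₁} {w₂} e∈ m m′ refl) with ◇-elim (revS s) (rev∈ m′)
... | u , u′ , e , a , b = subst (_∈L _) (sym (trans (reverse-++ w₁ w₂)
    (trans (cong (_++ reverse w₁) e) (++-assoc u u′ (reverse w₁)))))
  (◇-intro a (star-++ {v = v} b (loop (revA∈ e∈) (rev∈ m) (stop empty) (sym (++-identityʳ _)))))
revA∈ (here refl) = here refl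
revA∈ (there e∈)  = there (revA∈ e∈)

unrev∈  : (s : Seq Λ d) {w : List Λ} → w ∈L revS s → reverse w ∈L s
unrev-star : ∀ v (E : List (Seq Λ d)) {w : List Λ} → w ∈L st v (revA E) ε → reverse w ∈L st v E ε
unrevA∈ : (E : List (Seq Λ d)) {e : Seq Λ d} → e ∈ revA E → ∃ λ e′ → e′ ∈ E ×
    (∀ {w} → w ∈L e → reverse w ∈L e′)
unrev∈ ε empty = empty
unrev∈ (lt a s) m with ◇-elim (revS s) m
... | u , .(a ∷ []) , refl , x , cons empty = subst (_∈L lt a s) (sym (reverse-++ u (a ∷ [])))
    (cons (unrev∈ s x))
unrev∈ (st v E s) m with ◇-elim (revS s) m
... | u , u′ , refl , x , y = subst (_∈L st v E s) (sym (reverse-++ u u′))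
    (star-++ (unrev-star v E y) (stop (unrev∈ s x)))
unrev-star v E (stop empty) = stop empty
unrev-star v E (loop {w₁ = w₁} {w₂} e∈ m m′ refl) with unrevA∈ E e∈
... | e′ , e∈′ , f = subst (_∈L st v E ε) (sym (reverse-++ w₁ w₂)) (star-++ {v = v} (unrev-star v E m′)
  (loop e∈′ (f m) (stop empty) (sym (++-identityʳ _))))
unrevA∈ (e ∷ E) (here refl) = e , here refl , unrev∈ e
unrevA∈ (e ∷ E) (there e∈) with unrevA∈ E e∈
... | e′ , e∈′ , f = e′ , there e∈′ , f

module _ (pr po : Λ → ℕ) where

  fire-reverse : ∀ w {m n} → Fire pr po w m n → Fire po pr (reverse w) n m
  fire-reverse []      refl = refl
  fire-reverse (a ∷ w) (r , refl , f) = subst (λ u → Fire po pr u _ _) (sym (unfold-reverse a w))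
    (fire-++ po pr (reverse w) (fire-reverse w f) (r , refl , refl))

  peak-++ˡ : ∀ B w {w′ m} → Peak pr po B w m → Peak pr po B (w ++ w′) m
  peak-++ˡ B []      {[]}    p        = p
  peak-++ˡ B []      {_ ∷ _} p        = inj₁ p
  peak-++ˡ B (a ∷ w)         (inj₁ p) = inj₁ p
  peak-++ˡ B (a ∷ w)         (inj₂ p) = inj₂ (peak-++ˡ B w p)

  peak-++ʳ : ∀ B w {w′ m n} → Fire pr po w m n → Peak pr po B w′ n → Peak pr po B (w ++ w′) m
  peak-++ʳ B []      refl           p = p
  peak-++ʳ B (a ∷ w) (r , refl , f) p = inj₂ (peak-++ʳ B w
      (subst (λ z → Fire pr po w (po a + z) _) (sym (m+n∸m≡n (pr a) r)) f) p)

  peak-end : ∀ B w {m n} → Fire pr po w m n → B < n → Peak pr po B w m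
  peak-end B w f p = subst (λ u → Peak pr po B u _) (++-identityʳ w) (peak-++ʳ B w {[]} f p)

peak-reverse : ∀ (pr po : Λ → ℕ) B w {m n} → Fire pr po w m n → Peak pr po B w m → Peak po pr B (reverse w) n
peak-reverse pr po B []      refl p = p
peak-reverse pr po B (a ∷ w) {m} {n} (r , refl , f) p = subst (λ u → Peak po pr B u n)
    (sym (unfold-reverse a w)) (go p)
  where
  go : Peak pr po B (a ∷ w) (pr a + r) → Peak po pr B (reverse w ++ a ∷ []) n
  go (inj₁ q) = peak-end po pr B (reverse w ++ a ∷ []) (fire-++ po pr (reverse w) (fire-reverse pr po w f)
      (r , refl , refl)) q
  go (inj₂ q) = peak-++ˡ po pr B (reverse w) (peak-reverse pr po B w f
      (subst (λ z → Peak pr po B w (po a + z)) (m+n∸m≡n (pr a) r) q))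

-- Pumping

module Pumping (pr po : Λ → ℕ) (pr≤1 : ∀ a → pr a ≤ 1) where

  fire-to : ∀ w {m n n′} → Fire pr po w m n → n′ + weight pr w ≡ m + weight po w → Fire pr po w m n′
  fire-to w {m} f e = subst (Fire pr po w m) (+-cancelʳ-≡ (weight pr w) _ _
      (trans (fire-effect pr po w f) (sym e))) f

  fire-large : ∀ w {m n} → length w ≤ m → n + weight pr w ≡ m + weight po w → Fire pr po w m n
  fire-large w {m} le e with fire-long pr po pr≤1 w m 0 (subst (_≤ m) (sym (+-identityʳ _)) le)
  ... | _ , f , _ = fire-to w f e

  -- Each copy of `u` uses up one X and leaves one α. The copies of X not yet used, the gains
  -- already made and c are an idle surplus in each round.
  fire-power : ∀ u x X α k c → Fire pr po u (x + X) (x + α) → Fire pr po (power k u) (x + k * X + c)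
      (x + k * α + c)
  fire-power u x X α zero    c f = refl
  fire-power u x X α (suc k) c f = fire-++ pr po u
    (subst₂ (Fire pr po u) (lem₁ x X (k * X) c) (lem₂ x α (k * X) c) (fire-mono pr po u (k * X + c) f))
    (subst (Fire pr po (power k u) (x + k * X + (α + c))) (lem₃ x α (k * α) c)
        (fire-power u x X α k (α + c) f))
    where
    lem₁ : ∀ x X p c → p + c + (x + X) ≡ x + (X + p) + c
    lem₁ = solve-∀
    lem₂ : ∀ x α p c → p + c + (x + α) ≡ x + p + (α + c)
    lem₂ = solve-∀
    lem₃ : ∀ x α p c → x + p + (α + c) ≡ x + (α + p) + c
    lem₃ = solve-∀

  -- The value in the middle of z^m interpolates between y + mα and y + mβ.
  fire-drift : ∀ z y α β k j → α + weight po z ≡ β + weight pr z → 1 ≤ α → 1 ≤ β → length z ≤ k + j →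
               Fire pr po (power k z) (y + k * α + j * β) (y + (k + j) * β)
  fire-drift z y α β zero    j e 1≤α 1≤β le = cong (_+ j * β) (+-identityʳ y)
  fire-drift z y α β (suc k) j e 1≤α 1≤β le = fire-++ pr po z
    (fire-large z {n = y + k * α + suc j * β}
      (≤-trans le (≤-trans (+-mono-≤ (m≤m*n (suc k) α ⦃ >-nonZero 1≤α ⦄) (m≤m*n j β ⦃ >-nonZero 1≤β ⦄))
          (+-monoˡ-≤ (j * β) (m≤n+m (suc k * α) y))))
      (trans (lem₁ y (k * α) β (j * β) (weight pr z)) (trans (cong (λ q → y + k * α + j * β + q) (sym e))
          (lem₂ y (k * α) α (j * β) (weight po z)))))
    (subst (λ q → Fire pr po (power k z) (y + k * α + suc j * β) (y + q * β)) (+-suc k j)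
      (fire-drift z y α β k (suc j) e 1≤α 1≤β (subst (length z ≤_) (sym (+-suc k j)) le)))
    where
    lem₁ : ∀ y p β q w → y + p + (β + q) + w ≡ y + p + q + (β + w)
    lem₁ = solve-∀
    lem₂ : ∀ y p α q w → y + p + q + (α + w) ≡ y + (α + p) + q + w
    lem₂ = solve-∀

  pumped : (u s z w : List Λ) → ℕ → List Λ
  pumped u s z w m = power m u ++ (s ++ (power m z ++ power m w))

  -- X and Y are the homogeneous shares of the entry and exit values. The powers of `u` turn m·X
  -- into m·α, `s` leads from x to y, the powers of `z` turn m·α into m·β, and those of `w` turn m·β
  -- into m·Y. Only `u` and `w` have to fire from prescribed values; positive α and β and large m
  -- leave enough tokens for `s` and `z`.
  fire-pumped : ∀ u s z w x y X Y α β m → Fire pr po u (x + X) (x + α) → 1 ≤ α → Fire pr po w (y + β)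
      (y + Y) → 1 ≤ β →
    x + weight po s ≡ y + weight pr s →
    X + (weight po u + weight po z + weight po w) ≡ Y + (weight pr u + weight pr z + weight pr w) →
    length s ≤ m → length z ≤ m → Fire pr po (pumped u s z w m) (x + m * X) (y + m * Y)
  fire-pumped u s z w x y X Y α β m fu 1≤α fw 1≤β es ez ls lz =
    fire-++ pr po (power m u) (subst₂ (Fire pr po (power m u)) (+-identityʳ _) (+-identityʳ _)
        (fire-power u x X α m 0 fu))
    (fire-++ pr po s (fire-large s {n = y + m * α} (≤-trans ls
        (≤-trans (m≤m*n m α ⦃ >-nonZero 1≤α ⦄) (m≤n+m _ x)))
        (trans (lem₀ y (m * α) (weight pr s)) (trans (cong (_+ m * α) (sym es))
            (lem₀′ x (weight po s) (m * α)))))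
    (fire-++ pr po (power m z) (subst₂ (Fire pr po (power m z)) (+-identityʳ _)
        (cong (λ q → y + q * β) (+-identityʳ m))
        (fire-drift z y α β m 0 drift 1≤α 1≤β (subst (length z ≤_) (sym (+-identityʳ m)) lz)))
      (subst₂ (Fire pr po (power m w)) (+-identityʳ _) (+-identityʳ _) (fire-power w y β Y m 0 fw))))
    where
    lem₀ : ∀ y p q → y + p + q ≡ y + q + p
    lem₀ = solve-∀
    lem₀′ : ∀ x p q → x + p + q ≡ x + q + p
    lem₀′ = solve-∀
    up : α + weight pr u ≡ X + weight po u
    up = +-cancelˡ-≡ x _ _ (trans (sym (+-assoc x α _)) (trans (fire-effect pr po u fu) (+-assoc x X _)))
    down : Y + weight pr w ≡ β + weight po w
    down = +-cancelˡ-≡ y _ _ (trans (sym (+-assoc y Y _)) (trans (fire-effect pr po w fw) (+-assoc y β _)))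
    drift : α + weight po z ≡ β + weight pr z
    drift = +-cancelʳ-≡ (weight pr u + weight po w) _ _ (begin
      α + weight po z + (weight pr u + weight po w)               ≡⟨ lem₁ α (weight po z) (weight pr u)
          (weight po w) ⟩
      α + weight pr u + (weight po z + weight po w)               ≡⟨ cong (_+ (weight po z + weight po w))
          up ⟩
      X + weight po u + (weight po z + weight po w)               ≡⟨ lem₂ X (weight po u) (weight po z)
          (weight po w) ⟩
      X + (weight po u + weight po z + weight po w)               ≡⟨ ez ⟩
      Y + (weight pr u + weight pr z + weight pr w)               ≡⟨ lem₃ Y (weight pr u) (weight pr z)
          (weight pr w) ⟩
      Y + weight pr w + (weight pr u + weight pr z)               ≡⟨ cong (_+ (weight pr u + weight pr z))
          down ⟩
      β + weight po w + (weight pr u + weight pr z)               ≡⟨ lem₄ β (weight po w) (weight pr u)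
          (weight pr z) ⟩
      β + weight pr z + (weight pr u + weight po w)               ∎)
      where
      open ≡-Reasoning
      lem₁ : ∀ a b c e → a + b + (c + e) ≡ a + c + (b + e)
      lem₁ = solve-∀
      lem₂ : ∀ a b c e → a + b + (c + e) ≡ a + (b + c + e)
      lem₂ = solve-∀
      lem₃ : ∀ a b c e → a + (b + c + e) ≡ a + e + (b + c)
      lem₃ = solve-∀
      lem₄ : ∀ a b c e → a + b + (c + e) ≡ a + e + (c + b)
      lem₄ = solve-∀

  weight-pumped : ∀ (φ : Λ → ℕ) u s z w m → weight φ (pumped u s z w m) ≡ weight φ s + m *
      (weight φ u + weight φ z + weight φ w)
  weight-pumped φ u s z w m = begin
    weight φ (pumped u s z w m)
      ≡⟨ trans (weight-++ φ (power m u) _) (cong₂ _+_ (weight-power φ m u) (trans (weight-++ φ s _)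
          (cong (weight φ s +_) (trans (weight-++ φ (power m z) _)
              (cong₂ _+_ (weight-power φ m z) (weight-power φ m w)))))) ⟩
    m * weight φ u + (weight φ s + (m * weight φ z + m * weight φ w))
      ≡⟨ lem m (weight φ u) (weight φ s) (weight φ z) (weight φ w) ⟩
    weight φ s + m * (weight φ u + weight φ z + weight φ w) ∎
    where
    open ≡-Reasoning
    lem : ∀ m u s z w → m * u + (s + (m * z + m * w)) ≡ s + m * (u + z + w)
    lem = solve-∀

totalS : (s : Seq Λ d) → CS s → ℕ
totalA : (E : List (Seq Λ d)) → CA E → ℕ
totalS ε          n            = 0
totalS (lt a s)   n            = totalS s n
totalS (st v E s) (n , n′)     = totalA E n + totalS s n′
totalA []         n            = 0
totalA (e ∷ E)    (k , n , n′) = k + totalS e n + totalA E n′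

Remainder : (s : Seq Λ d) → (h c : CS s) → ℕ → Set
Remainder {Λ} s h c N = ∃ λ r → PosS s r × (∀ (φ : Λ → ℕ) → weightS φ s r + weightS φ s c ≡ N * weightS φ s h)

RemainderA : (E : List (Seq Λ d)) → (h c : CA E) → ℕ → Set
RemainderA {Λ} E h c N = ∃ λ r → PosA E r × (∀ (φ : Λ → ℕ) → weightA φ E r + weightA φ E c ≡ N * weightA φ
    E h)

-- All multiplicities in h are at least 1 and those in c are below N, so N·h - c is positive in
-- every entry and can be realized by a word.
remainderS : ∀ (s : Seq Λ d) h c N → PosS s h → totalS s c < N → Remainder s h c N
remainderA : ∀ (E : List (Seq Λ d)) h c N → PosA E h → totalA E c < N → RemainderA E h c N
remainderS ε          h c N p lb = tt , tt , λ φ → sym (*-zeroʳ N)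
remainderS (lt a s)   h c N p lb = remainderS s h c N p lb
remainderS (st v E s) (h , h′) (c , c′) N (p , p′) lb
  with remainderA E h c N p (≤-<-trans (m≤m+n _ _) lb) | remainderS s h′ c′ N p′
      (≤-<-trans (m≤n+m _ (totalA E c)) lb)
... | r , pr , e | r′ , pr′ , e′ = (r , r′) , (pr , pr′) , λ φ →
  trans (interchange (weightA φ E r) (weightS φ s r′) (weightA φ E c) (weightS φ s c′))
      (trans (cong₂ _+_ (e φ) (e′ φ)) (sym (*-distribˡ-+ N _ _)))
remainderA []      h c N p lb = tt , tt , λ φ → sym (*-zeroʳ N)
remainderA (e ∷ E) (k , h , h′) (j , c , c′) N (0<k , p , p′) lb
  with remainderS e h c N p (≤-<-trans (≤-trans (m≤n+m _ j) (m≤m+n _ (totalA E c′))) lb) | remainderA E h′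
      c′ N p′ (≤-<-trans (m≤n+m _ (j + totalS e c)) lb)
... | r , pr , eq | r′ , pr′ , eq′ = (N * k ∸ j , r , r′) , (m<n⇒0<n∸m j<Nk , pr , pr′) , λ φ →
  trans (lem (N * k ∸ j) j (weight φ (skeleton e)) (weightS φ e r) (weightS φ e c) (weightA φ E r′)
      (weightA φ E c′))
    (trans (cong₂ _+_ (cong₂ _+_ (cong (_* weight φ (skeleton e)) (m∸n+n≡m (<⇒≤ j<Nk))) (eq φ)) (eq′ φ))
      (lem′ N k (weight φ (skeleton e)) (weightS φ e h) (weightA φ E h′)))
  where
  j<Nk : j < N * k
  j<Nk = <-≤-trans (≤-<-trans (≤-trans (m≤m+n j _) (m≤m+n _ (totalA E c′))) lb) (m≤m*n N k ⦃ >-nonZero 0<k ⦄)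
  lem : ∀ a j x r c r′ c′ → (a * x + r) + r′ + ((j * x + c) + c′) ≡ (a + j) * x + (r + c) + (r′ + c′)
  lem = solve-∀
  lem′ : ∀ N k x h h′ → N * k * x + N * h + N * h′ ≡ N * (k * x + h + h′)
  lem′ = solve-∀

PosS-addʳ : ∀ (s : Seq Λ d) b h → PosS s h → PosS s (addS s b h)
PosA-addʳ : ∀ (E : List (Seq Λ d)) b h → PosA E h → PosA E (addA E b h)
PosS-addʳ ε          b h p = tt
PosS-addʳ (lt a s)   b h p = PosS-addʳ s b h p
PosS-addʳ (st v E s) (b , b′) (h , h′) (p , p′) = PosA-addʳ E b h p , PosS-addʳ s b′ h′ p′
PosA-addʳ []      b h p = tt
PosA-addʳ (e ∷ E) (k , b , b′) (l , h , h′) (q , p , p′) = ≤-trans q (m≤n+m l k) , PosS-addʳ e b h p ,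
    PosA-addʳ E b′ h′ p′

lookup-ray : ∀ {d} (b h : Vec ℕ d) k i → lookup (b ⊞ scale k h) i ≡ lookup b i + k * lookup h i
lookup-ray b h k i = trans (lookup-zipWith _+_ i b (scale k h))
  (cong (lookup b i +_) (additive-scale (λ x → lookup x i) (lookup-zipWith _+_ i) k h))

module StarPump {Λ : Set} {d : ℕ} (pre post : Λ → Fin d → ℕ) (pre≤1 : ∀ a i → pre a i ≤ 1) (post≤1 : ∀ a i → post a i ≤ 1) where
  open Machine pre post
  open Refine pre post

  record StarSystem (v : Fin d → Maybe ℕ) (E : List (Seq Λ d)) : Set where
    field
      xb yb xh yh : Vec ℕ d
      nb nh       : CA E
      base-eq     : ∀ i → lookup xb i + weightA (λ a → post a i) E nb ≡ lookup yb i + weightA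
          (λ a → pre a i) E nb
      hom-eq      : ∀ i → lookup xh i + weightA (λ a → post a i) E nh ≡ lookup yh i + weightA
          (λ a → pre a i) E nh
      base-match  : MatchesM v xb
      hom-match   : ∀ i c → v i ≡ just c → lookup xh i ≡ 0

  module _ {v : Fin d → Maybe ℕ} {E : List (Seq Λ d)} (S : StarSystem v E) where
    open StarSystem S

    -- Only unfrozen coordinates with homogeneous value 0 are mentioned. Frozen coordinates never
    -- block a word of the star, and where the homogeneous value is positive its multiples supply
    -- the tokens.
    ForwardPump BackwardPump : Set
    ForwardPump  = ∃ λ u → u ∈L st v E ε × (∀ i → v i ≡ nothing → lookup xh i ≡ 0 → ∃ λ p → FireAt i u
        (lookup xb i) p × suc (lookup xb i) ≤ p)
    BackwardPump = ∃ λ w → w ∈L st v E ε × (∀ i → v i ≡ nothing → lookup yh i ≡ 0 → ∃ λ p → FireAt i w p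
        (lookup yb i) × suc (lookup yb i) ≤ p)

    -- The thresholds are followed by universal quantifiers so that all stars of a sequence can be
    -- pumped with one common N and then one common m. The bound for m comes after N because the
    -- filler word `z` depends on N.
    star-pump : PosA E nh → Frozen v E → ForwardPump → BackwardPump → ∃ λ N₀ → ∀ N → N₀ ≤ N → ∃ λ m₀ → ∀ m
        → m₀ ≤ m →
                StarRun v E (xb ⊞ scale (suc (m * N)) xh) (yb ⊞ scale (suc (m * N)) yh)
    star-pump pos fr (u , u∈ , fu) (w , w∈ , fw) = N₀ , go
      where
      cu = proj₁ (count u∈)
      cw = proj₁ (count w∈)
      -- Larger than the lengths of `u` and `w`, so N copies of a positive homogeneous value pay for
      -- either with a token to spare, and larger than all multiplicities in `u` and `w` together,
      -- so these can be subtracted from N copies of `nh`.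
      N₀ = suc (length u + length w + (totalA E (addA E cu cw)))
      totalA≤ : totalA E (addA E cu cw) < N₀
      totalA≤ = s≤s (m≤n+m _ _)
      go : ∀ N → N₀ ≤ N → ∃ λ m₀ → ∀ m → m₀ ≤ m → StarRun v E (xb ⊞ scale (suc (m * N)) xh)
          (yb ⊞ scale (suc (m * N)) yh)
      -- `nb` may have zero entries; adding `nh` once makes all of them positive and hence
      -- realizable. This extra copy is the `suc` in `suc (m * N)`.
      go N N₀≤ with realizeA v E E id (addA E nb nh) (PosA-addʳ E nb nh pos)
                  | remainderA E nh (addA E cu cw) N pos (<-≤-trans totalA≤ N₀≤)
      ... | s , s∈ , sw | r , rpos , rw with realizeA v E E id r rpos
      ... | z , z∈ , zw = length s + length z , λ m m₀≤ →
          matches m , W m , W∈ m , λ i → subst₂ (FireAt i (W m)) (sym (lookup-ray xb xh (suc (m * N)) i))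
              (sym (lookup-ray yb yh (suc (m * N)) i)) (fireAt i m m₀≤ (v i) refl)
        where
        W : ℕ → List Λ
        W = Pumping.pumped (λ a → 0) (λ a → 0) (λ _ → z≤n) u s z w
        W∈ : ∀ m → W m ∈L st v E ε
        W∈ m = star-++ {v = v} (power∈ m u∈) (star-++ {v = v} s∈
            (star-++ {v = v} (power∈ m z∈) (power∈ m w∈)))
        matches : ∀ m → MatchesM v (xb ⊞ scale (suc (m * N)) xh)
        matches m i with v i in e | base-match i
        ... | nothing | _ = tt
        ... | just c  | b = trans (lookup-ray xb xh (suc (m * N)) i)
            (trans (cong₂ (λ p q → p + suc (m * N) * q) b (hom-match i c e))
                              (trans (cong (c +_) (*-zeroʳ (suc (m * N)))) (+-identityʳ c)))
        word-weight : ∀ {w} (φ : Λ → ℕ) (w∈ : w ∈L st v E ε) → weight φ w ≡ weightA φ E (proj₁ (count w∈))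
        word-weight φ w∈ = trans (weight-count φ w∈) (+-identityʳ _)
        loop-weight : ∀ (φ : Λ → ℕ) → weight φ u + weight φ z + weight φ w ≡ N * weightA φ E nh
        loop-weight φ = begin
          weight φ u + weight φ z + weight φ w  ≡⟨ cong₂ _+_ (cong₂ _+_ (word-weight φ u∈) (zw φ))
              (word-weight φ w∈) ⟩
          a + weightA φ E r + b                 ≡⟨ lem a (weightA φ E r) b ⟩
          weightA φ E r + (a + b)               ≡⟨ cong (weightA φ E r +_) (sym (weightA-add φ E cu cw)) ⟩
          weightA φ E r + weightA φ E (addA E cu cw) ≡⟨ rw φ ⟩
          N * weightA φ E nh                    ∎
          where
          open ≡-Reasoning
          a = weightA φ E cu
          b = weightA φ E cw
          lem : ∀ a r b → a + r + b ≡ r + (a + b)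
          lem = solve-∀
        module _ (i : Fin d) where
          private
            pr po : Λ → ℕ
            pr a = pre a i
            po a = post a i
            x = lookup xb i + lookup xh i
            y = lookup yb i + lookup yh i
            X = N * lookup xh i
            Y = N * lookup yh i
          s-eq : x + weight po s ≡ y + weight pr s
          s-eq = trans (cong (x +_) (trans (sw po) (weightA-add po E nb nh)))
            (trans (lem (lookup xb i) (lookup xh i) (weightA po E nb) _)
                (trans (cong₂ _+_ (base-eq i) (hom-eq i))
              (trans (sym (lem (lookup yb i) (lookup yh i) (weightA pr E nb) _))
                  (cong (y +_) (sym (trans (sw pr) (weightA-add pr E nb nh)))))))
            where
            lem : ∀ a b c d → a + b + (c + d) ≡ (a + c) + (b + d)
            lem = solve-∀
          loop-eq : X + (weight po u + weight po z + weight po w) ≡ Y +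
              (weight pr u + weight pr z + weight pr w)
          loop-eq = trans (cong (X +_) (loop-weight po))
              (trans (sym (*-distribˡ-+ N (lookup xh i) _)) (trans (cong (N *_) (hom-eq i))
            (trans (*-distribˡ-+ N (lookup yh i) _) (cong (Y +_) (sym (loop-weight pr))))))
          total-eq : ∀ m → (y + m * Y) + weight pr (W m) ≡ (x + m * X) + weight po (W m)
          total-eq m = trans (cong (y + m * Y +_) (Pumping.weight-pumped pr po (λ a → pre≤1 a i) pr u s z
              w m))
            (trans (lem y m Y (weight pr s) _) (trans (sym (cong₂ (λ p q → p + m * q) s-eq loop-eq))
              (trans (sym (lem x m X (weight po s) _)) (cong (x + m * X +_)
                  (sym (Pumping.weight-pumped pr po (λ a → pre≤1 a i) po u s z w m))))))
            where
            lem : ∀ y m Y p q → y + m * Y + (p + m * q) ≡ (y + p) + m * (Y + q)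
            lem = solve-∀
          reassoc : ∀ b h m → b + h + m * (N * h) ≡ b + suc (m * N) * h
          reassoc b h m = trans (+-assoc b h _) (cong (λ q → b + (h + q)) (sym (*-assoc m N h)))
          forward : v i ≡ nothing → ∃ λ α → 1 ≤ α × Fire pr po u (x + X) (x + α)
          forward e with lookup xh i in eq
          ... | zero with fu i e eq
          ... | p , f , lb = p ∸ lookup xb i , m<n⇒0<n∸m lb
            , subst₂ (Fire pr po u) (trans (sym (+-identityʳ _))
                (cong₂ _+_ (sym (+-identityʳ _)) (sym (*-zeroʳ N))))
                (trans (sym (m+[n∸m]≡n (<⇒≤ lb))) (cong (_+ (p ∸ lookup xb i))
                    (sym (+-identityʳ (lookup xb i))))) f
          forward e | suc h with fire-long pr po (λ a → pre≤1 a i) u (lookup xb i + suc h + N * suc h)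
              (suc (lookup xb i + suc h))
            (≤-trans (≤-reflexive (+-comm (length u) (suc (lookup xb i + suc h))))
                (≤-trans (≤-reflexive (sym (+-suc (lookup xb i + suc h) (length u))))
                (+-monoʳ-≤ (lookup xb i + suc h)
              (≤-trans (s≤s (≤-trans (m≤m+n _ _) (m≤m+n _ (totalA E (addA E cu cw)))))
                  (≤-trans N₀≤ (m≤m*n N (suc h)))))))
          ... | n , f , lb = n ∸ (lookup xb i + suc h) , m<n⇒0<n∸m lb , subst (Fire pr po u _)
              (sym (m+[n∸m]≡n (<⇒≤ lb))) f
          backward : v i ≡ nothing → ∃ λ β → 1 ≤ β × Fire pr po w (y + β) (y + Y)
          backward e with lookup yh i in eq
          ... | zero with fw i e eq
          ... | p , f , lb = p ∸ lookup yb i , m<n⇒0<n∸m lb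
            , subst₂ (Fire pr po w) (trans (sym (m+[n∸m]≡n (<⇒≤ lb)))
                (cong (_+ (p ∸ lookup yb i)) (sym (+-identityʳ (lookup yb i)))))
                (trans (sym (+-identityʳ _)) (cong₂ _+_ (sym (+-identityʳ _)) (sym (*-zeroʳ N)))) f
          backward e | suc h with fire-long po pr (λ a → post≤1 a i) (reverse w)
              (lookup yb i + suc h + N * suc h) (suc (lookup yb i + suc h))
            (≤-trans (≤-reflexive (trans (cong (_+ suc (lookup yb i + suc h)) (length-reverse w))
                (+-comm (length w) (suc (lookup yb i + suc h)))))
                (≤-trans (≤-reflexive (sym (+-suc (lookup yb i + suc h) (length w))))
                (+-monoʳ-≤ (lookup yb i + suc h)
              (≤-trans (s≤s (≤-trans (m≤n+m _ (length u)) (m≤m+n _ (totalA E (addA E cu cw)))))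
                  (≤-trans N₀≤ (m≤m*n N (suc h)))))))
          ... | n , f , lb = n ∸ (lookup yb i + suc h) , m<n⇒0<n∸m lb
            , subst (λ q → Fire pr po w q _) (sym (m+[n∸m]≡n (<⇒≤ lb)))
                (subst (λ q → Fire pr po q _ _) (reverse-involutive w) (fire-reverse po pr (reverse w) f))
          fireAt : ∀ m → length s + length z ≤ m → ∀ c → v i ≡ c →
                 Fire pr po (W m) (lookup xb i + suc (m * N) * lookup xh i)
                     (lookup yb i + suc (m * N) * lookup yh i)
          fireAt m m₀≤ nothing e with forward e | backward e
          ... | α , 1≤α , f | β , 1≤β , g = subst₂ (Fire pr po (W m)) (reassoc (lookup xb i) _ m)
              (reassoc (lookup yb i) _ m)
            (Pumping.fire-pumped pr po (λ a → pre≤1 a i) u s z w x y X Y α β m f 1≤α g 1≤β s-eq loop-eq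
              (≤-trans (m≤m+n _ _) m₀≤) (≤-trans (m≤n+m _ (length s)) m₀≤))
          -- At a frozen coordinate typing lets the whole word fire, and the state equation
          -- identifies its final value.
          fireAt m m₀≤ (just c) e with Ty.typed-fires i {x = c} {s = st v E ε}
              (e , subst (λ q → Ty.TyA i q E) e (fr i) , refl) (W∈ m)
          ... | _ , _ , f = Pumping.fire-to pr po (λ a → pre≤1 a i) (W m)
            (subst (λ q → Fire pr po (W m) q _) (trans (sym start) (lookup-ray xb xh (suc (m * N)) i)) f)
            (trans (cong (_+ weight pr (W m)) (sym (reassoc (lookup yb i) _ m)))
                (trans (total-eq m) (cong (_+ weight po (W m)) (reassoc (lookup xb i) _ m))))
            where
            start : lookup (xb ⊞ scale (suc (m * N)) xh) i ≡ c
            start = subst (λ q → Matches {Λ} {d} q (lookup (xb ⊞ scale (suc (m * N)) xh) i)) e (matches m i)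

-- Deciding between pumping a star and bounding a coordinate

mask : Bool → (Λ → ℕ) → Λ → ℕ
mask true  f = f
mask false f = λ _ → 0

mask≤1 : ∀ b {f : Λ → ℕ} → (∀ a → f a ≤ 1) → ∀ a → mask b f a ≤ 1
mask≤1 true  p = p
mask≤1 false p = λ _ → z≤n

module Search {Λ : Set} {d : ℕ} (pr po : Λ → Fin d → ℕ) (pr≤1 : ∀ a i → pr a i ≤ 1) (po≤1 : ∀ a i → po a i ≤ 1) where

  private
    prᵢ poᵢ : Fin d → Λ → ℕ
    prᵢ i a = pr a i
    poᵢ i a = po a i

  Increasing : (Fin d → Bool) → Vec ℕ d → List Λ → Set
  Increasing I x u = ∀ i → I i ≡ true → ∃ λ p → Fire (prᵢ i) (poᵢ i) u (lookup x i) p × suc (lookup x i) ≤ p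

  SomeBounded : (Fin d → Bool) → ℕ → List Λ → Vec ℕ d → Set
  SomeBounded I B w M = ∃ λ i → I i ≡ true × ¬ Peak (prᵢ i) (poᵢ i) B w (lookup M i)

  Outcome : (Fin d → Bool) → Seq Λ d → Vec ℕ d → Set
  Outcome I s x =
    (∃ λ u → u ∈L s × Increasing I x u) ⊎
    (∃ λ B → ∀ {w} (M N : Vec ℕ d) → w ∈L s → (∀ i → Fire (prᵢ i) (poᵢ i) w (lookup M i) (lookup N i)) →
             (∀ i → I i ≡ true → lookup M i ≡ lookup x i) → SomeBounded I B w M)

  -- Finitely many candidates are tried. If all fail, no run that starts like x on `I` exceeds the
  -- bound at every coordinate of `I`, for `reach` would turn it into a successful candidate.
  -- Coordinates outside `I` are masked by a counter without effect and get goal 0, so they never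
  -- decide.
  search : ∀ I s x → Outcome I s x
  search I s x = decide (Any.any? (λ c → Finₚ.all? (λ i → fire-reach? (prᴵ i) (poᴵ i) c (lookup x i)
      (goal i))) candidates)
    where
    goal : Fin d → ℕ
    goal i = target (I i) where
      target : Bool → ℕ
      target true  = suc (lookup x i)
      target false = 0
    goal-false : ∀ i → I i ≡ false → goal i ≡ 0
    goal-false i e rewrite e = refl
    prᴵ poᴵ : Fin d → Λ → ℕ
    prᴵ i = mask (I i) (prᵢ i)
    poᴵ i = mask (I i) (poᵢ i)
    open Shortening (shorten d (λ a i → prᴵ i a) (λ a i → poᴵ i a) (λ a i → mask≤1 (I i) (λ a → pr≤1 a i) a)
                             (λ a i → mask≤1 (I i) (λ a → po≤1 a i) a) goal s)
    Good : List Λ → Set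
    Good c = ∀ i → ∃ λ z → Fire (prᴵ i) (poᴵ i) c (lookup x i) z × goal i ≤ z
    fire-idle : ∀ w m → Fire {Λ} (λ _ → 0) (λ _ → 0) w m m
    fire-idle []      m = refl
    fire-idle (_ ∷ w) m = m , refl , fire-idle w m
    decide : Dec (Any Good candidates) → Outcome I s x
    decide (yes any) with find any
    ... | u , u∈ , g = inj₁ (u , sound u∈ , λ i e → increase i e (g i))
      where
      increase : ∀ i → I i ≡ true → (∃ λ z → Fire (prᴵ i) (poᴵ i) u (lookup x i) z × goal i ≤ z) →
                 ∃ λ p → Fire (prᵢ i) (poᵢ i) u (lookup x i) p × suc (lookup x i) ≤ p
      increase i e g rewrite e = g
    decide (no none) = inj₂ (bound , λ {w} → bounded {w})
      where
      bounded : ∀ {w} (M N : Vec ℕ d) → w ∈L s → (∀ i → Fire (prᵢ i) (poᵢ i) w (lookup M i) (lookup N i)) →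
                (∀ i → I i ≡ true → lookup M i ≡ lookup x i) → SomeBounded I bound w M
      bounded {w} M N w∈ f agree with Finₚ.any? (λ i → (I i Boolₚ.≟ true) ×-dec ¬?
          (peak? (prᵢ i) (poᵢ i) bound w (lookup M i)))
      ... | yes (i , e , np) = i , e , np
      ... | no all-peak = ⊥-elim (none (lose c∈ good))
        where
        end : ∀ i b → I i ≡ b → ∃ λ n → Fire (mask b (prᵢ i)) (mask b (poᵢ i)) w (lookup x i) n
        end i true  e = lookup N i , subst (λ m → Fire (prᵢ i) (poᵢ i) w m (lookup N i)) (agree i e) (f i)
        end i false e = lookup x i , fire-idle w (lookup x i)
        N′ : Vec ℕ d
        N′ = tabulate λ i → proj₁ (end i (I i) refl)
        f′ : ∀ i → Fire (prᴵ i) (poᴵ i) w (lookup x i) (lookup N′ i)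
        f′ i = subst (Fire (prᴵ i) (poᴵ i) w (lookup x i)) (sym (lookup∘tabulate _ i))
            (proj₂ (end i (I i) refl))
        peaks : ∀ i b → I i ≡ b → Peak (mask b (prᵢ i)) (mask b (poᵢ i)) bound w (lookup x i) ⊎ goal i ≤
            lookup N′ i
        peaks i true  e = inj₁ (subst (Peak (prᵢ i) (poᵢ i) bound w) (agree i e)
          (decidable-stable (peak? (prᵢ i) (poᵢ i) bound w (lookup M i)) λ np → all-peak (i , e , np)))
        peaks i false e = inj₂ (subst (_≤ lookup N′ i) (sym (goal-false i e)) z≤n)
        result = reach x N′ w∈ f′ (λ i → peaks i (I i) refl)
        c∈ = proj₁ (proj₂ result)
        good = proj₂ (proj₂ result)

module StarCheck {Λ : Set} {d : ℕ} (pre post : Λ → Fin d → ℕ) (pre≤1 : ∀ a i → pre a i ≤ 1) (post≤1 : ∀ a i → post a i ≤ 1) where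
  open Machine pre post
  open Refine pre post
  open StarPump pre post pre≤1 post≤1

  relevant : Maybe ℕ → ℕ → Bool
  relevant nothing zero = true
  relevant _       _    = false

  relevant⁻ : ∀ m k → relevant m k ≡ true → m ≡ nothing × k ≡ 0
  relevant⁻ nothing zero _ = refl , refl

  Consistent : (b h M : Vec ℕ d) → Set
  Consistent b h M = ∀ i → lookup h i ≡ 0 → lookup M i ≡ lookup b i

  -- The second alternative covers only runs whose entry and exit values equal those of the base
  -- wherever the homogeneous solution is 0; for each run some base has this property by `agree`.
  Checked : ∀ {v E} → StarSystem v E → Set
  Checked {v} {E} S = (ForwardPump S × BackwardPump S) ⊎
    (∃ λ B → ∀ {w} M N → MatchesM v M → w ∈L st v E ε → FireM w M N →
       Consistent (StarSystem.xb S) (StarSystem.xh S) M → Consistent (StarSystem.yb S) (StarSystem.yh S) N →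
       ∃ λ t → t ∈ counterCases v E B × Run t M N)

  check : ∀ {v E} (S : StarSystem v E) → Frozen v E → Checked S
  check {v} {E} S fr = go (Search.search pre post pre≤1 post≤1 I (st v E ε) xb)
      (Search.search post pre post≤1 pre≤1 I′ (revS (st v E ε)) yb)
    where
    open StarSystem S
    I I′ : Fin d → Bool
    I i = relevant (v i) (lookup xh i)
    I′ i = relevant (v i) (lookup yh i)
    relevant-true : ∀ {m k} → m ≡ nothing → k ≡ 0 → relevant m k ≡ true
    relevant-true refl refl = refl
    go : Search.Outcome pre post pre≤1 post≤1 I (st v E ε) xb → Search.Outcome post pre post≤1 pre≤1 I′
        (revS (st v E ε)) yb → Checked S
    go (inj₂ (B , f)) _ = inj₂ (B , λ {w} M N m w∈ g cx cy →
      let i , e , np = f M N w∈ g (λ i e → cx i (proj₂ (relevant⁻ _ _ e)))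
      in counter-complete v E B fr M N m w∈ g i (proj₁ (relevant⁻ _ _ e)) np)
    -- A word decreasing to the exit is an increasing word of the reversed star with taking and
    -- putting exchanged. If there is none, a coordinate is bounded along the reversed run, which
    -- passes through the same values.
    go (inj₁ _) (inj₂ (B , f)) = inj₂ (B , λ {w} M N m w∈ g cx cy →
      let i , e , np = f N M (rev∈ w∈) (λ i → fire-reverse _ _ w (g i)) (λ i e → cy i (proj₂ (relevant⁻ _ _ e)))
      in counter-complete v E B fr M N m w∈ g i (proj₁ (relevant⁻ _ _ e))
          (λ p → np (peak-reverse _ _ B w (g i) p)))
    go (inj₁ (u , u∈ , f)) (inj₁ (w , w∈ , g)) = inj₁
      ( (u , u∈ , λ i e e′ → f i (relevant-true e e′))
      , (reverse w , unrev∈ (st v E ε) w∈ , λ i e e′ →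
          let p , fp , lb = g i (relevant-true e e′) in p , fire-reverse _ _ w fp , lb))

-- The characteristic system

pullback : ∀ {A B : Set} {MA : Module A} {MB : Module B} (f : A → B) →
           (∀ u v → f (Module._⊕_ MA u v) ≡ Module._⊕_ MB (f u) (f v)) → Eqn MB → Eqn MA
pullback f f-⊕ e = record
  { lhs = lhs ∘ f ; rhs = rhs ∘ f ; c = c ; c′ = c′
  ; lhs-add = λ u v → trans (cong lhs (f-⊕ u v)) (lhs-add (f u) (f v))
  ; rhs-add = λ u v → trans (cong rhs (f-⊕ u v)) (rhs-add (f u) (f v)) }
  where open Eqn e

all-family⁻ : ∀ {A : Set} {d} {P : A → Set} (f : Fin d → A) → All P (map f (allFin d)) → ∀ i → P (f i)
all-family⁻ f ps i = All.lookup ps (∈-map⁺ f (∈-allFin i))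

all-family : ∀ {A : Set} {d} {P : A → Set} (f : Fin d → A) → (∀ i → P (f i)) → All P (map f (allFin d))
all-family f p = Allₚ.map⁺ (All.universal p (allFin _))

module Decide {Λ : Set} {d : ℕ} (pre post : Λ → Fin d → ℕ) (pre≤1 : ∀ a i → pre a i ≤ 1) (post≤1 : ∀ a i → post a i ≤ 1) where
  open Machine pre post
  open Refine pre post
  open StarPump pre post pre≤1 post≤1
  open StarCheck pre post pre≤1 post≤1

  pre′ post′ : Fin d → Λ → ℕ
  pre′  i a = pre a i
  post′ i a = post a i

  -- The unknowns of the characteristic system: the markings reached after each item and,
  -- for each star, the multiplicities of its skeletons.
  Sol : Seq Λ d → Set
  Sol ε          = ⊤
  Sol (lt a s)   = Vec ℕ d × Vec ℕ d × Sol s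
  Sol (st v E s) = CA E × Vec ℕ d × Sol s

  Sol-module : ∀ s → Module (Sol s)
  Sol-module ε          = ⊤-module
  Sol-module (lt a s)   = Vec-module d ×-module Vec-module d ×-module Sol-module s
  Sol-module (st v E s) = CA-module E ×-module Vec-module d ×-module Sol-module s

  State : Seq Λ d → Set
  State s = Vec ℕ d × Sol s

  State-module : ∀ s → Module (State s)
  State-module s = Vec-module d ×-module Sol-module s

  SatS HomS : ∀ s → Vec ℕ d → State s → Set
  SatS ε          N (x , _)          = ∀ i → lookup x i ≡ lookup N i
  SatS (lt a s)   N (x , r , y , z)  = (∀ i → lookup x i ≡ lookup r i + pre a i) ×
      (∀ i → lookup y i ≡ lookup r i + post a i) × SatS s N (y , z)
  SatS (st v E s) N (x , n , y , z)  = (∀ i → lookup x i + weightA (post′ i) E n ≡ lookup y i + weightA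
      (pre′ i) E n)
                                     × (∀ i c → v i ≡ just c → lookup x i ≡ c) × SatS s N (y , z)
  HomS ε          N (x , _)          = ∀ i → lookup x i ≡ 0
  HomS (lt a s)   N (x , r , y , z)  = (∀ i → lookup x i ≡ lookup r i) × (∀ i → lookup y i ≡ lookup r i) ×
      HomS s N (y , z)
  HomS (st v E s) N (x , n , y , z)  = (∀ i → lookup x i + weightA (post′ i) E n ≡ lookup y i + weightA
      (pre′ i) E n)
                                     × (∀ i c → v i ≡ just c → lookup x i ≡ 0) × HomS s N (y , z)

  lookup-add : ∀ i (u v : Vec ℕ d) → lookup (u ⊞ v) i ≡ lookup u i + lookup v i
  lookup-add i u v = lookup-zipWith _+_ i u v

  valueEqn : ∀ {A} {MA : Module A} → (p q : A → ℕ) → Additive MA p → Additive MA q → ℕ → Eqn MA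
  valueEqn p q p-add q-add k = record { lhs = p ; rhs = q ; lhs-add = p-add ; rhs-add = q-add ; c = 0 ; c′
      = k }

  endEqn : ∀ s → Vec ℕ d → Fin d → Eqn (State-module s)
  endEqn s N i = valueEqn (λ (x , _) → lookup x i) (λ _ → 0) (λ (x , _) (x′ , _) → lookup-add i x x′)
      (λ _ _ → refl) (lookup N i)

  takeEqn putEqn : ∀ a s → Fin d → Eqn (State-module (lt a s))
  takeEqn a s i = valueEqn (λ (x , _) → lookup x i) (λ (_ , r , _) → lookup r i)
      (λ (x , _) (x′ , _) → lookup-add i x x′) (λ (_ , r , _) (_ , r′ , _) → lookup-add i r r′) (pre a i)
  putEqn  a s i = valueEqn (λ (_ , _ , y , _) → lookup y i) (λ (_ , r , _) → lookup r i)
      (λ (_ , _ , y , _) (_ , _ , y′ , _) → lookup-add i y y′)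
      (λ (_ , r , _) (_ , r′ , _) → lookup-add i r r′) (post a i)

  flowEqn : ∀ v E s → Fin d → Eqn (State-module (st v E s))
  flowEqn v E s i = valueEqn (λ (x , n , _) → lookup x i + weightA (post′ i) E n)
      (λ (_ , n , y , _) → lookup y i + weightA (pre′ i) E n)
    (λ (x , n , _) (x′ , n′ , _) → trans (cong₂ _+_ (lookup-add i x x′) (weightA-add (post′ i) E n n′))
        (interchange (lookup x i) (lookup x′ i) _ _))
    (λ (_ , n , y , _) (_ , n′ , y′ , _) → trans (cong₂ _+_ (lookup-add i y y′)
        (weightA-add (pre′ i) E n n′)) (interchange (lookup y i) (lookup y′ i) _ _)) 0

  frozenEqn : ∀ v E s → Fin d → Maybe ℕ → Eqn (State-module (st v E s))
  frozenEqn v E s i nothing  = valueEqn (λ _ → 0) (λ _ → 0) (λ _ _ → refl) (λ _ _ → refl) 0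
  frozenEqn v E s i (just c) = valueEqn (λ (x , _) → lookup x i) (λ _ → 0)
      (λ (x , _) (x′ , _) → lookup-add i x x′) (λ _ _ → refl) c

  rest : ∀ {A B C : Set} → A × B × C → C
  rest (_ , _ , z) = z

  -- The entry marking belongs to the state, so the system of the tail can be pulled back along
  -- `rest`, the marking after the first item becoming its entry. The actual start marking is
  -- imposed only in `decide-run`.
  equations : ∀ s → Vec ℕ d → List (Eqn (State-module s))
  equations ε          N = map (endEqn ε N) (allFin d)
  equations (lt a s)   N = map (takeEqn a s) (allFin d) ++
      (map (putEqn a s) (allFin d) ++ map (pullback rest (λ _ _ → refl)) (equations s N))
  equations (st v E s) N = map (flowEqn v E s) (allFin d) ++
      (map (λ i → frozenEqn v E s i (v i)) (allFin d) ++ map (pullback rest (λ _ _ → refl)) (equations s N))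

  sat⁺ : ∀ s N x → SatS s N x → All (Sat x) (equations s N)
  sat⁺ ε          N x p = all-family (endEqn ε N) (λ i → trans (+-identityʳ _) (p i))
  sat⁺ (lt a s)   N x (p , q , r) = Allₚ.++⁺ (all-family (takeEqn a s) (λ i → trans (+-identityʳ _) (p i)))
    (Allₚ.++⁺ (all-family (putEqn a s) (λ i → trans (+-identityʳ _) (q i)))
        (Allₚ.map⁺ (All.map id (sat⁺ s N (rest x) r))))
  sat⁺ (st v E s) N x (p , q , r) = Allₚ.++⁺ (all-family (flowEqn v E s) (λ i → cong (_+ 0) (p i)))
    (Allₚ.++⁺ (all-family (λ i → frozenEqn v E s i (v i)) (λ i → frozen i (v i) refl))
        (Allₚ.map⁺ (All.map id (sat⁺ s N (rest x) r))))
    where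
    frozen : ∀ i m → v i ≡ m → Sat x (frozenEqn v E s i m)
    frozen i nothing  e = refl
    frozen i (just c) e = trans (+-identityʳ _) (q i c e)

  sat⁻ : ∀ s N x → All (Sat x) (equations s N) → SatS s N x
  sat⁻ ε          N x p = λ i → trans (sym (+-identityʳ _)) (all-family⁻ (endEqn ε N) p i)
  sat⁻ (lt a s)   N x ps with Allₚ.++⁻ (map (takeEqn a s) (allFin d)) ps
  ... | p , ps′ with Allₚ.++⁻ (map (putEqn a s) (allFin d)) ps′
  ... | q , r = (λ i → trans (sym (+-identityʳ _)) (all-family⁻ (takeEqn a s) p i)) ,
      (λ i → trans (sym (+-identityʳ _)) (all-family⁻ (putEqn a s) q i))
              , sat⁻ s N (rest x) (All.map id (Allₚ.map⁻ r))
  sat⁻ (st v E s) N x ps with Allₚ.++⁻ (map (flowEqn v E s) (allFin d)) ps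
  ... | p , ps′ with Allₚ.++⁻ (map (λ i → frozenEqn v E s i (v i)) (allFin d)) ps′
  ... | q , r = (λ i → +-cancelʳ-≡ 0 _ _ (all-family⁻ (flowEqn v E s) p i)) ,
      (λ i c e → frozen i c (v i) e (all-family⁻ (λ i → frozenEqn v E s i (v i)) q i))
              , sat⁻ s N (rest x) (All.map id (Allₚ.map⁻ r))
    where
    frozen : ∀ i c m → m ≡ just c → Sat x (frozenEqn v E s i m) → lookup (proj₁ x) i ≡ c
    frozen i c .(just c) refl e = trans (sym (+-identityʳ _)) e

  hom⁻ : ∀ s N x → All (Hom x) (equations s N) → HomS s N x
  hom⁻ ε          N x p = all-family⁻ (endEqn ε N) p
  hom⁻ (lt a s)   N x ps with Allₚ.++⁻ (map (takeEqn a s) (allFin d)) ps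
  ... | p , ps′ with Allₚ.++⁻ (map (putEqn a s) (allFin d)) ps′
  ... | q , r = all-family⁻ (takeEqn a s) p , all-family⁻ (putEqn a s) q , hom⁻ s N (rest x)
      (All.map id (Allₚ.map⁻ r))
  hom⁻ (st v E s) N x ps with Allₚ.++⁻ (map (flowEqn v E s) (allFin d)) ps
  ... | p , ps′ with Allₚ.++⁻ (map (λ i → frozenEqn v E s i (v i)) (allFin d)) ps′
  ... | q , r = all-family⁻ (flowEqn v E s) p , (λ i c e → frozen i c (v i) e
      (all-family⁻ (λ i → frozenEqn v E s i (v i)) q i))
              , hom⁻ s N (rest x) (All.map id (Allₚ.map⁻ r))
    where
    frozen : ∀ i c m → m ≡ just c → Hom x (frozenEqn v E s i m) → lookup (proj₁ x) i ≡ 0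
    frozen i c .(just c) refl e = e

  solution : ∀ s {M N} → Run s M N → Sol s
  solution ε          r = tt
  solution (lt a s) {M} (M′ , f , r) = tabulate (λ i → proj₁ (f i)) , M′ , solution s r
  solution (st v E s)   (_ , w , M′ , w∈ , f , r) = proj₁ (count w∈) , M′ , solution s r

  word-weight : ∀ {v : Fin d → Maybe ℕ} {E : List (Seq Λ d)} {w} (φ : Λ → ℕ) (w∈ : w ∈L st v E ε) → weight
      φ w ≡ weightA φ E (proj₁ (count w∈))
  word-weight φ w∈ = trans (weight-count φ w∈) (+-identityʳ _)

  solution-sat : ∀ s {M N} (r : Run s M N) → SatS s N (M , solution s r)
  solution-sat ε refl = λ i → refl
  solution-sat (lt a s) (M′ , f , r) =
      (λ i → trans (proj₁ (proj₂ (f i))) (trans (+-comm (pre a i) _)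
          (cong (_+ pre a i) (sym (lookup∘tabulate _ i)))))
    , (λ i → trans (sym (proj₂ (proj₂ (f i)))) (trans (+-comm (post a i) _)
        (cong (_+ post a i) (sym (lookup∘tabulate _ i)))))
    , solution-sat s r
  solution-sat (st v E s) {M} (m , w , M′ , w∈ , f , r) =
      (λ i → trans (cong (lookup M i +_) (sym (word-weight {v} (post′ i) w∈)))
          (trans (sym (fire-effect _ _ w (f i))) (cong (lookup M′ i +_) (word-weight {v} (pre′ i) w∈))))
    , (λ i c e → subst (λ q → Matches {Λ} {d} q (lookup M i)) e (m i)) , solution-sat s r

  badTotal : ∀ s → (h x : Sol s) → ℕ
  badTotal ε          h x = 0
  badTotal (lt a s)   (_ , _ , h) (_ , _ , x) = badTotal s h x
  badTotal (st v E s) (n , _ , h) (k , _ , x) = badA E n k + badTotal s h x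

  badTotal-add : ∀ s h → Additive (Sol-module s) (badTotal s h)
  badTotal-add ε          h x y = refl
  badTotal-add (lt a s)   (_ , _ , h) (_ , _ , x) (_ , _ , y) = badTotal-add s h x y
  badTotal-add (st v E s) (n , _ , h) (k , _ , x) (l , _ , y) =
    trans (cong₂ _+_ (badA-add E n k l) (badTotal-add s h x y)) (interchange (badA E n k) (badA E n l) _ _)

  badTotal-self : ∀ s h → badTotal s h h ≡ 0
  badTotal-self ε          h = refl
  badTotal-self (lt a s)   (_ , _ , h) = badTotal-self s h
  badTotal-self (st v E s) (n , _ , h) = cong₂ _+_ (badA-self E n) (badTotal-self s h)

  Refinement : Seq Λ d → List (Seq Λ d) → Set
  Refinement s L = ∀ {t} → t ∈ L → t ≺ s × Good t × (∀ {M N} → Run t M N → Run s M N)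

  refine-lt : ∀ {a s L} → Refinement s L → Refinement (lt a s) (map (lt a) L)
  refine-lt {a} f t∈ with ∈-map⁻ (lt a) t∈
  ... | t , t∈′ , refl with f t∈′
  ... | p , g , r = lt p , g , λ (M′ , e , q) → M′ , e , r q

  refine-st : ∀ {v E s L} → Frozen v E → Refinement s L → Refinement (st v E s) (map (st v E) L)
  refine-st {v} {E} fr f t∈ with ∈-map⁻ (st v E) t∈
  ... | t , t∈′ , refl with f t∈′
  ... | p , g , r = st p , (fr , g) , λ (m , w , M′ , w∈ , e , q) → m , w , M′ , w∈ , e , r q

  refine-star : ∀ {v E s L} → Good s → (∀ {p} → p ∈ L → Valid v E p) → Refinement (st v E s) (map (_◇ s) L)
  refine-star {s = s} gs f t∈ with ∈-map⁻ (_◇ s) t∈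
  ... | p , p∈ , refl = replace smaller , Stars-◇ p good gs , λ r →
      let N , r₁ , r₂ = run-◇⁻ p r
          m , w , w∈ , g = refines r₁
      in m , w , N , w∈ , g , r₂
    where open Valid (f p∈)

  refine-++ : ∀ {s L L′} → Refinement s L → Refinement s L′ → Refinement s (L ++ L′)
  refine-++ {L = L} f g t∈ with ∈-++⁻ L t∈
  ... | inj₁ p = f p
  ... | inj₂ p = g p

  AllPos : ∀ s → Sol s → Set
  AllPos ε          h           = ⊤
  AllPos (lt a s)   (_ , _ , h) = AllPos s h
  AllPos (st v E s) (n , _ , h) = PosA E n × AllPos s h

  -- The property depends on the run and not merely on its end points, because it compares the
  -- multiplicities and intermediate markings of the run with a base solution.
  Property : Seq Λ d → Set₁
  Property s = ∀ M N → Run s M N → Set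

  Covering : ∀ s → Property s → Set
  Covering s P = ∃ λ L → Refinement s L × (∀ M N (r : Run s M N) → P M N r → ∃ λ t → t ∈ L × Run t M N)

  cover-lt : ∀ {a s} (P : Property s) (Q : Property (lt a s)) →
      (∀ M N M′ f r → Q M N (M′ , f , r) → P M′ N r) →
             Covering s P → Covering (lt a s) Q
  cover-lt {a} P Q imp (L , ref , c) = map (lt a) L , refine-lt ref , λ M N (M′ , e , r) q →
    let t , t∈ , r′ = c M′ N r (imp M N M′ e r q) in lt a t , ∈-map⁺ (lt a) t∈ , M′ , e , r′

  cover-st : ∀ {v E s} → Frozen v E → (P : Property s) (Q : Property (st v E s)) →
             (∀ M N m w M′ w∈ f r → Q M N (m , w , M′ , w∈ , f , r) → P M′ N r) → Covering s P → Covering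
                 (st v E s) Q
  cover-st {v} {E} fr P Q imp (L , ref , c) = map (st v E) L , refine-st fr ref , λ M N
      (m , w , M′ , w∈ , e , r) q →
    let t , t∈ , r′ = c M′ N r (imp M N m w M′ w∈ e r q) in st v E t , ∈-map⁺ (st v E) t∈ , m , w , M′ , w∈ , e , r′

  BadAtMost : ℕ → ∀ s → Sol s → Property s
  BadAtMost K s h M N r = badTotal s h (solution s r) ≤ K

  cover-unused : ∀ K s → Good s → (h : Sol s) → AllPos s h ⊎ Covering s (BadAtMost K s h)
  cover-unused K ε          g        h = inj₁ tt
  cover-unused K (lt a s)   g        h₀@(_ , _ , h) =
    Sum.map id (cover-lt (BadAtMost K s h) (BadAtMost K (lt a s) h₀) (λ _ _ _ _ _ q → q))
        (cover-unused K s g h)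
  cover-unused K (st v E s) (fr , g) h₀@(n , _ , h) with pos-or-shrinksA E n
  ... | inj₁ p = Sum.map (p ,_) (cover-st fr (BadAtMost K s h) (BadAtMost K (st v E s) h₀)
      (λ _ _ _ _ _ _ _ _ → ≤-trans (m≤n+m _ _))) (cover-unused K s g h)
  ... | inj₂ shrinks = inj₂ (map (_◇ s) ps , refine-star g (unroll-valid K v E n fr shrinks) , covers)
    where
    ps = iterations v (cleanA E n) (Unroll.unrollA K E n) K
    covers : ∀ M N (r : Run (st v E s) M N) → BadAtMost K (st v E s) h₀ M N r → ∃ λ t → t ∈ map (_◇ s) ps
        × Run t M N
    covers M N (m , w , M′ , w∈ , f , r) b with Unroll.unroll-complete-star K {s = ε} n tt w∈ K ≤-refl
        (≤-trans (m≤m+n _ _) b) z≤n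
    ... | w₁ , .[] , refl , (p , p∈ , w₁∈) , (_ , here refl , empty) = p ◇ s , ∈-map⁺ (_◇ s) p∈ , run-◇ p
      (word→run p M M′ (λ i → Ty.iterations-typed i K v E n refl (fr i) K p∈) m
          (subst (_∈L p) (sym (++-identityʳ w₁)) w₁∈) f) r

  Agree : ∀ s → (h b x : State s) → Set
  Agree s h b x = ∀ π → Additive (State-module s) π → π h ≡ 0 → π x ≡ π b

  Agrees : ∀ s → (h b : State s) → Property s
  Agrees s h b M N r = Agree s h b (M , solution s r)

  system : ∀ v E s N (b h : State (st v E s)) → SatS (st v E s) N b → HomS (st v E s) N h → StarSystem v E
  system v E s N (x , n , y , z) (xh , nh , yh , zh) (sx , sm , _) (hx , hm , _) = record
    { xb = x ; yb = y ; xh = xh ; yh = yh ; nb = n ; nh = nh ; base-eq = sx ; hom-eq = hx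
    ; base-match = λ i → match i (v i) refl ; hom-match = hm }
    where
    match : ∀ i m → v i ≡ m → Matches {Λ} {d} m (lookup x i)
    match i nothing  e = tt
    match i (just c) e = sm i c e

  Pumped : ∀ s → Vec ℕ d → (b h : State s) → Set
  Pumped s N (x , _) (xh , _) = ∃ λ N₀ → ∀ k → N₀ ≤ k → ∃ λ m₀ → ∀ m → m₀ ≤ m → Run s
      (x ⊞ scale (suc (m * k)) xh) N

  pump-or-cover : ∀ s N → Good s → (b h : State s) → SatS s N b → HomS s N h → AllPos s (proj₂ h) →
                  Pumped s N b h ⊎ Covering s (Agrees s h b)
  pump-or-cover ε N g (x , _) (xh , _) sat hom pos = inj₁ (0 , λ k _ → 0 , λ m _ →
    lookup-ext {M = x ⊞ scale (suc (m * k)) xh} {N} λ i → trans (lookup-ray x xh (suc (m * k)) i)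
      (trans (cong (λ q → lookup x i + suc (m * k) * q) (hom i))
          (trans (cong (lookup x i +_) (*-zeroʳ (suc (m * k)))) (trans (+-identityʳ _) (sat i)))))
  pump-or-cover (lt a s) N g (x , r , y , z) (xh , rh , yh , zh) (sx , sy , sat) (hx , hy , hom) pos
    with pump-or-cover s N g (y , z) (yh , zh) sat hom pos
  ... | inj₁ (N₀ , f) = inj₁ (N₀ , λ k k≤ → let m₀ , f′ = f k k≤ in m₀ , λ m m≤ → _ , fireAt k m , f′ m m≤)
    where
    fireAt : ∀ k m → FireM (a ∷ []) (x ⊞ scale (suc (m * k)) xh) (y ⊞ scale (suc (m * k)) yh)
    fireAt k m i = lookup r i + suc (m * k) * lookup rh i
      , trans (lookup-ray x xh (suc (m * k)) i) (trans (cong₂ (λ p q → p + suc (m * k) * q) (sx i) (hx i))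
          (lem (lookup r i) (pre a i) _))
      , sym (trans (lookup-ray y yh (suc (m * k)) i) (trans
          (cong₂ (λ p q → p + suc (m * k) * q) (sy i) (hy i)) (lem (lookup r i) (post a i) _)))
      where
      lem : ∀ r p q → r + p + q ≡ p + (r + q)
      lem = solve-∀
  ... | inj₂ c = inj₂ (cover-lt (Agrees s (yh , zh) (y , z))
      (Agrees (lt a s) (xh , rh , yh , zh) (x , r , y , z))
                        (λ _ _ _ _ _ q π π-add → q (π ∘ rest) (λ (_ , _ , u) (_ , _ , v) → π-add u v)) c)
  pump-or-cover (st v E s) N (fr , g) b@(x , n , y , z) h@(xh , nh , yh , zh) ss@(_ , _ , sat)
      hs@(_ , _ , hom) (p , pos)
    with check (system v E s N b h ss hs) fr
  ... | inj₂ (B , f) = inj₂ (map (_◇ s) (counterCases v E B) , refine-star g (counter-valid v E B fr) , λ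
      M N (m , w , M′ , w∈ , e , r) q →
      let t , t∈ , r′ = f M M′ m w∈ e (λ i z → q (λ (x , _) → lookup x i) (λ (x , _) (x′ , _) → lookup-add i x x′) z)
                                      (λ i z → q (λ (_ , _ , y , _) → lookup y i)
                                          (λ (_ , _ , y , _) (_ , _ , y′ , _) → lookup-add i y y′) z)
      in t ◇ s , ∈-map⁺ (_◇ s) t∈ , run-◇ t r′ r)
  ... | inj₁ (fp , bp) with pump-or-cover s N g (y , z) (yh , zh) sat hom pos
  ... | inj₂ c = inj₂ (cover-st fr (Agrees s (yh , zh) (y , z))
      (Agrees (st v E s) (xh , nh , yh , zh) (x , n , y , z))
                        (λ _ _ _ _ _ _ _ _ q π π-add → q (π ∘ rest)
                            (λ (_ , _ , u) (_ , _ , v) → π-add u v)) c)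
  ... | inj₁ (N₁ , f) with star-pump (system v E s N b h ss hs) p fr fp bp
  ... | N₀ , f₀ = inj₁ (N₀ + N₁ , λ k k≤ →
      let m₀ , g₀ = f₀ k (≤-trans (m≤m+n N₀ N₁) k≤)
          m₁ , g₁ = f k (≤-trans (m≤n+m N₁ N₀) k≤)
      in m₀ + m₁ , λ m m≤ →
        let mt , w , w∈ , e = g₀ m (≤-trans (m≤m+n m₀ m₁) m≤)
        in mt , w , _ , w∈ , e , g₁ m (≤-trans (m≤n+m m₁ m₀) m≤))

  any-run : ∀ L {M N} → (∀ {t} → t ∈ L → Dec (Run t M N)) → Dec (∃ λ t → t ∈ L × Run t M N)
  any-run []      f = no λ ()
  any-run (t ∷ L) f with f (here refl) | any-run L (f ∘ there)
  ... | yes r | _                 = yes (t , here refl , r)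
  ... | no _  | yes (u , u∈ , r)  = yes (u , there u∈ , r)
  ... | no ¬r | no ¬rs            = no λ { (_ , here refl , r) → ¬r r ; (u , there u∈ , r) → ¬rs
      (u , u∈ , r) }

  AgreesSome : ∀ s → State s → List (State s) → Property s
  AgreesSome s h bs M N r = ∃ λ b → b ∈ bs × Agrees s h b M N r

  -- A run is known to agree with some base, but not with which. One base that can be pumped already
  -- settles the question positively; a cover of all runs is assembled when every base yields its
  -- own.
  pump-or-cover-all : ∀ s N → Good s → (h : State s) → HomS s N h → AllPos s (proj₂ h) →
      (bs : List (State s)) → All (SatS s N) bs →
                      (∃ λ b → b ∈ bs × Pumped s N b h) ⊎ Covering s (AgreesSome s h bs)
  pump-or-cover-all s N g h hom pos []       []           = inj₂ ([] , (λ ()) , λ { M N r (_ , () , _) })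
  pump-or-cover-all s N g h hom pos (b ∷ bs) (sat ∷ sats) with pump-or-cover s N g b h sat hom pos |
      pump-or-cover-all s N g h hom pos bs sats
  ... | inj₁ p                | _                      = inj₁ (b , here refl , p)
  ... | inj₂ _                | inj₁ (b′ , b∈ , p)     = inj₁ (b′ , there b∈ , p)
  ... | inj₂ (L , ref , c)    | inj₂ (L′ , ref′ , c′)  = inj₂ (L ++ L′ , refine-++ ref ref′ , covers)
    where
    covers : ∀ M N (r : Run s M N) → AgreesSome s h (b ∷ bs) M N r → ∃ λ t → t ∈ L ++ L′ × Run t M N
    covers M N r (_ , here refl , q) = let t , t∈ , r′ = c M N r q in t , ∈-++⁺ˡ t∈ , r′
    covers M N r (b , there b∈ , q)  = let t , t∈ , r′ = c′ M N r (b , b∈ , q) in t , ∈-++⁺ʳ L t∈ , r′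

  startEqn : ∀ s → Vec ℕ d → Fin d → Eqn (State-module s)
  startEqn s M i = valueEqn (λ (x , _) → lookup x i) (λ _ → 0) (λ (x , _) (x′ , _) → lookup-add i x x′)
      (λ _ _ → refl) (lookup M i)

  -- Either the characteristic system forces a finite refinement into smaller sequences, or its
  -- solutions can be pumped up to an actual run.
  decide-run : ∀ s → Acc _≺_ s → Good s → ∀ M N → Dec (Run s M N)
  decide-run s (acc smaller) g M N = conclude (cover-unused K s g hs)
    where
    open Solution (solve (State-module s) (map (startEqn s M) (allFin d) ++ equations s N))
    starts = map (startEqn s M) (allFin d)
    xh = proj₁ direction
    hs = proj₂ direction
    -- `badTotal` vanishes on the direction, so its value on any run is its value on some base.
    K = maxOver (λ (_ , z) → badTotal s hs z) bases
    homS : HomS s N direction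
    homS = hom⁻ s N direction (proj₂ (Allₚ.++⁻ starts hom))
    -- The start marking is prescribed by equations of the system, so adding multiples of the
    -- direction does not move it.
    xh≡0 : ∀ i → lookup xh i ≡ 0
    xh≡0 = all-family⁻ (startEqn s M) (proj₁ (Allₚ.++⁻ starts hom))
    run-agrees : (r : Run s M N) → AgreesSome s direction bases M N r
    run-agrees r = agree (M , solution s r) (Allₚ.++⁺ (all-family (startEqn s M) (λ i → +-identityʳ _))
        (sat⁺ s N (M , solution s r) (solution-sat s r)))
    by-cover : (P : Property s) → (∀ r → P M N r) → Covering s P → Dec (Run s M N)
    by-cover P p (L , ref , c) = map′ (λ (t , t∈ , r) → proj₂ (proj₂ (ref t∈)) r) (λ r → c M N r (p r))
      (any-run L λ {t} t∈ → decide-run t (smaller (proj₁ (ref t∈))) (proj₁ (proj₂ (ref t∈))) M N)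
    few-bad : ∀ r → BadAtMost K s hs M N r
    few-bad r with run-agrees r
    ... | b , b∈ , q = ≤-trans (≤-reflexive (q (λ (_ , z) → badTotal s hs z)
        (λ (_ , z) (_ , z′) → badTotal-add s hs z z′) (badTotal-self s hs)))
                               (≤-maxOver (λ (_ , z) → badTotal s hs z) b∈)
    from-pump : ∀ {b} → b ∈ bases → Pumped s N b direction → Run s M N
    from-pump {b} b∈ (N₀ , f) with f N₀ ≤-refl
    ... | m₀ , f′ = subst (λ x → Run s x N) start (f′ m₀ ≤-refl)
      where
      start : proj₁ b ⊞ scale (suc (m₀ * N₀)) xh ≡ M
      start = lookup-ext {M = proj₁ b ⊞ scale (suc (m₀ * N₀)) xh} {M} λ i → trans
          (lookup-ray (proj₁ b) xh (suc (m₀ * N₀)) i)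
        (trans (cong (λ q → lookup (proj₁ b) i + suc (m₀ * N₀) * q) (xh≡0 i))
            (trans (cong (lookup (proj₁ b) i +_) (*-zeroʳ (suc (m₀ * N₀))))
          (all-family⁻ (startEqn s M) (proj₁ (Allₚ.++⁻ starts (All.lookup bases-sat b∈))) i)))
    conclude : AllPos s hs ⊎ Covering s (BadAtMost K s hs) → Dec (Run s M N)
    conclude (inj₂ c) = by-cover (BadAtMost K s hs) few-bad c
    conclude (inj₁ pos) with pump-or-cover-all s N g direction homS pos bases
        (All.map (λ sat → sat⁻ s N _ (proj₂ (Allₚ.++⁻ starts sat))) bases-sat)
    ... | inj₁ (b , b∈ , p) = yes (from-pump b∈ p)
    ... | inj₂ c            = by-cover (AgreesSome s direction bases) run-agrees c

  decide : ∀ s → Good s → ∀ M N → Dec (Run s M N)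
  decide s = decide-run s (≺-wellFounded s)

-- Place/transition nets

least : {P : ℕ → Set} → Decidable P → ∀ n → P n → ∃ λ k → P k × (∀ k′ → P k′ → k ≤ k′)
least {P} P? n = go n (<-wellFounded n)
  where
  go : ∀ n → Acc _<_ n → P n → ∃ λ k → P k × (∀ k′ → P k′ → k ≤ k′)
  go n (acc rs) p with anyUpTo? P? n
  ... | yes (m , m<n , q) = go m (rs m<n) q
  ... | no none           = n , p , λ k q → ≮⇒≥ λ k<n → none (k , k<n , q)

b2n≤1 : ∀ x → b2n x ≤ 1
b2n≤1 true  = ≤-refl
b2n≤1 false = z≤n

wordsUpTo : ∀ n → ℕ → List (List (Fin n))
wordsUpTo n zero    = [] ∷ []
wordsUpTo n (suc k) = [] ∷ cartesianProductWith _∷_ (allFin n) (wordsUpTo n k)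

wordsUpTo-length : ∀ {n} k {w} → w ∈ wordsUpTo n k → length w ≤ k
wordsUpTo-length zero    (here refl) = z≤n
wordsUpTo-length (suc k) (here refl) = z≤n
wordsUpTo-length {n} (suc k) (there w∈) with ∈-cartesianProductWith⁻ _∷_ (allFin n) (wordsUpTo n k) w∈
... | _ , _ , _ , w∈′ , refl = s≤s (wordsUpTo-length k w∈′)

wordsUpTo-complete : ∀ {n} k w → length w ≤ k → w ∈ wordsUpTo n k
wordsUpTo-complete zero    []      z≤n     = here refl
wordsUpTo-complete (suc k) []      z≤n     = here refl
wordsUpTo-complete (suc k) (a ∷ w) (s≤s p) = there (∈-cartesianProductWith⁺ _∷_ (∈-allFin a)
    (wordsUpTo-complete k w p))

letters : ∀ {Λ : Set} {d} → List Λ → List (Seq Λ d)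
letters = map (λ a → lt a ε)

anyWord : ∀ {Λ : Set} {d} → List Λ → Seq Λ d → Seq Λ d
anyWord as = st (λ _ → nothing) (letters as)

anyWord∈ : ∀ {Λ : Set} {d} {as : List Λ} {s : Seq Λ d} w → (∀ {a} → a ∈ w → a ∈ as) → [] ∈L s → w ∈L
    anyWord as s
anyWord∈ []      f e = stop e
anyWord∈ (a ∷ w) f e = loop (∈-map⁺ _ (f (here refl))) (cons empty) (anyWord∈ w (f ∘ there) e) refl

anyWord⁻ : ∀ {Λ : Set} {d} {as : List Λ} {w} → w ∈L anyWord {d = d} as ε → ∀ {a} → a ∈ w → a ∈ as
anyWord⁻ (stop empty) ()
anyWord⁻ (loop e∈ m m′ refl) a∈ with ∈-map⁻ _ e∈
anyWord⁻ (loop e∈ (cons empty) m′ refl) (here refl) | _ , b∈ , refl = b∈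
anyWord⁻ (loop e∈ (cons empty) m′ refl) (there a∈)  | _ , b∈ , refl = anyWord⁻ m′ a∈

fire-map : ∀ {A B : Set} (f : A → B) (pr po : B → ℕ) w {m n} → Fire (pr ∘ f) (po ∘ f) w m n → Fire pr po
    (map f w) m n
fire-map f pr po []      e            = e
fire-map f pr po (a ∷ w) (r , e , g) = r , e , fire-map f pr po w g

fire-map⁻ : ∀ {A B : Set} (f : A → B) (pr po : B → ℕ) w {m n} → Fire pr po (map f w) m n → Fire (pr ∘ f)
    (po ∘ f) w m n
fire-map⁻ f pr po []      e            = e
fire-map⁻ f pr po (a ∷ w) (r , e , g) = r , e , fire-map⁻ f pr po w g

fire-sinks : ∀ {Λ : Set} (pr po : Λ → ℕ) w n → (∀ {a} → a ∈ w → po a ≡ 0) → Fire pr po w (weight pr w + n) n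
fire-sinks pr po []      n z = refl
fire-sinks pr po (a ∷ w) n z = weight pr w + n , +-assoc (pr a) _ n
  , subst (λ k → Fire pr po w (k + (weight pr w + n)) n) (sym (z (here refl)))
      (fire-sinks pr po w n (z ∘ there))

weight-zero : ∀ {Λ : Set} (φ : Λ → ℕ) w → (∀ {a} → a ∈ w → φ a ≡ 0) → weight φ w ≡ 0
weight-zero φ []      z = refl
weight-zero φ (a ∷ w) z = cong₂ _+_ (z (here refl)) (weight-zero φ w (z ∘ there))

module Truncation {Λ : Set} (pr po : Λ → ℕ) (pr≤1 : ∀ a → pr a ≤ 1) where

  Firable₁ : List Λ → ℕ → Set
  Firable₁ w m = ∃ λ n → Fire pr po w m n

  -- A letter takes at most one token from a place, so C tokens suffice for a word of length at most
  -- C.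
  truncate : ∀ {C} w m → length w ≤ C → Firable₁ w m → Firable₁ w (m ⊓ C)
  truncate {C} w m le f with ≤-total m C
  ... | inj₁ m≤C rewrite m≤n⇒m⊓n≡m m≤C = f
  ... | inj₂ C≤m rewrite m≥n⇒m⊓n≡n C≤m =
    let n , g , _ = fire-long pr po pr≤1 w C 0 (subst (_≤ C) (sym (+-identityʳ _)) le) in n , g

  untruncate : ∀ {C} w m → Firable₁ w (m ⊓ C) → Firable₁ w m
  untruncate {C} w m (n , f) = _ , subst (λ k → Fire pr po w k ((m ∸ m ⊓ C) + n)) (m∸n+n≡m (m⊓n≤m m C))
      (fire-mono pr po w (m ∸ m ⊓ C) f)

module PetriNet (S : Net) where

  |P| = np S
  T = Fin (nt S)

  takes puts : Fin |P| → T → ℕ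
  takes p t = b2n (pre S t p)
  puts  p t = b2n (post S t p)

  takes≤1 : ∀ p t → takes p t ≤ 1
  takes≤1 p t = b2n≤1 (pre S t p)

  puts≤1 : ∀ p t → puts p t ≤ 1
  puts≤1 p t = b2n≤1 (post S t p)

  FireP : Fin |P| → List T → ℕ → ℕ → Set
  FireP p = Fire (takes p) (puts p)

  fires⇒fire : ∀ {M w M′} → Fires S M w M′ → ∀ p → FireP p w (M p) (M′ p)
  fires⇒fire fires-ε p = refl
  fires⇒fire (fires-∷ {M} {a} {w} {M″} en f) p = M p ∸ takes p a , sym (m+[n∸m]≡n (en p))
    , subst (λ k → FireP p w k (M″ p)) (+-comm _ (puts p a)) (fires⇒fire f p)

  fire⇒fires : ∀ w M → (∀ p → ∃ λ n → FireP p w (M p) n) → Firable S M w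
  fire⇒fires []      M f = M , fires-ε
  fire⇒fires (a ∷ w) M f = let M′ , g = fire⇒fires w (fire S M a) rest′ in M′ , fires-∷ enabled g
    where
    enabled : Enabled S M a
    enabled p with f p
    ... | n , r , e , g = subst (takes p a ≤_) (sym e) (m≤m+n _ r)
    rest′ : ∀ p → ∃ λ n → FireP p w (fire S M a p) n
    rest′ p with f p
    ... | n , r , e , g = n , subst (λ k → FireP p w k n)
      (trans (+-comm (puts p a) r) (cong (_+ puts p a) (trans (sym (m+n∸m≡n (takes p a) r))
          (cong (_∸ takes p a) (sym e))))) g

  firable? : ∀ M w → Dec (Firable S M w)
  firable? M w = map′ (fire⇒fires w M) (λ (M′ , f) p → M′ p , fires⇒fire f p)
      (Finₚ.all? λ p → fire? (takes p) (puts p) w (M p))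

  enabled? : ∀ M a → Dec (Enabled S M a)
  enabled? M a = Finₚ.all? λ p → takes p a ≤? M p

  trunc : ℕ → Marking S → Marking S
  trunc C M p = M p ⊓ C

  firable-trunc : ∀ {C} M w → length w ≤ C → Firable S M w → Firable S (trunc C M) w
  firable-trunc {C} M w le (M′ , f) = fire⇒fires w (trunc C M) λ p → Truncation.truncate (takes p)
      (puts p) (takes≤1 p) w (M p) le (M′ p , fires⇒fire f p)

  firable-untrunc : ∀ {C} M w → Firable S (trunc C M) w → Firable S M w
  firable-untrunc {C} M w (M′ , f) = fire⇒fires w M λ p → Truncation.untruncate (takes p) (puts p)
      (takes≤1 p) w (M p) (M′ p , fires⇒fire f p)

  enabled-trunc : ∀ {C} M a → 1 ≤ C → Enabled S M a → Enabled S (trunc C M) a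
  enabled-trunc M a 1≤C en p = ⊓-glb (en p) (≤-trans (takes≤1 p a) 1≤C)

  firable-cong : ∀ {M M′} w → (∀ p → M p ≡ M′ p) → Firable S M w → Firable S M′ w
  firable-cong {M} {M′} w e (N , f) = fire⇒fires w M′ λ p → N p , subst (λ m → FireP p w m (N p)) (e p)
      (fires⇒fire f p)

  -- inj₂ p is a sink removing one token from p: M lies in the truncation class of τ iff
  -- sinks at the saturated places lead from M to τ.
  Letter : Set
  Letter = T ⊎ Fin |P|

  δ : Fin |P| → Fin |P| → ℕ
  δ q p with q Finₚ.≟ p
  ... | yes _ = 1
  ... | no  _ = 0

  δ-same : ∀ p → δ p p ≡ 1
  δ-same p with p Finₚ.≟ p
  ... | yes _ = refl
  ... | no ¬e = ⊥-elim (¬e refl)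

  δ-other : ∀ {q p} → q ≢ p → δ q p ≡ 0
  δ-other {q} {p} q≢p with q Finₚ.≟ p
  ... | yes e = ⊥-elim (q≢p e)
  ... | no  _ = refl

  pre⁺ post⁺ : Letter → Fin |P| → ℕ
  pre⁺ (inj₁ t) p = takes p t
  pre⁺ (inj₂ q) p = δ q p
  post⁺ (inj₁ t) p = puts p t
  post⁺ (inj₂ q) p = 0

  pre⁺≤1 : ∀ a p → pre⁺ a p ≤ 1
  pre⁺≤1 (inj₁ t) p = takes≤1 p t
  pre⁺≤1 (inj₂ q) p with q Finₚ.≟ p
  ... | yes _ = ≤-refl
  ... | no  _ = z≤n

  post⁺≤1 : ∀ a p → post⁺ a p ≤ 1
  post⁺≤1 (inj₁ t) p = puts≤1 p t
  post⁺≤1 (inj₂ q) p = z≤n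

  open Machine pre⁺ post⁺
  open Decide pre⁺ post⁺ pre⁺≤1 post⁺≤1 using (decide)

  letters-frozen : ∀ as → Frozen (λ _ → nothing) (letters as)
  letters-frozen as i = Ty.TyA-tabulate i (letters as) λ e∈ → case ∈-map⁻ _ e∈ of λ
      { (a , _ , refl) → nothing , tt , refl }

  ReachesClass : ℕ → Vec ℕ |P| → Set
  ReachesClass C τ = ∃ λ M → Reachable S M × (∀ p → M p ⊓ C ≡ lookup τ p)

  module _ (C : ℕ) (τ : Vec ℕ |P|) (τ≤C : ∀ p → lookup τ p ≤ C) where

    sinks : List Letter
    sinks = map inj₂ (filter (λ p → lookup τ p ≟ C) (allFin |P|))

    problem : Seq Letter |P|
    problem = anyWord (map inj₁ (allFin (nt S))) (anyWord sinks ε)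

    M₀ᵛ : Vec ℕ |P|
    M₀ᵛ = tabulate (M₀ S)

    only-transitions : ∀ (w : List Letter) → (∀ {a} → a ∈ w → a ∈ map inj₁ (allFin (nt S))) → ∃ λ u → w ≡
        map inj₁ u
    only-transitions []      f = [] , refl
    only-transitions (a ∷ w) f with ∈-map⁻ inj₁ (f (here refl)) | only-transitions w (f ∘ there)
    ... | t , _ , refl | u , refl = t ∷ u , refl

    sink-full : ∀ {q} → inj₂ q ∈ sinks → lookup τ q ≡ C
    sink-full q∈ with ∈-map⁻ inj₂ q∈
    ... | q , q∈′ , refl = proj₂ (∈-filter⁻ (λ p → lookup τ p ≟ C) {xs = allFin |P|} q∈′)

    sink-post : ∀ {a} → a ∈ sinks → ∀ p → post⁺ a p ≡ 0
    sink-post a∈ p with ∈-map⁻ inj₂ a∈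
    ... | q , _ , refl = refl

    sink-pre : ∀ {a} → a ∈ sinks → ∀ p → lookup τ p ≢ C → pre⁺ a p ≡ 0
    sink-pre a∈ p ne with ∈-map⁻ inj₂ a∈
    ... | q , _ , refl = δ-other λ { refl → ne (sink-full a∈) }

    run⇒class : Run problem M₀ᵛ τ → ReachesClass C τ
    run⇒class (_ , w , M , w∈ , f , _ , w′ , M′ , w′∈ , f′ , refl) with only-transitions w (anyWord⁻ w∈)
    ... | u , refl = proj₁ firing , (u , proj₂ firing) , λ p → trans (cong (_⊓ C) (end p)) (class p)
      where
      fireU : ∀ p → FireP p u (M₀ S p) (lookup M p)
      fireU p = subst (λ m → FireP p u m (lookup M p)) (lookup∘tabulate (M₀ S) p) (fire-map⁻ inj₁ _ _ u (f p))
      firing : Firable S (M₀ S) u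
      firing = fire⇒fires u (M₀ S) λ p → lookup M p , fireU p
      end : ∀ p → proj₁ firing p ≡ lookup M p
      end p = fire-deterministic _ _ u (fires⇒fire (proj₂ firing) p) (fireU p)
      balance : ∀ p → lookup τ p + weight (λ a → pre⁺ a p) w′ ≡ lookup M p
      balance p = trans (fire-effect _ _ w′ (f′ p)) (trans
          (cong (lookup M p +_) (weight-zero _ w′ λ a∈ → sink-post (anyWord⁻ w′∈ a∈) p)) (+-identityʳ _))
      class : ∀ p → lookup M p ⊓ C ≡ lookup τ p
      class p with lookup τ p ≟ C
      -- At a saturated place sinks only remove tokens, so M has at least C of them there; at any
      -- other place no sink acts and the value is exact.
      ... | yes e = trans (m≥n⇒m⊓n≡n (subst (_≤ lookup M p) e
          (subst (lookup τ p ≤_) (balance p) (m≤m+n _ _)))) (sym e)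
      ... | no ne = trans (cong (_⊓ C) (trans (sym (balance p))
          (trans (cong (lookup τ p +_) (weight-zero _ w′ λ a∈ → sink-pre (anyWord⁻ w′∈ a∈) p ne))
          (+-identityʳ _))))
                          (m≤n⇒m⊓n≡m (τ≤C p))

    drain : (Fin |P| → ℕ) → List (Fin |P|) → List Letter
    drain e []       = []
    drain e (q ∷ qs) = power (e q) (inj₂ q ∷ []) ++ drain e qs

    drain-weight-∉ : ∀ e p qs → ¬ p ∈ qs → weight (λ a → pre⁺ a p) (drain e qs) ≡ 0
    drain-weight-∈ : ∀ e p qs → Unique qs → p ∈ qs → weight (λ a → pre⁺ a p) (drain e qs) ≡ e p
    step-weight : ∀ e p q → weight (λ a → pre⁺ a p) (power (e q) (inj₂ q ∷ [])) ≡ e q * δ q p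
    step-weight e p q = trans (weight-power _ (e q) _) (cong (e q *_) (+-identityʳ (δ q p)))
    drain-weight-∉ e p []       ∉ = refl
    drain-weight-∉ e p (q ∷ qs) ∉ = trans (weight-++ _ (power (e q) (inj₂ q ∷ [])) _) (cong₂ _+_
      (trans (step-weight e p q) (trans (cong (e q *_) (δ-other λ { refl → ∉ (here refl) }))
          (*-zeroʳ (e q)))) (drain-weight-∉ e p qs (∉ ∘ there)))
    drain-weight-∈ e p (q ∷ qs) (q∉ ∷ u) (here refl) = trans (weight-++ _ (power (e q) (inj₂ q ∷ [])) _)
        (trans (cong₂ _+_
      (trans (step-weight e p q) (trans (cong (e q *_) (δ-same q)) (*-identityʳ (e q))))
      (drain-weight-∉ e p qs λ p∈ → All.lookup q∉ p∈ refl)) (+-identityʳ _))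
    drain-weight-∈ e p (q ∷ qs) (q∉ ∷ u) (there p∈) = trans (weight-++ _ (power (e q) (inj₂ q ∷ [])) _)
        (cong₂ _+_
      (trans (step-weight e p q) (trans (cong (e q *_) (δ-other λ { refl → All.lookup q∉ p∈ refl }))
          (*-zeroʳ (e q)))) (drain-weight-∈ e p qs u p∈))

    drain-sinks : ∀ e qs → (∀ q → e q ≢ 0 → lookup τ q ≡ C) → ∀ {a} → a ∈ drain e qs → a ∈ sinks
    drain-sinks e (q ∷ qs) full a∈ with ∈-++⁻ (power (e q) (inj₂ q ∷ [])) a∈
    ... | inj₂ a∈′ = drain-sinks e qs full a∈′
    ... | inj₁ a∈′ = powers (e q) (full q) a∈′
      where
      powers : ∀ k → (k ≢ 0 → lookup τ q ≡ C) → ∀ {a} → a ∈ power k (inj₂ q ∷ []) → a ∈ sinks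
      powers (suc k) f (here refl) = ∈-map⁺ inj₂ (∈-filter⁺ (λ p → lookup τ p ≟ C) (∈-allFin q) (f λ ()))
      powers (suc zero)    f (there ())
      powers (suc (suc k)) f (there a∈) = powers (suc k) (λ _ → f λ ()) a∈

    class⇒run : ReachesClass C τ → Run problem M₀ᵛ τ
    class⇒run (M , (u , f) , cl) =
        (λ _ → tt) , map inj₁ u , tabulate M , anyWord∈ (map inj₁ u)
            (λ a∈ → case ∈-map⁻ inj₁ a∈ of λ { (t , _ , refl) → ∈-map⁺ inj₁ (∈-allFin t) }) empty
      , (λ p → subst₂ (FireAt p (map inj₁ u)) (sym (lookup∘tabulate (M₀ S) p)) (sym (lookup∘tabulate M p))
          (fire-map inj₁ _ _ u (fires⇒fire f p)))
      , (λ _ → tt) , drain e (allFin |P|) , τ , anyWord∈ (drain e (allFin |P|))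
          (drain-sinks e (allFin |P|) full) empty
      , (λ p → subst (λ m → FireAt p (drain e (allFin |P|)) m (lookup τ p)) (surplus p)
                 (fire-sinks _ _ (drain e (allFin |P|)) (lookup τ p) λ a∈ → sink-post
                     (drain-sinks e (allFin |P|) full a∈) p))
      , refl
      where
      e : Fin |P| → ℕ
      e p = M p ∸ lookup τ p
      full : ∀ q → e q ≢ 0 → lookup τ q ≡ C
      full q ne with ≤-total (M q) C
      ... | inj₁ M≤C = ⊥-elim (ne (trans (cong (M q ∸_) (trans (sym (cl q)) (m≤n⇒m⊓n≡m M≤C))) (n∸n≡0 (M q))))
      ... | inj₂ C≤M = trans (sym (cl q)) (m≥n⇒m⊓n≡n C≤M)
      surplus : ∀ p → weight (λ a → pre⁺ a p) (drain e (allFin |P|)) + lookup τ p ≡ lookup (tabulate M) p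
      surplus p = trans (cong (_+ lookup τ p) (drain-weight-∈ e p (allFin |P|) (allFin⁺ |P|) (∈-allFin p)))
        (trans (m∸n+n≡m (subst (_≤ M p) (cl p) (m⊓n≤m (M p) C))) (sym (lookup∘tabulate M p)))

    reaches-class? : Dec (ReachesClass C τ)
    reaches-class? = map′ run⇒class class⇒run
      (decide problem (letters-frozen (map inj₁ (allFin (nt S))) , letters-frozen sinks , tt) M₀ᵛ τ)

  module _ (a b : Transition S) where

    Within : ℕ → Marking S → Set
    Within k M = Σ (List (Transition S)) λ w → length w ≤ k × Firable S M ((a ∷ w) ∷ʳ b)

    within? : ∀ k M → Dec (Within k M)
    within? k M = map′ (λ any → let w , w∈ , f = find any in w , wordsUpTo-length k w∈ , f)
                       (λ (w , le , f) → lose (wordsUpTo-complete k w le) f)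
                       (Any.any? (λ w → firable? M ((a ∷ w) ∷ʳ b)) (wordsUpTo (nt S) k))

    Violation : ℕ → Marking S → Set
    Violation k M = Enabled S M a × Enabled S M b × ¬ Within k M

    violation? : ∀ k M → Dec (Violation k M)
    violation? k M = enabled? M a ×-dec enabled? M b ×-dec ¬? (within? k M)

    -- The letters `a` and `b` around w account for the two in the truncation level k + 2.
    length-∷ʳ : ∀ (w : List T) {k} → length w ≤ k → length ((a ∷ w) ∷ʳ b) ≤ suc (suc k)
    length-∷ʳ w le = s≤s (subst (_≤ suc _) (sym (trans (length-++ w)
        (+-comm (length w) 1))) (s≤s le))

    violation-trunc : ∀ k M τ → (∀ p → M p ⊓ suc (suc k) ≡ τ p) → Violation k M → Violation k τ
    violation-trunc k M τ cl (ea , eb , no-w) = (λ p → subst (takes p a ≤_) (cl p)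
        (enabled-trunc M a (s≤s z≤n) ea p))
      , (λ p → subst (takes p b ≤_) (cl p) (enabled-trunc M b (s≤s z≤n) eb p))
      , λ (w , le , f) → no-w (w , le , firable-untrunc M _ (firable-cong _ (λ p → sym (cl p)) f))

    violation-untrunc : ∀ k M τ → (∀ p → M p ⊓ suc (suc k) ≡ τ p) → Violation k τ → Violation k M
    violation-untrunc k M τ cl (ea , eb , no-w) = (λ p → ≤-trans (ea p)
        (subst (_≤ M p) (cl p) (m⊓n≤m (M p) _)))
      , (λ p → ≤-trans (eb p) (subst (_≤ M p) (cl p) (m⊓n≤m (M p) _)))
      , λ (w , le , f) → no-w (w , le , firable-cong _ cl (firable-trunc M _ (length-∷ʳ w le) f))

    postpones? : ∀ k → Dec (Postpones S a b k)
    postpones? k with Any.any? test (box C |P|)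
      where
      C = suc (suc k)
      Bad : Vec ℕ |P| → Set
      Bad τ = (∀ p → lookup τ p ≤ C) × Violation k (lookup τ) × ReachesClass C τ
      test : ∀ τ → Dec (Bad τ)
      test τ with Finₚ.all? (λ p → lookup τ p ≤? C)
      ... | no ¬le = no (¬le ∘ proj₁)
      ... | yes le = map′ (le ,_) proj₂ (violation? k (lookup τ) ×-dec reaches-class? C τ le)
    ... | yes any with find any
    ... | τ , _ , _ , viol , M , reach , cl = no λ post → let ea , eb , no-w = violation-untrunc k M (lookup τ) cl viol in no-w (post M reach ea eb)
    postpones? k | no none = yes λ M reach ea eb → decidable-stable (within? k M) λ no-w →
      none (lose (∈-box C (τ M) (λ p → subst (_≤ C) (sym (lookup∘tabulate _ p)) (m⊓n≤n (M p) C)))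
        ( (λ p → subst (_≤ C) (sym (lookup∘tabulate _ p)) (m⊓n≤n (M p) C))
        , violation-trunc k M (lookup (τ M)) (λ p → sym (lookup∘tabulate _ p)) (ea , eb , no-w)
        , M , reach , λ p → sym (lookup∘tabulate _ p)))
      where
      C = suc (suc k)
      τ : Marking S → Vec ℕ |P|
      τ M = tabulate λ p → M p ⊓ C

    -- The target is the preset of `b`, so reaching it means enabling `b`. The candidates depend
    -- neither on the marking nor on `a`, and the longest of them gives the value of k to be tested.
    open Shortening (shorten |P| (λ t p → takes p t) (λ t p → puts p t) (λ t p → takes≤1 p t)
        (λ t p → puts≤1 p t)
                             (λ p → takes p b) (anyWord {d = |P|} (allFin (nt S)) ε)) using
                                 (candidates; reach)

    delay : ℕ
    delay = maxOver length candidates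

    postpones-delay : ∀ k → Postpones S a b k → Postpones S a b delay
    postpones-delay k post M r ea eb with post M r ea eb
    ... | w , _ , N , f = proj₁ short , ≤-maxOver length (proj₁ (proj₂ short))
        , fire⇒fires ((a ∷ proj₁ short) ∷ʳ b) M λ p → fireP p (proj₂ (proj₂ short) p)
      where
      next : Fin |P| → ℕ
      next p = puts p a + (M p ∸ takes p a)
      after-a : ∀ p → FireP p (w ++ b ∷ []) (next p) (N p)
      after-a p with fires⇒fire f p
      ... | x , e , g = subst (λ q → FireP p (w ++ b ∷ []) (puts p a + q) (N p))
          (trans (sym (m+n∸m≡n (takes p a) x)) (cong (_∸ takes p a) (sym e))) g
      mid : ∀ p → ∃ λ y → FireP p w (next p) y × takes p b ≤ y
      mid p with fire-split _ _ w (after-a p)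
      ... | y , g , (x , e , _) = y , g , subst (takes p b ≤_) (sym e) (m≤m+n _ x)
      short : ∃ λ c → c ∈ candidates × (∀ p → ∃ λ z → FireP p c (lookup (tabulate next) p) z × takes p b ≤ z)
      short = reach (tabulate next) (tabulate (λ p → proj₁ (mid p))) (anyWord∈ w (λ _ → ∈-allFin _) empty)
        (λ p → subst₂ (FireP p w) (sym (lookup∘tabulate next p)) (sym (lookup∘tabulate _ p))
            (proj₁ (proj₂ (mid p))))
        (λ p → inj₂ (subst (takes p b ≤_) (sym (lookup∘tabulate _ p)) (proj₂ (proj₂ (mid p)))))
      fireP : ∀ {c} p → (∃ λ z → FireP p c (lookup (tabulate next) p) z × takes p b ≤ z) → ∃ λ n → FireP p
          ((a ∷ c) ∷ʳ b) (M p) n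
      fireP {c} p (z , g , le) = _ , M p ∸ takes p a , sym (m+[n∸m]≡n (ea p))
        , fire-++ _ _ c (subst (λ m → FireP p c m z) (lookup∘tabulate next p) g)
            (z ∸ takes p b , sym (m+[n∸m]≡n le) , refl)

    min-postponement : MinPostponement S a b
    min-postponement with postpones? delay
    ... | yes p = inj₁ (least postpones? delay p)
    ... | no ¬p = inj₂ λ (k , q) → ¬p (postpones-delay k q)

theorem11 : (S : Net) → (a b : Transition S) → MinPostponement S a b
theorem11 S a b = PetriNet.min-postponement S a b
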